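{- Let $W$ be an irreducible $T$-module with endpoint $r$ and diameter $d=D-2r$. Then the following hold for $0\le i,j\le d$ and nonzero vectors $u\in E_rW$, $u^*\in E^*_rW$, $u^{\varepsilon}\in E^{\varepsilon}_rW$. (i) $\langle E_{r+i}u^{\varepsilon},E_{r+j}u^*\rangle=\delta_{ij}\,\mathbf{i}^i\binom{d}{i}(1+\mathbf{i})^{ -d}\langle u^{\varepsilon},u^*\rangle$. (ii) $\langle E^*_{r+i}u,E^*_{r+j}u^{\varepsilon}\rangle=\delta_{ij}\,\mathbf{i}^i\binom{d}{i}(1+\mathbf{i})^{ -d}\langle u,u^{\varepsilon}\rangle$. (iii) $\langle E^{\varepsilon}_{r+i}u^*,E^{\varepsilon}_{r+j}u\rangle=\delta_{ij}\,\mathbf{i}^i\binom{d}{i}(1+\mathbf{i})^{ -d}\langle u^*,u\rangle$.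
   Context: Let $D$ be a positive integer and let $Q_D$ be the $D$-cube: the graph with vertex set $X=\{0,1\}^D$, two vertices being adjacent iff they differ in exactly one coordinate; $\partial$ denotes path-length distance. $\mathrm{Mat}_X(\mathbb{C})$ is the algebra of complex matrices with rows and columns indexed by $X$, acting on $V=\mathbb{C}^X$ (column vectors) by left multiplication. $V$ carries the Hermitian inner product $\langle v,w\rangle=v^t\overline{w}$ (linear in the first argument). Write $\mathbf{i}^2=-1$ (the bold $\mathbf{i}$ is the imaginary unit; the plain $i$ is an index). Let $A$ be the adjacency matrix of $Q_D$. Fix $x=(0,0,\ldots,0)\in X$. Let $A^*$ be the diagonal matrix in $\mathrm{Mat}_X(\mathbb{C})$ with $(y,y)$-entry $D-2\partial(x,y)$ for $y\in X$, and let $A^{\varepsilon}=-\mathbf{i}(AA^*-A^*A)/2$. Let $T$ be the subalgebra of $\mathrm{Mat}_X(\mathbb{C})$ generated by $A$ and $A^*$. The eigenvalues of $A$ are $\theta_i=D-2i$ $(0\le i\le D)$. For $0\le i\le D$: $E_i=\prod_{0\le j\le D,\,j\ne i}\frac{A-\theta_jI}{\theta_i-\theta_j}$ is the primitive idempotent of $A$ for $\theta_i$ (the orthogonal projection onto the $\theta_i$-eigenspace of $A$); $E_i^*$ is the diagonal matrix with $(y,y)$-entry $1$ if $\partial(x,y)=i$ and $0$ otherwise; and $E_i^{\varepsilon}=P^{ -1}E_iP$, where $P=P_1^{\otimes D}$ (Kronecker power, $P_{yz}=\prod_{k=1}^D(P_1)_{y_kz_k}$, invertible) with $P_1=\begin{pmatrix}1&1\\-\mathbf{i}&\mathbf{i}\end{pmatrix}$,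 rows and columns indexed by $0,1$ in that order. ($E_i^*$ and $E_i^{\varepsilon}$ are the primitive idempotents of $A^*$ and $A^{\varepsilon}$ for the eigenvalue $D-2i$.) A $T$-module is a subspace $W\subseteq V$ with $BW\subseteq W$ for all $B\in T$; it is irreducible if $W\ne0$ and it contains no $T$-modules other than $0$ and $W$. The endpoint of an irreducible $T$-module $W$ is $r=\min\{i\mid 0\le i\le D,\ E_i^*W\neq0\}$ (it is known that also $r=\min\{i\mid E_iW\ne0\}$), and its diameter is $d=|\{i\mid 0\le i\le D,\ E_i^*W\ne0\}|-1$; it is known that $d=D-2r$ and $0\le r\le D/2$. -}

module Defs where

open import Algebra.Bundles using (CommutativeRing)
open import Data.Bool.Base using (true; false; _∧_; if_then_else_)
open import Data.Fin.Base using (Fin; zero; suc; toℕ)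
import Data.Fin.Properties as Fin
open import Data.Fin.Subset as Subset using (Subset)
open import Data.Integer.Base as ℤ using (ℤ; +_)
import Data.Integer.Properties as ℤ
import Data.List.Base as List
open import Data.Nat.Base as ℕ using (ℕ; zero; suc; z≤n; s≤s)
import Data.Nat.Properties as ℕ
open import Data.Product.Base using (∃; _×_; _,_; proj₁; proj₂)
open import Data.Rational.Base as ℚ using (ℚ; 0ℚ; 1ℚ; ½; ∣_∣)
import Data.Rational.Literals as ℚ
import Data.Rational.Properties as ℚ
open import Data.Rational.Solver using (module +-*-Solver)
open import Data.Vec.Base using (Vec; []; _∷_; replicate)
import Data.Vec.Properties as Vec
open import Function.Base using (_∘_)
open import Function.Bundles using (_⇔_)
open import Level using (0ℓ)
open import Relation.Binary.Definitions using (DecidableEquality)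
open import Relation.Binary.PropositionalEquality as ≡ using (_≡_; _≢_)
open import Relation.Binary.Structures using (IsEquivalence)
open import Relation.Nullary.Decidable using (yes; no; does)
open import Relation.Nullary.Negation using (¬_)
open import Relation.Unary using (Pred; _∈_; _⊆_; _≐_)

------------------------------------------------------------------------
-- Real numbers: Cauchy sequences of rationals, up to equivalence

-- z m n → 0 as m , n → ∞ independently.
Small : (ℕ → ℕ → ℚ) → Set
Small z = ∀ ε → 0ℚ ℚ.< ε →
  ∃ λ N → ∀ m n → N ℕ.≤ m → N ℕ.≤ n → ∣ z m n ∣ ℚ.< ε

-- No η here and for ℂ below, and operations defined by copatterns, so that
-- conversion checking does not unfold them.
record ℝ : Set where
  no-eta-equality
  constructor mkℝ
  field
    seq    : ℕ → ℚ
    cauchy : Small (λ m n → seq m ℚ.- seq n)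

open ℝ public

-- For Cauchy sequences this is equivalent to seq x n - seq y n → 0.
record _≈ᵣ_ (x y : ℝ) : Set where
  constructor mk≈
  field
    close : Small (λ m n → seq x m ℚ.- seq y n)

open _≈ᵣ_ public

private
  half-pos : ∀ {ε} → 0ℚ ℚ.< ε → 0ℚ ℚ.< ½ ℚ.* ε
  half-pos {ε} 0<ε = ≡.subst (ℚ._< ½ ℚ.* ε) (ℚ.*-zeroʳ ½) (ℚ.*-monoʳ-<-pos ½ 0<ε)

  halves : ∀ ε → ½ ℚ.* ε ℚ.+ ½ ℚ.* ε ≡ ε
  halves ε = ≡.trans (≡.sym (ℚ.*-distribʳ-+ ε ½ ½)) (ℚ.*-identityˡ ε)

  small-resp : ∀ {z w} → (∀ m n → z m n ≡ w m n) → Small z → Small w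
  small-resp eq sz ε 0<ε with N , h ← sz ε 0<ε =
    N , λ m n p q → ≡.subst (λ t → ∣ t ∣ ℚ.< ε) (eq m n) (h m n p q)

  small-+ : ∀ {z w} → Small z → Small w → Small (λ m n → z m n ℚ.+ w m n)
  small-+ {z} {w} sz sw ε 0<ε
    with N , h ← sz (½ ℚ.* ε) (half-pos 0<ε)
       | M , k ← sw (½ ℚ.* ε) (half-pos 0<ε) =
    N ℕ.⊔ M , λ m n p q → ≡.subst (∣ z m n ℚ.+ w m n ∣ ℚ.<_) (halves ε)
      (ℚ.≤-<-trans (ℚ.∣p+q∣≤∣p∣+∣q∣ (z m n) (w m n))
        (ℚ.+-mono-< (h m n (ℕ.m⊔n≤o⇒m≤o N M p) (ℕ.m⊔n≤o⇒m≤o N M q))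
                    (k m n (ℕ.m⊔n≤o⇒n≤o N M p) (ℕ.m⊔n≤o⇒n≤o N M q))))

  small-neg : ∀ {z} → Small z → Small (λ m n → ℚ.- z m n)
  small-neg {z} sz ε 0<ε with N , h ← sz ε 0<ε =
    N , λ m n p q → ≡.subst (ℚ._< ε) (≡.sym (ℚ.∣-p∣≡∣p∣ (z m n))) (h m n p q)

  small-flip : ∀ {z} → Small z → Small (λ m n → z n m)
  small-flip sz ε 0<ε with N , h ← sz ε 0<ε = N , λ m n p q → h n m q p

  Bounded : (ℕ → ℚ) → Set
  Bounded x = ∃ λ B → 0ℚ ℚ.< B × ∃ λ N → ∀ n → N ℕ.≤ n → ∣ x n ∣ ℚ.≤ B

  bounded : ∀ x → Bounded (seq x)
  bounded x with N , h ← cauchy x 1ℚ (ℚ.*<* (ℤ.+<+ (s≤s z≤n))) =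
    1ℚ ℚ.+ ∣ seq x N ∣ ,
    ℚ.<-≤-trans (ℚ.*<* (ℤ.+<+ (s≤s z≤n)))
      (≡.subst (ℚ._≤ 1ℚ ℚ.+ ∣ seq x N ∣) (ℚ.+-identityʳ 1ℚ)
        (ℚ.+-monoʳ-≤ 1ℚ (ℚ.0≤∣p∣ (seq x N)))) ,
    N , λ n p → ≡.subst (λ t → ∣ t ∣ ℚ.≤ 1ℚ ℚ.+ ∣ seq x N ∣) (cancel (seq x n) (seq x N))
      (ℚ.≤-trans (ℚ.∣p+q∣≤∣p∣+∣q∣ (seq x n ℚ.- seq x N) (seq x N))
        (ℚ.+-monoˡ-≤ ∣ seq x N ∣ (ℚ.<⇒≤ (h n N p ℕ.≤-refl))))
    where
    cancel : ∀ a b → (a ℚ.- b) ℚ.+ b ≡ a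
    cancel = solve 2 (λ a b → (a :- b) :+ b := a) ≡.refl
      where open +-*-Solver

  small-scaleˡ : ∀ {z b} → Bounded b → Small z → Small (λ m n → b m ℚ.* z m n)
  small-scaleˡ {z} {b} (B , 0<B , M , bd) sz ε 0<ε =
    N ℕ.⊔ M , λ m n p q → ℚ.≤-<-trans
      (≡.subst (ℚ._≤ B ℚ.* ∣ z m n ∣) (≡.sym (ℚ.∣p*q∣≡∣p∣*∣q∣ (b m) (z m n)))
        (ℚ.*-monoʳ-≤-nonNeg ∣ z m n ∣ {{ℚ.nonNegative (ℚ.0≤∣p∣ (z m n))}}
          (bd m (ℕ.m⊔n≤o⇒n≤o N M p))))
      (≡.subst (B ℚ.* ∣ z m n ∣ ℚ.<_) cancel
        (ℚ.*-monoʳ-<-pos B {{B-pos}}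
          (h m n (ℕ.m⊔n≤o⇒m≤o N M p) (ℕ.m⊔n≤o⇒m≤o N M q))))
    where
    B-pos = ℚ.positive 0<B
    B≢0   = ℚ.pos⇒nonZero B {{B-pos}}
    1/B   = (ℚ.1/ B) {{B≢0}}
    0<1/B*ε : 0ℚ ℚ.< 1/B ℚ.* ε
    0<1/B*ε = ≡.subst (ℚ._< 1/B ℚ.* ε) (ℚ.*-zeroʳ 1/B)
      (ℚ.*-monoʳ-<-pos 1/B {{ℚ.1/pos⇒pos B {{B-pos}}}} 0<ε)
    cancel : B ℚ.* (1/B ℚ.* ε) ≡ ε
    cancel = ≡.trans (≡.sym (ℚ.*-assoc B 1/B ε))
      (≡.trans (≡.cong (ℚ._* ε) (ℚ.*-inverseʳ B {{B≢0}})) (ℚ.*-identityˡ ε))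
    N = proj₁ (sz (1/B ℚ.* ε) 0<1/B*ε)
    h = proj₂ (sz (1/B ℚ.* ε) 0<1/B*ε)

  small-scaleʳ : ∀ {z b} → Bounded b → Small z → Small (λ m n → b n ℚ.* z m n)
  small-scaleʳ bd sz = small-flip (small-scaleˡ bd (small-flip sz))

  add-close : ∀ (x x′ y y′ : ℕ → ℚ) →
    Small (λ m n → x m ℚ.- x′ n) → Small (λ m n → y m ℚ.- y′ n) →
    Small (λ m n → (x m ℚ.+ y m) ℚ.- (x′ n ℚ.+ y′ n))
  add-close x x′ y y′ p q =
    small-resp (λ m n → rearrange (x m) (x′ n) (y m) (y′ n)) (small-+ p q)
    where
    open +-*-Solver
    rearrange : ∀ a b c d → (a ℚ.- b) ℚ.+ (c ℚ.- d) ≡ (a ℚ.+ c) ℚ.- (b ℚ.+ d)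
    rearrange = solve 4 (λ a b c d → (a :- b) :+ (c :- d) := (a :+ c) :- (b :+ d)) ≡.refl

  mul-close : ∀ (x x′ y y′ : ℕ → ℚ) → Bounded x′ → Bounded y →
    Small (λ m n → x m ℚ.- x′ n) → Small (λ m n → y m ℚ.- y′ n) →
    Small (λ m n → (x m ℚ.* y m) ℚ.- (x′ n ℚ.* y′ n))
  mul-close x x′ y y′ bx′ by p q =
    small-resp (λ m n → rearrange (x m) (x′ n) (y m) (y′ n))
      (small-+ (small-scaleˡ by p) (small-scaleʳ bx′ q))
    where
    open +-*-Solver
    rearrange : ∀ a b c d → c ℚ.* (a ℚ.- b) ℚ.+ b ℚ.* (c ℚ.- d) ≡ (a ℚ.* c) ℚ.- (b ℚ.* d)
    rearrange = solve 4 (λ a b c d → c :* (a :- b) :+ b :* (c :- d) := (a :* c) :- (b :* d)) ≡.refl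

  neg-close : ∀ (x x′ : ℕ → ℚ) → Small (λ m n → x m ℚ.- x′ n) →
    Small (λ m n → (ℚ.- x m) ℚ.- (ℚ.- x′ n))
  neg-close x x′ p = small-resp (λ m n → rearrange (x m) (x′ n)) (small-neg p)
    where
    open +-*-Solver
    rearrange : ∀ a b → ℚ.- (a ℚ.- b) ≡ (ℚ.- a) ℚ.- (ℚ.- b)
    rearrange = solve 2 (λ a b → :- (a :- b) := (:- a) :- (:- b)) ≡.refl

infixl 6 _+ᵣ_ _-ᵣ_
infixl 7 _*ᵣ_
infix  8 -ᵣ_
infix  4 _≈ᵣ_

_+ᵣ_ : ℝ → ℝ → ℝ
seq    (x +ᵣ y) n = seq x n ℚ.+ seq y n
cauchy (x +ᵣ y)   = add-close (seq x) (seq x) (seq y) (seq y) (cauchy x) (cauchy y)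

_*ᵣ_ : ℝ → ℝ → ℝ
seq    (x *ᵣ y) n = seq x n ℚ.* seq y n
cauchy (x *ᵣ y)   = mul-close (seq x) (seq x) (seq y) (seq y) (bounded x) (bounded y)
                              (cauchy x) (cauchy y)

-ᵣ_ : ℝ → ℝ
seq    (-ᵣ x) n = ℚ.- seq x n
cauchy (-ᵣ x)   = neg-close (seq x) (seq x) (cauchy x)

_-ᵣ_ : ℝ → ℝ → ℝ
x -ᵣ y = x +ᵣ (-ᵣ y)

fromℚᵣ : ℚ → ℝ
seq    (fromℚᵣ q) _      = q
cauchy (fromℚᵣ q) ε 0<ε =
  0 , λ _ _ _ _ → ≡.subst (λ t → ∣ t ∣ ℚ.< ε) (≡.sym (ℚ.+-inverseʳ q)) 0<ε

0ᵣ 1ᵣ : ℝ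
0ᵣ = fromℚᵣ 0ℚ
1ᵣ = fromℚᵣ 1ℚ

≈ᵣ-pointwise : ∀ {x y} → (∀ n → seq x n ≡ seq y n) → x ≈ᵣ y
≈ᵣ-pointwise {x} eq =
  mk≈ (small-resp (λ m n → ≡.cong (λ t → seq x m ℚ.- t) (eq n)) (cauchy x))

≈ᵣ-isEquivalence : IsEquivalence _≈ᵣ_
≈ᵣ-isEquivalence = record
  { refl  = λ {x} → mk≈ (cauchy x)
  ; sym   = λ {x} {y} p → mk≈
      (small-resp (λ m n → swap (seq x n) (seq y m)) (small-flip (small-neg (close p))))
  ; trans = λ {x} {y} {z} p q → mk≈ (λ ε 0<ε →
      let N , h = close p (½ ℚ.* ε) (half-pos 0<ε)
          M , k = close q (½ ℚ.* ε) (half-pos 0<ε)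
          K     = N ℕ.⊔ M
      in K , λ m n K≤m K≤n →
        ≡.subst (∣ seq x m ℚ.- seq z n ∣ ℚ.<_) (halves ε)
          (ℚ.≤-<-trans
            (≡.subst (λ t → ∣ t ∣ ℚ.≤ ∣ seq x m ℚ.- seq y K ∣ ℚ.+ ∣ seq y K ℚ.- seq z n ∣)
              (join (seq x m) (seq y K) (seq z n))
              (ℚ.∣p+q∣≤∣p∣+∣q∣ (seq x m ℚ.- seq y K) (seq y K ℚ.- seq z n)))
            (ℚ.+-mono-< (h m K (ℕ.m⊔n≤o⇒m≤o N M K≤m) (ℕ.m≤m⊔n N M))
                        (k K n (ℕ.m≤n⊔m N M) (ℕ.m⊔n≤o⇒n≤o N M K≤n)))))
  }
  where
  open +-*-Solver
  swap : ∀ a b → ℚ.- (a ℚ.- b) ≡ b ℚ.- a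
  swap = solve 2 (λ a b → :- (a :- b) := b :- a) ≡.refl
  join : ∀ a b c → (a ℚ.- b) ℚ.+ (b ℚ.- c) ≡ a ℚ.- c
  join = solve 3 (λ a b c → (a :- b) :+ (b :- c) := a :- c) ≡.refl

open IsEquivalence ≈ᵣ-isEquivalence
  renaming (refl to ≈ᵣ-refl; sym to ≈ᵣ-sym; trans to ≈ᵣ-trans)
  using () public

+ᵣ-cong : ∀ {x x′ y y′} → x ≈ᵣ x′ → y ≈ᵣ y′ → x +ᵣ y ≈ᵣ x′ +ᵣ y′
+ᵣ-cong {x} {x′} {y} {y′} p q =
  mk≈ (add-close (seq x) (seq x′) (seq y) (seq y′) (close p) (close q))

*ᵣ-cong : ∀ {x x′ y y′} → x ≈ᵣ x′ → y ≈ᵣ y′ → x *ᵣ y ≈ᵣ x′ *ᵣ y′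
*ᵣ-cong {x} {x′} {y} {y′} p q =
  mk≈ (mul-close (seq x) (seq x′) (seq y) (seq y′) (bounded x′) (bounded y)
    (close p) (close q))

-ᵣ-cong : ∀ {x x′} → x ≈ᵣ x′ → -ᵣ x ≈ᵣ -ᵣ x′
-ᵣ-cong {x} {x′} p = mk≈ (neg-close (seq x) (seq x′) (close p))

ℝ-commutativeRing : CommutativeRing 0ℓ 0ℓ
ℝ-commutativeRing = record
  { Carrier = ℝ
  ; _≈_     = _≈ᵣ_
  ; _+_     = _+ᵣ_
  ; _*_     = _*ᵣ_
  ; -_      = -ᵣ_
  ; 0#      = 0ᵣ
  ; 1#      = 1ᵣ
  ; isCommutativeRing = record
    { isRing = record
      { +-isAbelianGroup = record
        { isGroup = record
          { isMonoid = record
            { isSemigroup = record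
              { isMagma = record { isEquivalence = ≈ᵣ-isEquivalence ; ∙-cong = +ᵣ-cong }
              ; assoc   = +-assoc
              }
            ; identity = +-identityˡ , +-identityʳ
            }
          ; inverse = -‿inverseˡ , -‿inverseʳ
          ; ⁻¹-cong = -ᵣ-cong
          }
        ; comm = +-comm
        }
      ; *-cong     = *ᵣ-cong
      ; *-assoc    = *-assoc
      ; *-identity = *-identityˡ , *-identityʳ
      ; distrib    = *-distribˡ , *-distribʳ
      }
    ; *-comm = *-comm
    }
  }
  where
  +-assoc : ∀ x y z → (x +ᵣ y) +ᵣ z ≈ᵣ x +ᵣ (y +ᵣ z)
  +-assoc x y z = ≈ᵣ-pointwise (λ n → ℚ.+-assoc (seq x n) (seq y n) (seq z n))
  +-comm : ∀ x y → x +ᵣ y ≈ᵣ y +ᵣ x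
  +-comm x y = ≈ᵣ-pointwise (λ n → ℚ.+-comm (seq x n) (seq y n))
  +-identityˡ : ∀ x → 0ᵣ +ᵣ x ≈ᵣ x
  +-identityˡ x = ≈ᵣ-pointwise (λ n → ℚ.+-identityˡ (seq x n))
  +-identityʳ : ∀ x → x +ᵣ 0ᵣ ≈ᵣ x
  +-identityʳ x = ≈ᵣ-pointwise (λ n → ℚ.+-identityʳ (seq x n))
  -‿inverseˡ : ∀ x → (-ᵣ x) +ᵣ x ≈ᵣ 0ᵣ
  -‿inverseˡ x = ≈ᵣ-pointwise (λ n → ℚ.+-inverseˡ (seq x n))
  -‿inverseʳ : ∀ x → x +ᵣ (-ᵣ x) ≈ᵣ 0ᵣ
  -‿inverseʳ x = ≈ᵣ-pointwise (λ n → ℚ.+-inverseʳ (seq x n))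
  *-assoc : ∀ x y z → (x *ᵣ y) *ᵣ z ≈ᵣ x *ᵣ (y *ᵣ z)
  *-assoc x y z = ≈ᵣ-pointwise (λ n → ℚ.*-assoc (seq x n) (seq y n) (seq z n))
  *-comm : ∀ x y → x *ᵣ y ≈ᵣ y *ᵣ x
  *-comm x y = ≈ᵣ-pointwise (λ n → ℚ.*-comm (seq x n) (seq y n))
  *-identityˡ : ∀ x → 1ᵣ *ᵣ x ≈ᵣ x
  *-identityˡ x = ≈ᵣ-pointwise (λ n → ℚ.*-identityˡ (seq x n))
  *-identityʳ : ∀ x → x *ᵣ 1ᵣ ≈ᵣ x
  *-identityʳ x = ≈ᵣ-pointwise (λ n → ℚ.*-identityʳ (seq x n))
  *-distribˡ : ∀ x y z → x *ᵣ (y +ᵣ z) ≈ᵣ x *ᵣ y +ᵣ x *ᵣ z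
  *-distribˡ x y z = ≈ᵣ-pointwise (λ n → ℚ.*-distribˡ-+ (seq x n) (seq y n) (seq z n))
  *-distribʳ : ∀ x y z → (y +ᵣ z) *ᵣ x ≈ᵣ y *ᵣ x +ᵣ z *ᵣ x
  *-distribʳ x y z = ≈ᵣ-pointwise (λ n → ℚ.*-distribʳ-+ (seq x n) (seq y n) (seq z n))

------------------------------------------------------------------------
-- Complex numbers

infix 5 _+i_

record ℂ : Set where
  no-eta-equality
  constructor _+i_
  field
    re im : ℝ

open ℂ public

infix 4 _≈ᶜ_

record _≈ᶜ_ (z w : ℂ) : Set where
  constructor mk≈ᶜ
  field
    re-≈ : re z ≈ᵣ re w
    im-≈ : im z ≈ᵣ im w

open _≈ᶜ_ public

private
  module ComplexLaws (R : CommutativeRing 0ℓ 0ℓ) where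
    open CommutativeRing R
    open import Algebra.Properties.Ring ring using (-‿distribˡ-*; -‿distribʳ-*)
    open import Algebra.Properties.AbelianGroup +-abelianGroup using (⁻¹-∙-comm; ε⁻¹≈ε)
    open import Algebra.Properties.CommutativeSemigroup +-commutativeSemigroup
      using (interchange)

    cross : ∀ {p q r s} → (p + q) + (r + s) ≈ (p + r) + (s + q)
    cross {p} {q} {r} {s} = trans (interchange p q r s) (+-congˡ (+-comm q s))

    -[x+y]z : ∀ x y z → - ((x + y) * z) ≈ - (x * z) + - (y * z)
    -[x+y]z x y z = trans (-‿cong (distribʳ z x y)) (sym (⁻¹-∙-comm (x * z) (y * z)))

    -z[x+y] : ∀ z x y → - (z * (x + y)) ≈ - (z * x) + - (z * y)
    -z[x+y] z x y = trans (-‿cong (distribˡ z x y)) (sym (⁻¹-∙-comm (z * x) (z * y)))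

    [x-y]z : ∀ x y z → (x + - y) * z ≈ x * z + - (y * z)
    [x-y]z x y z = trans (distribʳ z x (- y)) (+-congˡ (sym (-‿distribˡ-* y z)))

    z[x-y] : ∀ z x y → z * (x + - y) ≈ z * x + - (z * y)
    z[x-y] z x y = trans (distribˡ z x (- y)) (+-congˡ (sym (-‿distribʳ-* z y)))

    assoc-re : ∀ a b c d e f →
      (a * c - b * d) * e - (a * d + b * c) * f ≈ a * (c * e - d * f) - b * (c * f + d * e)
    assoc-re a b c d e f = begin
      (a * c - b * d) * e - (a * d + b * c) * f
        ≈⟨ +-cong ([x-y]z (a * c) (b * d) e) (-[x+y]z (a * d) (b * c) f) ⟩
      (a * c * e - b * d * e) + (- (a * d * f) - b * c * f)
        ≈⟨ cross ⟩
      (a * c * e - a * d * f) + (- (b * c * f) - b * d * e)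
        ≈⟨ +-cong (+-cong (*-assoc a c e) (-‿cong (*-assoc a d f)))
                  (+-cong (-‿cong (*-assoc b c f)) (-‿cong (*-assoc b d e))) ⟩
      (a * (c * e) - a * (d * f)) + (- (b * (c * f)) - b * (d * e))
        ≈⟨ +-cong (z[x-y] a (c * e) (d * f)) (-z[x+y] b (c * f) (d * e)) ⟨
      a * (c * e - d * f) - b * (c * f + d * e) ∎
      where open import Relation.Binary.Reasoning.Setoid setoid

    assoc-im : ∀ a b c d e f →
      (a * c - b * d) * f + (a * d + b * c) * e ≈ a * (c * f + d * e) + b * (c * e - d * f)
    assoc-im a b c d e f = begin
      (a * c - b * d) * f + (a * d + b * c) * e
        ≈⟨ +-cong ([x-y]z (a * c) (b * d) f) (distribʳ e (a * d) (b * c)) ⟩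
      (a * c * f - b * d * f) + (a * d * e + b * c * e)
        ≈⟨ cross ⟩
      (a * c * f + a * d * e) + (b * c * e - b * d * f)
        ≈⟨ +-cong (+-cong (*-assoc a c f) (*-assoc a d e))
                  (+-cong (*-assoc b c e) (-‿cong (*-assoc b d f))) ⟩
      (a * (c * f) + a * (d * e)) + (b * (c * e) - b * (d * f))
        ≈⟨ +-cong (distribˡ a (c * f) (d * e)) (z[x-y] b (c * e) (d * f)) ⟨
      a * (c * f + d * e) + b * (c * e - d * f) ∎
      where open import Relation.Binary.Reasoning.Setoid setoid

    identity-re : ∀ a b → 1# * a - 0# * b ≈ a
    identity-re a b = trans
      (+-cong (*-identityˡ a) (trans (-‿cong (zeroˡ b)) ε⁻¹≈ε)) (+-identityʳ a)

    identity-im : ∀ a b → 1# * b + 0# * a ≈ b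
    identity-im a b = trans (+-cong (*-identityˡ b) (zeroˡ a)) (+-identityʳ b)

    distribˡ-re : ∀ a b c d e f →
      a * (c + e) - b * (d + f) ≈ (a * c - b * d) + (a * e - b * f)
    distribˡ-re a b c d e f = trans
      (+-cong (distribˡ a c e) (-z[x+y] b d f))
      (interchange (a * c) (a * e) (- (b * d)) (- (b * f)))

    distribˡ-im : ∀ a b c d e f →
      a * (d + f) + b * (c + e) ≈ (a * d + b * c) + (a * f + b * e)
    distribˡ-im a b c d e f = trans
      (+-cong (distribˡ a d f) (distribˡ b c e))
      (interchange (a * d) (a * f) (b * c) (b * e))

    comm-re : ∀ a b c d → a * c - b * d ≈ c * a - d * b
    comm-re a b c d = +-cong (*-comm a c) (-‿cong (*-comm b d))

    comm-im : ∀ a b c d → a * d + b * c ≈ c * b + d * a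
    comm-im a b c d = trans (+-comm (a * d) (b * c)) (+-cong (*-comm b c) (*-comm a d))

infixl 6 _+ᶜ_
infixl 7 _*ᶜ_
infix  8 -ᶜ_

_+ᶜ_ _*ᶜ_ : ℂ → ℂ → ℂ
re (z +ᶜ w) = re z +ᵣ re w
im (z +ᶜ w) = im z +ᵣ im w
re (z *ᶜ w) = re z *ᵣ re w -ᵣ im z *ᵣ im w
im (z *ᶜ w) = re z *ᵣ im w +ᵣ im z *ᵣ re w

-ᶜ_ : ℂ → ℂ
re (-ᶜ z) = -ᵣ re z
im (-ᶜ z) = -ᵣ im z

fromℚ : ℚ → ℂ
fromℚ q = fromℚᵣ q +i 0ᵣ

0ᶜ 1ᶜ : ℂ
0ᶜ = fromℚ 0ℚ
1ᶜ = fromℚ 1ℚ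

ℂ-commutativeRing : CommutativeRing 0ℓ 0ℓ
ℂ-commutativeRing = record
  { Carrier = ℂ
  ; _≈_     = _≈ᶜ_
  ; _+_     = _+ᶜ_
  ; _*_     = _*ᶜ_
  ; -_      = -ᶜ_
  ; 0#      = 0ᶜ
  ; 1#      = 1ᶜ
  ; isCommutativeRing = record
    { isRing = record
      { +-isAbelianGroup = record
        { isGroup = record
          { isMonoid = record
            { isSemigroup = record
              { isMagma = record { isEquivalence = isEquivalence ; ∙-cong = +-cong }
              ; assoc   = +-assoc
              }
            ; identity = +-identityˡ , +-identityʳ
            }
          ; inverse = -‿inverseˡ , -‿inverseʳ
          ; ⁻¹-cong = -‿cong
          }
        ; comm = +-comm
        }
      ; *-cong     = *-cong
      ; *-assoc    = *-assoc
      ; *-identity = *-identityˡ , *-identityʳ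
      ; distrib    = *-distribˡ , *-distribʳ
      }
    ; *-comm = *-comm
    }
  }
  where
  module R = CommutativeRing ℝ-commutativeRing
  open ComplexLaws ℝ-commutativeRing
  ≈-trans : ∀ {x y z} → x ≈ᶜ y → y ≈ᶜ z → x ≈ᶜ z
  ≈-trans p q = mk≈ᶜ (≈ᵣ-trans (re-≈ p) (re-≈ q)) (≈ᵣ-trans (im-≈ p) (im-≈ q))
  isEquivalence : IsEquivalence _≈ᶜ_
  isEquivalence = record
    { refl  = mk≈ᶜ ≈ᵣ-refl ≈ᵣ-refl
    ; sym   = λ p → mk≈ᶜ (≈ᵣ-sym (re-≈ p)) (≈ᵣ-sym (im-≈ p))
    ; trans = ≈-trans
    }
  +-cong : ∀ {x x′ y y′} → x ≈ᶜ x′ → y ≈ᶜ y′ → x +ᶜ y ≈ᶜ x′ +ᶜ y′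
  +-cong p q = mk≈ᶜ (+ᵣ-cong (re-≈ p) (re-≈ q)) (+ᵣ-cong (im-≈ p) (im-≈ q))
  +-assoc : ∀ x y z → (x +ᶜ y) +ᶜ z ≈ᶜ x +ᶜ (y +ᶜ z)
  +-assoc x y z = mk≈ᶜ (R.+-assoc (re x) (re y) (re z)) (R.+-assoc (im x) (im y) (im z))
  +-comm : ∀ x y → x +ᶜ y ≈ᶜ y +ᶜ x
  +-comm x y = mk≈ᶜ (R.+-comm (re x) (re y)) (R.+-comm (im x) (im y))
  +-identityˡ : ∀ x → 0ᶜ +ᶜ x ≈ᶜ x
  +-identityˡ x = mk≈ᶜ (R.+-identityˡ (re x)) (R.+-identityˡ (im x))
  +-identityʳ : ∀ x → x +ᶜ 0ᶜ ≈ᶜ x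
  +-identityʳ x = ≈-trans (+-comm x 0ᶜ) (+-identityˡ x)
  -‿inverseˡ : ∀ x → (-ᶜ x) +ᶜ x ≈ᶜ 0ᶜ
  -‿inverseˡ x = mk≈ᶜ (R.-‿inverseˡ (re x)) (R.-‿inverseˡ (im x))
  -‿inverseʳ : ∀ x → x +ᶜ (-ᶜ x) ≈ᶜ 0ᶜ
  -‿inverseʳ x = ≈-trans (+-comm x (-ᶜ x)) (-‿inverseˡ x)
  -‿cong : ∀ {x x′} → x ≈ᶜ x′ → -ᶜ x ≈ᶜ -ᶜ x′
  -‿cong p = mk≈ᶜ (-ᵣ-cong (re-≈ p)) (-ᵣ-cong (im-≈ p))
  *-cong : ∀ {x x′ y y′} → x ≈ᶜ x′ → y ≈ᶜ y′ → x *ᶜ y ≈ᶜ x′ *ᶜ y′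
  *-cong p q = mk≈ᶜ
    (+ᵣ-cong (*ᵣ-cong (re-≈ p) (re-≈ q)) (-ᵣ-cong (*ᵣ-cong (im-≈ p) (im-≈ q))))
    (+ᵣ-cong (*ᵣ-cong (re-≈ p) (im-≈ q)) (*ᵣ-cong (im-≈ p) (re-≈ q)))
  *-assoc : ∀ x y z → (x *ᶜ y) *ᶜ z ≈ᶜ x *ᶜ (y *ᶜ z)
  *-assoc x y z = mk≈ᶜ
    (assoc-re (re x) (im x) (re y) (im y) (re z) (im z))
    (assoc-im (re x) (im x) (re y) (im y) (re z) (im z))
  *-comm : ∀ x y → x *ᶜ y ≈ᶜ y *ᶜ x
  *-comm x y = mk≈ᶜ
    (comm-re (re x) (im x) (re y) (im y))
    (comm-im (re x) (im x) (re y) (im y))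
  *-identityˡ : ∀ x → 1ᶜ *ᶜ x ≈ᶜ x
  *-identityˡ x = mk≈ᶜ (identity-re (re x) (im x)) (identity-im (re x) (im x))
  *-identityʳ : ∀ x → x *ᶜ 1ᶜ ≈ᶜ x
  *-identityʳ x = ≈-trans (*-comm x 1ᶜ) (*-identityˡ x)
  *-distribˡ : ∀ x y z → x *ᶜ (y +ᶜ z) ≈ᶜ x *ᶜ y +ᶜ x *ᶜ z
  *-distribˡ x y z = mk≈ᶜ
    (distribˡ-re (re x) (im x) (re y) (im y) (re z) (im z))
    (distribˡ-im (re x) (im x) (re y) (im y) (re z) (im z))
  *-distribʳ : ∀ x y z → (y +ᶜ z) *ᶜ x ≈ᶜ y *ᶜ x +ᶜ z *ᶜ x
  *-distribʳ x y z = ≈-trans (*-comm (y +ᶜ z) x)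
    (≈-trans (*-distribˡ x y z) (+-cong (*-comm x y) (*-comm x z)))

open CommutativeRing ℂ-commutativeRing public
  using (_≈_; _+_; _*_; -_; _-_; 0#; 1#)
open CommutativeRing ℂ-commutativeRing
  using (semiring; setoid; trans; *-cong; *-congʳ; *-identityˡ; zeroˡ; zeroʳ; distribˡ; +-cong)
  renaming (refl to ≈-refl; sym to ≈-sym)
open import Algebra.Properties.CommutativeSemigroup
  (CommutativeRing.*-commutativeSemigroup ℂ-commutativeRing) using (interchange)
open import Algebra.Properties.Semiring.Exp semiring public using (_^_)
open import Algebra.Properties.Semiring.Sum semiring public
  using (sum; sum-cong-≋; *-distribˡ-sum; *-distribʳ-sum)

conj : ℂ → ℂ
conj z = re z +i -ᵣ im z

𝕚 : ℂ
𝕚 = 0ᵣ +i 1ᵣ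

fromℤ : ℤ → ℂ
fromℤ = fromℚ ∘ ℚ.fromℤ

fromℕ : ℕ → ℂ
fromℕ n = fromℤ (+ n)

δ : ℕ → ℕ → ℂ
δ i j = if does (i ℕ.≟ j) then 1# else 0#

private
  rational-≈ : ∀ {z w} → (∀ n → seq (re z) n ≡ seq (re w) n) →
               (∀ n → seq (im z) n ≡ seq (im w) n) → z ≈ w
  rational-≈ p q = mk≈ᶜ (≈ᵣ-pointwise p) (≈ᵣ-pointwise q)

𝕚*𝕚≈-1 : 𝕚 * 𝕚 ≈ - 1#
𝕚*𝕚≈-1 = rational-≈ (λ _ → ≡.refl) (λ _ → ≡.refl)

[1+𝕚]⁻¹ : ℂ
[1+𝕚]⁻¹ = fromℚᵣ ½ +i fromℚᵣ (ℚ.- ½)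

[1+𝕚]⁻¹-inverse : (1# + 𝕚) * [1+𝕚]⁻¹ ≈ 1#
[1+𝕚]⁻¹-inverse = rational-≈ (λ _ → ≡.refl) (λ _ → ≡.refl)

------------------------------------------------------------------------
-- The D-cube

Vertex : ℕ → Set
Vertex D = Vec (Fin 2) D

_≟ᵥ_ : ∀ {D} → DecidableEquality (Vertex D)
_≟ᵥ_ = Vec.≡-dec Fin._≟_

differsAt : Fin 2 → Fin 2 → ℕ
differsAt a b = if does (a Fin.≟ b) then 0 else 1

#differences : ∀ {D} → Vertex D → Vertex D → ℕ
#differences []      []      = 0
#differences (a ∷ y) (b ∷ z) = differsAt a b ℕ.+ #differences y z

Adjacent : ∀ {D} → Vertex D → Vertex D → Set
Adjacent y z = #differences y z ≡ 1

data Walk {D : ℕ} : ℕ → Vertex D → Vertex D → Set where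
  nil  : ∀ {y} → Walk 0 y y
  step : ∀ {n x y z} → Adjacent x y → Walk n y z → Walk (suc n) x z

private
  differsAt-refl : ∀ a → differsAt a a ≡ 0
  differsAt-refl zero       = ≡.refl
  differsAt-refl (suc zero) = ≡.refl

  differsAt-triangle : ∀ a b c → differsAt a c ℕ.≤ differsAt a b ℕ.+ differsAt b c
  differsAt-triangle zero       b          zero       = z≤n
  differsAt-triangle zero       zero       (suc zero) = ℕ.≤-refl
  differsAt-triangle zero       (suc zero) (suc zero) = ℕ.≤-refl
  differsAt-triangle (suc zero) zero       zero       = ℕ.≤-refl
  differsAt-triangle (suc zero) (suc zero) zero       = ℕ.≤-refl
  differsAt-triangle (suc zero) b          (suc zero) = z≤n

  #differences-refl : ∀ {D} (y : Vertex D) → #differences y y ≡ 0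
  #differences-refl []      = ≡.refl
  #differences-refl (a ∷ y) = ≡.cong₂ ℕ._+_ (differsAt-refl a) (#differences-refl y)

  #differences-triangle : ∀ {D} (x y z : Vertex D) →
    #differences x z ℕ.≤ #differences x y ℕ.+ #differences y z
  #differences-triangle []      []      []      = z≤n
  #differences-triangle (a ∷ x) (b ∷ y) (c ∷ z) = ℕ.≤-trans
    (ℕ.+-mono-≤ (differsAt-triangle a b c) (#differences-triangle x y z))
    (ℕ.≤-reflexive (+-interchange (differsAt a b) (differsAt b c) _ _))
    where
    open import Algebra.Properties.CommutativeSemigroup ℕ.+-commutativeSemigroup
      renaming (interchange to +-interchange)

  prepend : ∀ {D n} {y z : Vertex D} a → Walk n y z → Walk n (a ∷ y) (a ∷ z)
  prepend a nil        = nil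
  prepend a (step p w) =
    step (≡.cong₂ ℕ._+_ (differsAt-refl a) p) (prepend a w)

  shortestWalk : ∀ {D} (y z : Vertex D) → Walk (#differences y z) y z
  shortestWalk []      []      = nil
  shortestWalk (a ∷ y) (b ∷ z) with a Fin.≟ b in eq
  ... | yes ≡.refl = prepend a (shortestWalk y z)
  ... | no  _      = step
    (≡.cong₂ ℕ._+_ (≡.cong (λ t → if does t then 0 else 1) eq) (#differences-refl y))
    (prepend b (shortestWalk y z))

  walk-bound : ∀ {D n} {y z : Vertex D} → Walk n y z → #differences y z ℕ.≤ n
  walk-bound {y = y} nil = ℕ.≤-reflexive (#differences-refl y)
  walk-bound (step {x = x} {y} {z} p w) = ℕ.≤-trans (#differences-triangle x y z)
    (ℕ.+-mono-≤ (ℕ.≤-reflexive p) (walk-bound w))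

pathLengthDistance : ∀ {D} (y z : Vertex D) →
  ∃ λ n → Walk n y z × (∀ m → Walk m y z → n ℕ.≤ m)
pathLengthDistance y z = #differences y z , shortestWalk y z , λ _ → walk-bound

∂ : ∀ {D} → Vertex D → Vertex D → ℕ
∂ y z = proj₁ (pathLengthDistance y z)

𝐱 : ∀ {D} → Vertex D
𝐱 = replicate _ zero

------------------------------------------------------------------------
-- Vectors and matrices indexed by the vertices

Vect : ℕ → Set
Vect D = Vertex D → ℂ

Mat : ℕ → Set
Mat D = Vertex D → Vertex D → ℂ

∑ : ∀ {D} → (Vertex D → ℂ) → ℂ
∑ {zero}  f = f []
∑ {suc D} f = sum (λ a → ∑ (λ y → f (a ∷ y)))

infix  4 _≈ᵥ_ _≈ₘ_
infixl 6 _+ᵥ_ _+ₘ_ _-ₘ_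
infixl 7 _·_
infixr 7 _∙_ _*ᵥ_ _*ₘ_

_≈ᵥ_ : ∀ {D} → Vect D → Vect D → Set
v ≈ᵥ w = ∀ y → v y ≈ w y

0ᵥ : ∀ {D} → Vect D
0ᵥ _ = 0#

_+ᵥ_ : ∀ {D} → Vect D → Vect D → Vect D
(v +ᵥ w) y = v y + w y

_*ᵥ_ : ∀ {D} → ℂ → Vect D → Vect D
(c *ᵥ v) y = c * v y

⟨_,_⟩ : ∀ {D} → Vect D → Vect D → ℂ
⟨ v , w ⟩ = ∑ (λ y → v y * conj (w y))

_≈ₘ_ : ∀ {D} → Mat D → Mat D → Set
M ≈ₘ N = ∀ y z → M y z ≈ N y z

diag : ∀ {D} → (Vertex D → ℂ) → Mat D
diag f y z = if does (y ≟ᵥ z) then f y else 0#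

I : ∀ {D} → Mat D
I = diag (λ _ → 1#)

_+ₘ_ _-ₘ_ _·_ : ∀ {D} → Mat D → Mat D → Mat D
(M +ₘ N) y z = M y z + N y z
(M -ₘ N) y z = M y z - N y z
(M · N) y z = ∑ (λ w → M y w * N w z)

_*ₘ_ : ∀ {D} → ℂ → Mat D → Mat D
(c *ₘ M) y z = c * M y z

_∙_ : ∀ {D} → Mat D → Vect D → Vect D
(M ∙ v) y = ∑ (λ z → M y z * v z)

------------------------------------------------------------------------
-- The matrices A, A* and the algebra T

A : ∀ {D} → Mat D
A y z = if does (#differences y z ℕ.≟ 1) then 1# else 0#

θ : ℕ → ℕ → ℤ
θ D i = + D ℤ.- + (2 ℕ.* i)

A* : ∀ {D} → Mat D
A* {D} = diag (λ y → fromℤ (θ D (∂ 𝐱 y)))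

data T {D : ℕ} : Mat D → Set where
  A∈T   : T A
  A*∈T  : T A*
  I∈T   : T I
  +-∈T  : ∀ {M N} → T M → T N → T (M +ₘ N)
  ·-∈T  : ∀ {M N} → T M → T N → T (M · N)
  *-∈T  : ∀ c {M} → T M → T (c *ₘ M)
  ≈-∈T  : ∀ {M N} → M ≈ₘ N → T M → T N

------------------------------------------------------------------------
-- Primitive idempotents

θ-injective : ∀ D {i j} → θ D i ≡ θ D j → i ≡ j
θ-injective D {i} {j} eq = ℕ.*-cancelˡ-≡ i j 2
  (ℤ.+-injective (ℤ.neg-injective (∙-cancelˡ (+ D) _ _ eq)))
  where open import Algebra.Properties.AbelianGroup ℤ.+-0-abelianGroup using (∙-cancelˡ)

1/[θᵢ-θⱼ] : ∀ D {i j} → i ≢ j → ℚ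
1/[θᵢ-θⱼ] D {i} {j} i≢j = (ℚ.1/ ℚ.fromℤ (θ D i ℤ.- θ D j))
  {{ℤ.≢-nonZero (λ eq → i≢j (θ-injective D (ℤ.i-j≡0⇒i≡j (θ D i) (θ D j) eq)))}}

E-factor : ∀ {D} → ℕ → ℕ → Mat D
E-factor {D} i j with i ℕ.≟ j
... | yes _   = I
... | no  i≢j = fromℚ (1/[θᵢ-θⱼ] D i≢j) *ₘ (A -ₘ fromℤ (θ D j) *ₘ I)

-- The indices i are natural numbers; only 0 ≤ i ≤ D is meaningful in E and Eε.
E : ∀ {D} → ℕ → Mat D
E {D} i = List.foldr _·_ I (List.map (E-factor i) (List.upTo (suc D)))

E* : ∀ {D} → ℕ → Mat D
E* i = diag (λ y → δ (∂ 𝐱 y) i)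

Mat₂ : Set
Mat₂ = Fin 2 → Fin 2 → ℂ

infix 8 _^⊗

_^⊗ : ∀ {D} → Mat₂ → Mat D
(M ^⊗) []      []      = 1#
(M ^⊗) (a ∷ y) (b ∷ z) = M a b * (M ^⊗) y z

P₁ : Mat₂
P₁ zero       zero       = 1#
P₁ zero       (suc zero) = 1#
P₁ (suc zero) zero       = - 𝕚
P₁ (suc zero) (suc zero) = 𝕚

P₁⁻¹ : Mat₂
P₁⁻¹ zero       zero       = fromℚ ½
P₁⁻¹ zero       (suc zero) = fromℚ ½ * 𝕚
P₁⁻¹ (suc zero) zero       = fromℚ ½
P₁⁻¹ (suc zero) (suc zero) = - (fromℚ ½ * 𝕚)

P P⁻¹ : ∀ {D} → Mat D
P   = P₁ ^⊗
P⁻¹ = P₁⁻¹ ^⊗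

private
  I₂ : Mat₂
  I₂ a b = if does (a Fin.≟ b) then 1# else 0#

  _·₂_ : Mat₂ → Mat₂ → Mat₂
  (M ·₂ N) a c = sum (λ b → M a b * N b c)

  ∑-cong : ∀ {D} {f g : Vertex D → ℂ} → (∀ y → f y ≈ g y) → ∑ f ≈ ∑ g
  ∑-cong {zero}  p = p []
  ∑-cong {suc D} p = sum-cong-≋ (λ a → ∑-cong (λ y → p (a ∷ y)))

  ∑-*ˡ : ∀ {D} c (f : Vertex D → ℂ) → ∑ (λ y → c * f y) ≈ c * ∑ f
  ∑-*ˡ {zero}  c f = ≈-refl
  ∑-*ˡ {suc D} c f = trans
    (sum-cong-≋ (λ a → ∑-*ˡ c (λ y → f (a ∷ y))))
    (≈-sym (*-distribˡ-sum c (λ a → ∑ (λ y → f (a ∷ y)))))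

  ^⊗-· : ∀ {D} M N → (M ^⊗) · (N ^⊗) ≈ₘ _^⊗ {D} (M ·₂ N)
  ^⊗-· M N []      []      = *-identityˡ 1#
  ^⊗-· M N (a ∷ y) (c ∷ z) = begin
    sum (λ b → ∑ (λ w → (M a b * (M ^⊗) y w) * (N b c * (N ^⊗) w z)))
      ≈⟨ sum-cong-≋ (λ b → trans
           (∑-cong (λ w → interchange (M a b) ((M ^⊗) y w) (N b c) ((N ^⊗) w z)))
           (∑-*ˡ (M a b * N b c) (λ w → (M ^⊗) y w * (N ^⊗) w z))) ⟩
    sum (λ b → (M a b * N b c) * ((M ^⊗) · (N ^⊗)) y z)
      ≈⟨ *-distribʳ-sum (((M ^⊗) · (N ^⊗)) y z) (λ b → M a b * N b c) ⟨
    (M ·₂ N) a c * ((M ^⊗) · (N ^⊗)) y z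
      ≈⟨ *-cong ≈-refl (^⊗-· M N y z) ⟩
    (M ·₂ N) a c * ((M ·₂ N) ^⊗) y z ∎
    where open import Relation.Binary.Reasoning.Setoid setoid

  ^⊗-I : ∀ {D M} → (∀ a b → M a b ≈ I₂ a b) → (M ^⊗) ≈ₘ I {D}
  ^⊗-I p []      []      = ≈-refl
  ^⊗-I p (a ∷ y) (b ∷ z) =
    trans (*-cong (p a b) (^⊗-I p y z)) (if-* (does (a Fin.≟ b)) (does (y ≟ᵥ z)))
    where
    if-* : ∀ s t → (if s then 1# else 0#) * (if t then 1# else 0#)
                 ≈ (if s ∧ t then 1# else 0#)
    if-* true  t = *-identityˡ _
    if-* false t = zeroˡ _

  P₁·P₁⁻¹ : ∀ a b → (P₁ ·₂ P₁⁻¹) a b ≈ I₂ a b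
  P₁·P₁⁻¹ zero       zero       = rational-≈ (λ _ → ≡.refl) (λ _ → ≡.refl)
  P₁·P₁⁻¹ zero       (suc zero) = rational-≈ (λ _ → ≡.refl) (λ _ → ≡.refl)
  P₁·P₁⁻¹ (suc zero) zero       = rational-≈ (λ _ → ≡.refl) (λ _ → ≡.refl)
  P₁·P₁⁻¹ (suc zero) (suc zero) = rational-≈ (λ _ → ≡.refl) (λ _ → ≡.refl)

  P₁⁻¹·P₁ : ∀ a b → (P₁⁻¹ ·₂ P₁) a b ≈ I₂ a b
  P₁⁻¹·P₁ zero       zero       = rational-≈ (λ _ → ≡.refl) (λ _ → ≡.refl)
  P₁⁻¹·P₁ zero       (suc zero) = rational-≈ (λ _ → ≡.refl) (λ _ → ≡.refl)
  P₁⁻¹·P₁ (suc zero) zero       = rational-≈ (λ _ → ≡.refl) (λ _ → ≡.refl)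
  P₁⁻¹·P₁ (suc zero) (suc zero) = rational-≈ (λ _ → ≡.refl) (λ _ → ≡.refl)

P·P⁻¹≈I : ∀ {D} → P · P⁻¹ ≈ₘ I {D}
P·P⁻¹≈I y z = trans (^⊗-· P₁ P₁⁻¹ y z) (^⊗-I P₁·P₁⁻¹ y z)

P⁻¹·P≈I : ∀ {D} → P⁻¹ · P ≈ₘ I {D}
P⁻¹·P≈I y z = trans (^⊗-· P₁⁻¹ P₁ y z) (^⊗-I P₁⁻¹·P₁ y z)

Eε : ∀ {D} → ℕ → Mat D
Eε i = P⁻¹ · E i · P

------------------------------------------------------------------------
-- T-modules

record Subspace (D : ℕ) : Set₁ where
  field
    member : Pred (Vect D) 0ℓ
    resp   : ∀ {v w} → v ≈ᵥ w → v ∈ member → w ∈ member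
    0∈     : 0ᵥ ∈ member
    +∈     : ∀ {v w} → v ∈ member → w ∈ member → v +ᵥ w ∈ member
    *∈     : ∀ c {v} → v ∈ member → c *ᵥ v ∈ member

open Subspace public

IsZero : ∀ {D} → Pred (Vect D) 0ℓ → Set
IsZero S = ∀ {v} → v ∈ S → v ≈ᵥ 0ᵥ

_[_] : ∀ {D} → Mat D → Subspace D → Pred (Vect D) 0ℓ
(M [ W ]) v = ∃ λ w → w ∈ member W × v ≈ᵥ M ∙ w

IsTModule : ∀ {D} → Subspace D → Set
IsTModule W = ∀ {B} → T B → ∀ {w} → w ∈ member W → B ∙ w ∈ member W

record IsIrreducible {D : ℕ} (W : Subspace D) : Set₁ where
  field
    isTModule : IsTModule W
    nonzero   : ¬ IsZero (member W)
    -- Negative form: a disjunction "U = 0 or U = W" would not be provable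
    -- constructively even for one-dimensional W.
    simple    : ¬ (∃ λ U → IsTModule U × member U ⊆ member W ×
                           ¬ IsZero (member U) × ¬ (member U ≐ member W))

record IsEndpoint {D : ℕ} (W : Subspace D) (r : ℕ) : Set where
  field
    r≤D     : r ℕ.≤ D
    nonzero : ¬ IsZero (E* r [ W ])
    least   : ∀ i → i ℕ.≤ D → ¬ IsZero (E* i [ W ]) → r ℕ.≤ i

-- d = |{ i | 0 ≤ i ≤ D , E* i W ≠ 0 }| - 1
record IsDiameter {D : ℕ} (W : Subspace D) (d : ℕ) : Set where
  field
    support   : Subset (suc D)
    ∈-support : ∀ i → i Subset.∈ support ⇔ (¬ IsZero (E* (toℕ i) [ W ]))
    size      : Subset.∣ support ∣ ≡ suc d

{-# OPTIONS --safe #-}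

-- P is √2^D times a unitary matrix, conjugation by P permutes A, A* and Aε cyclically,
-- and P preserves every T-module, because it is a multiple of (Σₖ 𝕚^k E k)(Σₖ 𝕚^k E* k).
-- Hence all three parts reduce to one statement about vectors a and b such that P a and
-- P² b are highest weight vectors for A*: they are supported on Hamming weight r and killed by
-- the operator N lowering that weight. Carrying these conditions back along P gives
--   N a = (D - r - k) a  and  Nᵀ b = 𝕚 (k - r) b  on vertices of weight k,
-- and the adjointness of N and Nᵀ turns them into a first-order recurrence for
-- x k = ⟨ E* k a , b ⟩ whose solution is x (r + i) = 𝕚^i (d C i) x r. The sum of all x k is
-- ⟨ a , b ⟩, so the binomial theorem gives x r = (1 + 𝕚)^-d ⟨ a , b ⟩.
-- The relations for a and the antipodal symmetry of the cube show that E* k W ≠ 0 exactly for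
-- r ≤ k ≤ D - r, so d = D - 2 r.
module Submission where

open import Defs
open import Algebra.Bundles using (CommutativeRing; RawRing)
import Algebra.Properties.CommutativeSemiring.Binomial
import Algebra.Properties.Semiring.Exp
import Algebra.Properties.Semiring.Mult
import Algebra.Solver.Ring
open import Algebra.Solver.Ring.AlmostCommutativeRing
  using (fromCommutativeRing; _-Raw-AlmostCommutative⟶_)
open import Data.Bool.Base using (if_then_else_)
open import Data.Fin.Base using (Fin; zero; suc; toℕ)
open import Data.Fin.Patterns using (0F; 1F)
open import Data.Fin.Subset as Subset using (Subset; inside; outside)
open import Data.Fin.Subset.Properties using (drop-there)
open import Data.Integer.Base as ℤ using (ℤ; +_)
import Data.Integer.Properties as ℤ
open import Data.List.Base as List using (List; []; _∷_)
import Data.List.Membership.Propositional as List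
open import Data.List.Membership.Propositional.Properties using (∈-upTo⁺)
import Data.List.Relation.Unary.Any as Any
open import Data.Maybe.Base using (Maybe; just; nothing)
open import Data.Nat.Base as ℕ using (ℕ; zero; suc; _≤_; _<_; z≤n; s≤s)
open import Data.Nat.Combinatorics using (_C_; nCk+nC[k+1]≡[n+1]C[k+1]; nC1≡n)
import Data.Nat.Properties as ℕ
open import Data.Nat.Solver renaming (module +-*-Solver to ℕ-Solver)
open import Data.Product.Base using (∃; _×_; _,_; proj₁; proj₂)
open import Data.Rational.Base as ℚ using (ℚ; 0ℚ; 1ℚ; ½; ∣_∣)
import Data.Rational.Literals as ℚ
import Data.Rational.Properties as ℚ
open import Data.Rational.Solver renaming (module +-*-Solver to ℚ-Solver)
open import Data.Rational.Unnormalised.Base using (*≡*)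
import Data.Rational.Unnormalised.Properties as ℚᵘ
open import Data.Sum.Base using (inj₁; inj₂)
open import Data.Vec.Base using ([]; _∷_; here; there)
open import Function.Base using (_∘_)
open import Function.Bundles using (module Equivalence)
open import Level using (0ℓ)
open import Relation.Binary.PropositionalEquality as ≡ using (_≡_; _≢_)
open import Relation.Nullary.Decidable using (yes; no; does; dec-true; dec-false; decidable-stable)
open import Relation.Nullary.Negation using (¬_; contradiction)
open import Relation.Unary using (_∈_)

open CommutativeRing ℂ-commutativeRing using
  ( setoid; semiring; commutativeSemiring; +-cong; +-congˡ; +-congʳ; *-cong; *-congˡ; *-congʳ; -‿cong
  ; +-comm; +-identityˡ; +-identityʳ; *-assoc; *-comm; *-identityˡ; *-identityʳ; zeroˡ; zeroʳ)
  renaming (refl to ≈-refl; sym to ≈-sym; trans to ≈-trans; reflexive to ≈-reflexive)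

-- The vectors `a` and `b` are two of `u`, `u*`, `uε` moved by `P` zero, one or two times. Since
-- `P₁` cubed is the scalar 2 - 2𝕚, the condition on `P a` or `P² b` always comes back, up to a
-- scalar, to the weight r component of a vector of W. Such a component is killed by `N` because A =
-- N + Nᵀ and vectors of W vanish below weight r. The powers of 𝕚 arise because the two conditions
-- sit at different powers of `P`: carried back through `P`, σᶻ becomes the real matrix σˣ, but
-- through `P²` it becomes the imaginary antisymmetric matrix with entries 𝕚 and -𝕚. Two constraints
-- shape the development. Identities on the cube have to be brought down to 2 × 2 matrices, where
-- they hold by computation; hence matrices given by sums over vertices are rewritten as operators
-- recursive in the coordinates. And equality of complex numbers is undecidable, so inverses are
-- explicit, and vanishing below the endpoint is recovered from its double negation.

private variable
  D : ℕ

open ℕ-Solver using () renaming (solve to solveℕ; con to conℕ; _:=_ to _:=ℕ_; _:+_ to _:+ℕ_; _:*_ to _:*ℕ_)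

-- Absorption identity for binomial coefficients

nC0≡1 : ∀ m → m C 0 ≡ 1
nC0≡1 zero    = ≡.refl
nC0≡1 (suc m) = ≡.refl

-- This is (k+1) C(m,k+1) = (m-k) C(m,k) in additive form, which avoids truncated subtraction and so
-- also covers k > m. Induction along Pascal's rule.
C-absorption : ∀ m k → suc k ℕ.* (m C suc k) ℕ.+ k ℕ.* (m C k) ≡ m ℕ.* (m C k)
C-absorption zero    zero    = ≡.refl
C-absorption zero    (suc k) = ≡.cong₂ ℕ._+_ (ℕ.*-zeroʳ (suc (suc k))) (ℕ.*-zeroʳ (suc k))
C-absorption (suc m) zero    = ≡.trans (ℕ.+-identityʳ _)
  (≡.trans (ℕ.*-identityˡ _) (≡.trans (nC1≡n (suc m)) (≡.sym (ℕ.*-identityʳ (suc m)))))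
C-absorption (suc m) (suc k) = begin
  suc (suc k) ℕ.* (suc m C suc (suc k)) ℕ.+ suc k ℕ.* (suc m C suc k)
    ≡⟨ ≡.cong₂ (λ p q → suc (suc k) ℕ.* p ℕ.+ suc k ℕ.* q)
         (nCk+nC[k+1]≡[n+1]C[k+1] m (suc k)) (nCk+nC[k+1]≡[n+1]C[k+1] m k) ⟨
  suc (suc k) ℕ.* (y ℕ.+ z) ℕ.+ suc k ℕ.* (x ℕ.+ y)
    -- Regrouped so that the induction hypotheses at `suc k` and at `k` both appear, with one copy
    -- of x + y left over.
    ≡⟨ solveℕ 4 (λ k x y z → (conℕ 2 :+ℕ k) :*ℕ (y :+ℕ z) :+ℕ (conℕ 1 :+ℕ k) :*ℕ (x :+ℕ y)
         :=ℕ ((conℕ 2 :+ℕ k) :*ℕ z :+ℕ (conℕ 1 :+ℕ k) :*ℕ y)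
            :+ℕ (((conℕ 1 :+ℕ k) :*ℕ y :+ℕ k :*ℕ x) :+ℕ (x :+ℕ y))) ≡.refl k x y z ⟩
  (suc (suc k) ℕ.* z ℕ.+ suc k ℕ.* y) ℕ.+ ((suc k ℕ.* y ℕ.+ k ℕ.* x) ℕ.+ (x ℕ.+ y))
    ≡⟨ ≡.cong₂ (λ p q → p ℕ.+ (q ℕ.+ (x ℕ.+ y))) (C-absorption m (suc k)) (C-absorption m k) ⟩
  m ℕ.* y ℕ.+ (m ℕ.* x ℕ.+ (x ℕ.+ y))
    ≡⟨ solveℕ 3 (λ m x y → m :*ℕ y :+ℕ (m :*ℕ x :+ℕ (x :+ℕ y)) :=ℕ (conℕ 1 :+ℕ m) :*ℕ (x :+ℕ y))
        ≡.refl m x y ⟩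
  suc m ℕ.* (x ℕ.+ y)
    ≡⟨ ≡.cong (suc m ℕ.*_) (nCk+nC[k+1]≡[n+1]C[k+1] m k) ⟩
  suc m ℕ.* (suc m C suc k) ∎
  where
  open ≡.≡-Reasoning
  x = m C k
  y = m C suc k
  z = m C suc (suc k)

open import Relation.Binary.Reasoning.Setoid setoid
open ℚ-Solver using () renaming (solve to solveℚ; con to conℚ; _:=_ to _:=ℚ_
  ; _:+_ to _:+ℚ_; _:*_ to _:*ℚ_; _:-_ to _:-ℚ_; :-_ to :-ℚ_)

-- Complex numbers

≈-pointwise : ∀ {z w} → (∀ n → seq (re z) n ≡ seq (re w) n) →
              (∀ n → seq (im z) n ≡ seq (im w) n) → z ≈ w
≈-pointwise p q = mk≈ᶜ (≈ᵣ-pointwise p) (≈ᵣ-pointwise q)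

-- With these coefficients the ring solver knows 𝕚 * 𝕚 ≈ - 1# and ½ + ½ ≈ 1#.
GaussianRational : RawRing 0ℓ 0ℓ
GaussianRational = record
  { Carrier = ℚ × ℚ
  ; _≈_ = _≡_
  ; _+_ = λ (a , b) (c , d) → a ℚ.+ c , b ℚ.+ d
  ; _*_ = λ (a , b) (c , d) → a ℚ.* c ℚ.- b ℚ.* d , a ℚ.* d ℚ.+ b ℚ.* c
  ; -_  = λ (a , b) → ℚ.- a , ℚ.- b
  ; 0#  = 0ℚ , 0ℚ
  ; 1#  = 1ℚ , 0ℚ
  }

⟦_⟧ᵍ : ℚ × ℚ → ℂ
⟦ a , b ⟧ᵍ = fromℚᵣ a +i fromℚᵣ b

GaussianRational⟶ℂ : GaussianRational -Raw-AlmostCommutative⟶ fromCommutativeRing ℂ-commutativeRing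
GaussianRational⟶ℂ = record
  { ⟦_⟧    = ⟦_⟧ᵍ
  ; +-homo = λ _ _ → ≈-pointwise (λ _ → ≡.refl) (λ _ → ≡.refl)
  ; *-homo = λ _ _ → ≈-pointwise (λ _ → ≡.refl) (λ _ → ≡.refl)
  ; -‿homo = λ _ → ≈-pointwise (λ _ → ≡.refl) (λ _ → ≡.refl)
  ; 0-homo = ≈-refl
  ; 1-homo = ≈-refl
  }

_≟ᵍ_ : ∀ p q → Maybe (⟦ p ⟧ᵍ ≈ ⟦ q ⟧ᵍ)
(a , b) ≟ᵍ (c , d) with a ℚ.≟ c | b ℚ.≟ d
... | yes ≡.refl | yes ≡.refl = just ≈-refl
... | _          | _          = nothing

open Algebra.Solver.Ring GaussianRational
  (fromCommutativeRing ℂ-commutativeRing) GaussianRational⟶ℂ _≟ᵍ_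
  using (solve; _:=_; _:+_; _:*_; _:-_; :-_; con; Polynomial)

:0 :1 :𝕚 :½ : ∀ {n} → Polynomial n
:0 = con (0ℚ , 0ℚ)
:1 = con (1ℚ , 0ℚ)
:𝕚 = con (0ℚ , 1ℚ)
:½ = con (½ , 0ℚ)

-- IsEndpoint.least gives the vanishing of E* i W for i < r only up to double negation.
≈ᵣ-stable : ∀ {x y} → ¬ ¬ (x ≈ᵣ y) → x ≈ᵣ y
≈ᵣ-stable {x} {y} ¬¬x≈y = mk≈ λ ε 0<ε →
  let
    q     = ½ ℚ.* ε
    t     = ½ ℚ.* q
    K , h = cauchy x q (half-pos 0<ε)
    L , k = cauchy y t (half-pos (half-pos 0<ε))
  -- The bound K ⊔ L comes from the Cauchy moduli alone. For fixed m and n the claim is a decidable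
  -- inequality of rationals, so the doubly negated hypothesis may be used for it; the index M that
  -- depends on that hypothesis occurs only there.
  in K ℕ.⊔ L , λ m n K⊔L≤m K⊔L≤n → decidable-stable (_ ℚ.<? _) λ ¬small → ¬¬x≈y λ x≈y →
  let
    N , l = close x≈y t (half-pos (half-pos 0<ε))
    M     = (K ℕ.⊔ L) ℕ.⊔ N
    K≤M   = ℕ.m⊔n≤o⇒m≤o K L (ℕ.m≤m⊔n (K ℕ.⊔ L) N)
    L≤M   = ℕ.m⊔n≤o⇒n≤o K L (ℕ.m≤m⊔n (K ℕ.⊔ L) N)
    N≤M   = ℕ.m≤n⊔m (K ℕ.⊔ L) N
  in ¬small (≡.subst₂ (λ a b → ∣ a ∣ ℚ.< b)
    (telescope (seq x m) (seq x M) (seq y M) (seq y n)) (quarters ε)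
    (ℚ.≤-<-trans
      (ℚ.≤-trans (ℚ.∣p+q∣≤∣p∣+∣q∣ (seq x m ℚ.- seq x M) _)
        (ℚ.+-monoʳ-≤ ∣ seq x m ℚ.- seq x M ∣ (ℚ.∣p+q∣≤∣p∣+∣q∣ (seq x M ℚ.- seq y M) _)))
      (ℚ.+-mono-< (h m M (ℕ.m⊔n≤o⇒m≤o K L K⊔L≤m) K≤M)
        (ℚ.+-mono-< (l M M N≤M N≤M) (k M n L≤M (ℕ.m⊔n≤o⇒n≤o K L K⊔L≤n))))))
  where
  half-pos : ∀ {ε} → 0ℚ ℚ.< ε → 0ℚ ℚ.< ½ ℚ.* ε
  half-pos {ε} 0<ε = ≡.subst (ℚ._< ½ ℚ.* ε) (ℚ.*-zeroʳ ½) (ℚ.*-monoʳ-<-pos ½ 0<ε)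
  telescope : ∀ a b c d → (a ℚ.- b) ℚ.+ ((b ℚ.- c) ℚ.+ (c ℚ.- d)) ≡ a ℚ.- d
  telescope = solveℚ 4 (λ a b c d → (a :-ℚ b) :+ℚ ((b :-ℚ c) :+ℚ (c :-ℚ d)) :=ℚ a :-ℚ d) ≡.refl
  quarters : ∀ ε → ½ ℚ.* ε ℚ.+ (½ ℚ.* (½ ℚ.* ε) ℚ.+ ½ ℚ.* (½ ℚ.* ε)) ≡ ε
  quarters = solveℚ 1 (λ ε → conℚ ½ :*ℚ ε :+ℚ (conℚ ½ :*ℚ (conℚ ½ :*ℚ ε) :+ℚ conℚ ½ :*ℚ (conℚ ½ :*ℚ ε)) :=ℚ ε) ≡.refl

≈-stable : ∀ {z w} → ¬ ¬ (z ≈ w) → z ≈ w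
≈-stable ¬¬p = mk≈ᶜ (≈ᵣ-stable (λ ¬p → ¬¬p (λ p → ¬p (re-≈ p))))
                    (≈ᵣ-stable (λ ¬p → ¬¬p (λ p → ¬p (im-≈ p))))

fromℚ-homo-* : ∀ p q → fromℚ (p ℚ.* q) ≈ fromℚ p * fromℚ q
fromℚ-homo-* p q = ≈-pointwise
  (λ _ → solveℚ 2 (λ p q → p :*ℚ q :=ℚ p :*ℚ q :-ℚ conℚ 0ℚ :*ℚ conℚ 0ℚ) ≡.refl p q)
  (λ _ → solveℚ 2 (λ p q → conℚ 0ℚ :=ℚ p :*ℚ conℚ 0ℚ :+ℚ conℚ 0ℚ :*ℚ q) ≡.refl p q)

fromℤ-homo-+ : ∀ i j → fromℤ (i ℤ.+ j) ≈ fromℤ i + fromℤ j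
fromℤ-homo-+ i j = ≈-pointwise (λ _ → ≡.sym eq) (λ _ → ≡.refl)
  where
  eq : ℚ.fromℤ i ℚ.+ ℚ.fromℤ j ≡ ℚ.fromℤ (i ℤ.+ j)
  eq = ℚ.toℚᵘ-injective (ℚᵘ.≃-trans (ℚ.toℚᵘ-homo-+ (ℚ.fromℤ i) (ℚ.fromℤ j))
    (*≡* (≡.cong (ℤ._* + 1) (≡.cong₂ ℤ._+_ (ℤ.*-identityʳ i) (ℤ.*-identityʳ j)))))

fromℤ-homo-* : ∀ i j → fromℤ (i ℤ.* j) ≈ fromℤ i * fromℤ j
fromℤ-homo-* i j = ≈-trans (≈-reflexive (≡.cong fromℚ (≡.sym eq))) (fromℚ-homo-* (ℚ.fromℤ i) (ℚ.fromℤ j))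
  where
  eq : ℚ.fromℤ i ℚ.* ℚ.fromℤ j ≡ ℚ.fromℤ (i ℤ.* j)
  eq = ℚ.toℚᵘ-injective (ℚᵘ.≃-trans (ℚ.toℚᵘ-homo-* (ℚ.fromℤ i) (ℚ.fromℤ j)) (*≡* ≡.refl))

fromℤ-homo-neg : ∀ i → fromℤ (ℤ.- i) ≈ - fromℤ i
fromℤ-homo-neg i = ≈-pointwise (λ _ → eq i) (λ _ → ≡.refl)
  where
  eq : ∀ i → ℚ.fromℤ (ℤ.- i) ≡ ℚ.- ℚ.fromℤ i
  eq (+ zero)     = ≡.refl
  eq (+ suc n)    = ≡.refl
  eq ℤ.-[1+ n ]   = ≡.refl

fromℕ-suc : ∀ n → fromℕ (suc n) ≈ 1# + fromℕ n
fromℕ-suc n = fromℤ-homo-+ (+ 1) (+ n)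

fromℕ-homo-+ : ∀ m n → fromℕ (m ℕ.+ n) ≈ fromℕ m + fromℕ n
fromℕ-homo-+ m n = fromℤ-homo-+ (+ m) (+ n)

fromℕ-homo-* : ∀ m n → fromℕ (m ℕ.* n) ≈ fromℕ m * fromℕ n
fromℕ-homo-* m n = ≈-trans (≈-reflexive (≡.cong fromℤ (ℤ.pos-* m n))) (fromℤ-homo-* (+ m) (+ n))

2ᶜ : ℂ
2ᶜ = 1# + 1#

θ-≈ : ∀ D k → fromℤ (θ D k) ≈ fromℕ D - 2ᶜ * fromℕ k
θ-≈ D k = begin
  fromℤ (θ D k)                       ≈⟨ fromℤ-homo-+ (+ D) _ ⟩
  fromℕ D + fromℤ (ℤ.- + (2 ℕ.* k))   ≈⟨ +-congˡ (fromℤ-homo-neg (+ (2 ℕ.* k))) ⟩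
  fromℕ D - fromℕ (2 ℕ.* k)           ≈⟨ +-congˡ (-‿cong (fromℕ-homo-* 2 k)) ⟩
  fromℕ D - fromℕ 2 * fromℕ k         ≈⟨ +-congˡ (-‿cong (*-congʳ (fromℕ-homo-+ 1 1))) ⟩
  fromℕ D - 2ᶜ * fromℕ k ∎

-- The inverse is passed explicitly, since a refutation of `c ≈ 0#` does not constructively yield
-- one. The scalars cancelled below are positive naturals and powers of 2.
invertible-cancelˡ : ∀ {c c⁻¹ z w} → c⁻¹ * c ≈ 1# → c * z ≈ c * w → z ≈ w
invertible-cancelˡ {c} {c⁻¹} {z} {w} inv eq = begin
  z              ≈⟨ *-identityˡ z ⟨
  1# * z         ≈⟨ *-congʳ inv ⟨
  c⁻¹ * c * z    ≈⟨ *-assoc c⁻¹ c z ⟩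
  c⁻¹ * (c * z)  ≈⟨ *-congˡ eq ⟩
  c⁻¹ * (c * w)  ≈⟨ *-assoc c⁻¹ c w ⟨
  c⁻¹ * c * w    ≈⟨ *-congʳ inv ⟩
  1# * w         ≈⟨ *-identityˡ w ⟩
  w              ∎

fromℕ-suc-inverse : ∀ n → fromℚ (ℚ.1/ ℚ.fromℤ (+ suc n)) * fromℕ (suc n) ≈ 1#
fromℕ-suc-inverse n = ≈-trans (≈-sym (fromℚ-homo-* _ (ℚ.fromℤ (+ suc n))))
  (≈-reflexive (≡.cong fromℚ (ℚ.*-inverseˡ (ℚ.fromℤ (+ suc n)))))

-- Operators on ℂ^X

∑-cong : {f g : Vertex D → ℂ} → (∀ y → f y ≈ g y) → ∑ f ≈ ∑ g
∑-cong {zero}  p = p []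
∑-cong {suc D} p = sum-cong-≋ (λ a → ∑-cong (λ y → p (a ∷ y)))

∑-split : (f : Vertex (suc D) → ℂ) → ∑ f ≈ ∑ (λ y → f (0F ∷ y)) + ∑ (λ y → f (1F ∷ y))
∑-split f = +-congˡ (+-identityʳ _)

∑-+ : (f g : Vertex D → ℂ) → ∑ (λ y → f y + g y) ≈ ∑ f + ∑ g
∑-+ {zero}  f g = ≈-refl
∑-+ {suc D} f g = begin
  ∑ (λ y → f y + g y)
    ≈⟨ ∑-split (λ y → f y + g y) ⟩
  ∑ (λ y → f (0F ∷ y) + g (0F ∷ y)) + ∑ (λ y → f (1F ∷ y) + g (1F ∷ y))
    ≈⟨ +-cong (∑-+ (λ y → f (0F ∷ y)) (λ y → g (0F ∷ y)))
              (∑-+ (λ y → f (1F ∷ y)) (λ y → g (1F ∷ y))) ⟩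
  (∑ (λ y → f (0F ∷ y)) + ∑ (λ y → g (0F ∷ y))) +
  (∑ (λ y → f (1F ∷ y)) + ∑ (λ y → g (1F ∷ y)))
    ≈⟨ solve 4 (λ a b c d → (a :+ b) :+ (c :+ d) := (a :+ c) :+ (b :+ d)) ≈-refl _ _ _ _ ⟩
  (∑ (λ y → f (0F ∷ y)) + ∑ (λ y → f (1F ∷ y))) +
  (∑ (λ y → g (0F ∷ y)) + ∑ (λ y → g (1F ∷ y)))
    ≈⟨ +-cong (∑-split f) (∑-split g) ⟨
  ∑ f + ∑ g ∎

∑-*ˡ : ∀ c (f : Vertex D → ℂ) → ∑ (λ y → c * f y) ≈ c * ∑ f
∑-*ˡ {zero}  c f = ≈-refl
∑-*ˡ {suc D} c f = ≈-trans (sum-cong-≋ (λ a → ∑-*ˡ c (λ y → f (a ∷ y))))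
  (≈-sym (*-distribˡ-sum c (λ a → ∑ (λ y → f (a ∷ y)))))

∑-*ʳ : ∀ c (f : Vertex D → ℂ) → ∑ (λ y → f y * c) ≈ ∑ f * c
∑-*ʳ c f = begin
  ∑ (λ y → f y * c) ≈⟨ ∑-cong (λ y → *-comm (f y) c) ⟩
  ∑ (λ y → c * f y) ≈⟨ ∑-*ˡ c f ⟩
  c * ∑ f           ≈⟨ *-comm c (∑ f) ⟩
  ∑ f * c           ∎

∑-comm : ∀ {E} (f : Vertex D → Vertex E → ℂ) →
  ∑ (λ y → ∑ (λ z → f y z)) ≈ ∑ (λ z → ∑ (λ y → f y z))
∑-comm {zero}  f = ≈-refl
∑-comm {suc D} f = begin
  ∑ (λ y → ∑ (f y))
    ≈⟨ ∑-split (λ y → ∑ (f y)) ⟩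
  ∑ (λ y → ∑ (f (0F ∷ y))) + ∑ (λ y → ∑ (f (1F ∷ y)))
    ≈⟨ +-cong (∑-comm (λ y → f (0F ∷ y))) (∑-comm (λ y → f (1F ∷ y))) ⟩
  ∑ (λ z → ∑ (λ y → f (0F ∷ y) z)) + ∑ (λ z → ∑ (λ y → f (1F ∷ y) z))
    ≈⟨ ∑-+ (λ z → ∑ (λ y → f (0F ∷ y) z)) (λ z → ∑ (λ y → f (1F ∷ y) z)) ⟨
  ∑ (λ z → ∑ (λ y → f (0F ∷ y) z) + ∑ (λ y → f (1F ∷ y) z))
    ≈⟨ ∑-cong (λ z → ∑-split (λ y → f y z)) ⟨
  ∑ (λ z → ∑ (λ y → f y z)) ∎

∙-cong : (M : Mat D) {v w : Vect D} → v ≈ᵥ w → M ∙ v ≈ᵥ M ∙ w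
∙-cong M p y = ∑-cong (λ z → *-congˡ (p z))

∙-congˡ : {M N : Mat D} → M ≈ₘ N → ∀ v → M ∙ v ≈ᵥ N ∙ v
∙-congˡ p v y = ∑-cong (λ z → *-congʳ (p y z))

·-∙ : (M N : Mat D) (v : Vect D) → (M · N) ∙ v ≈ᵥ M ∙ N ∙ v
·-∙ M N v y = begin
  ∑ (λ z → ∑ (λ w → M y w * N w z) * v z)
    ≈⟨ ∑-cong (λ z → ∑-*ʳ (v z) (λ w → M y w * N w z)) ⟨
  ∑ (λ z → ∑ (λ w → M y w * N w z * v z))
    ≈⟨ ∑-comm (λ z w → M y w * N w z * v z) ⟩
  ∑ (λ w → ∑ (λ z → M y w * N w z * v z))
    ≈⟨ ∑-cong (λ w → ∑-cong (λ z → *-assoc (M y w) (N w z) (v z))) ⟩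
  ∑ (λ w → ∑ (λ z → M y w * (N w z * v z)))
    ≈⟨ ∑-cong (λ w → ∑-*ˡ (M y w) (λ z → N w z * v z)) ⟩
  ∑ (λ w → M y w * ∑ (λ z → N w z * v z)) ∎

*ₘ-∙ : ∀ c (M : Mat D) v → (c *ₘ M) ∙ v ≈ᵥ c *ᵥ (M ∙ v)
*ₘ-∙ c M v y = ≈-trans (∑-cong (λ z → *-assoc c (M y z) (v z))) (∑-*ˡ c (λ z → M y z * v z))

-ₘ-∙ : (M N : Mat D) (v : Vect D) → ∀ y → ((M -ₘ N) ∙ v) y ≈ (M ∙ v) y - (N ∙ v) y
-ₘ-∙ M N v y = begin
  ∑ (λ z → (M y z - N y z) * v z)
    ≈⟨ ∑-cong (λ z → solve 3 (λ m n x → (m :- n) :* x := m :* x :+ (:- :1) :* (n :* x))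
        ≈-refl (M y z) (N y z) (v z)) ⟩
  ∑ (λ z → M y z * v z + (- 1#) * (N y z * v z))
    ≈⟨ ∑-+ (λ z → M y z * v z) (λ z → (- 1#) * (N y z * v z)) ⟩
  (M ∙ v) y + ∑ (λ z → (- 1#) * (N y z * v z))
    ≈⟨ +-congˡ (∑-*ˡ (- 1#) (λ z → N y z * v z)) ⟩
  (M ∙ v) y + (- 1#) * (N ∙ v) y
    ≈⟨ solve 2 (λ a b → a :+ (:- :1) :* b := a :- b) ≈-refl _ _ ⟩
  (M ∙ v) y - (N ∙ v) y ∎

diag-∙ : (f : Vertex D → ℂ) (v : Vect D) → ∀ y → (diag f ∙ v) y ≈ f y * v y
diag-∙ f v []       = ≈-refl
diag-∙ f v (0F ∷ y) = begin
  (diag f ∙ v) (0F ∷ y)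
    ≈⟨ ∑-split (λ z → diag f (0F ∷ y) z * v z) ⟩
  (diag (f ∘ (0F ∷_)) ∙ (v ∘ (0F ∷_))) y + ∑ (λ z → 0# * v (1F ∷ z))
    ≈⟨ +-cong (diag-∙ (f ∘ (0F ∷_)) (v ∘ (0F ∷_)) y)
         (≈-trans (∑-*ˡ 0# (λ z → v (1F ∷ z))) (zeroˡ _)) ⟩
  f (0F ∷ y) * v (0F ∷ y) + 0#
    ≈⟨ +-identityʳ _ ⟩
  f (0F ∷ y) * v (0F ∷ y) ∎
diag-∙ f v (1F ∷ y) = begin
  (diag f ∙ v) (1F ∷ y)
    ≈⟨ ∑-split (λ z → diag f (1F ∷ y) z * v z) ⟩
  ∑ (λ z → 0# * v (0F ∷ z)) + (diag (f ∘ (1F ∷_)) ∙ (v ∘ (1F ∷_))) y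
    ≈⟨ +-cong (≈-trans (∑-*ˡ 0# (λ z → v (0F ∷ z))) (zeroˡ _))
         (diag-∙ (f ∘ (1F ∷_)) (v ∘ (1F ∷_)) y) ⟩
  0# + f (1F ∷ y) * v (1F ∷ y)
    ≈⟨ +-identityˡ _ ⟩
  f (1F ∷ y) * v (1F ∷ y) ∎

-- K^⊗ and Σₖ 1 ⊗ … ⊗ M ⊗ … ⊗ 1 as operators, by recursion on the number of factors.
tensor : Mat₂ → Vect D → Vect D
tensor {zero}  K v []      = v []
tensor {suc D} K v (a ∷ y) =
  K a 0F * tensor K (v ∘ (0F ∷_)) y + K a 1F * tensor K (v ∘ (1F ∷_)) y

derivation : Mat₂ → Vect D → Vect D
derivation {zero}  M v []      = 0#
derivation {suc D} M v (a ∷ y) =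
  (M a 0F * v (0F ∷ y) + M a 1F * v (1F ∷ y)) + derivation M (v ∘ (a ∷_)) y

^⊗-∙ : ∀ K (v : Vect D) → K ^⊗ ∙ v ≈ᵥ tensor K v
^⊗-∙ K v []      = *-identityˡ _
^⊗-∙ K v (a ∷ y) = begin
  (K ^⊗ ∙ v) (a ∷ y)
    ≈⟨ ∑-split (λ z → (K ^⊗) (a ∷ y) z * v z) ⟩
  ∑ (λ z → (K a 0F * (K ^⊗) y z) * v (0F ∷ z)) + ∑ (λ z → (K a 1F * (K ^⊗) y z) * v (1F ∷ z))
    ≈⟨ +-cong (part 0F) (part 1F) ⟩
  tensor K v (a ∷ y) ∎
  where
  part : ∀ b → ∑ (λ z → (K a b * (K ^⊗) y z) * v (b ∷ z)) ≈ K a b * tensor K (v ∘ (b ∷_)) y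
  part b = ≈-trans (∑-cong (λ z → *-assoc (K a b) ((K ^⊗) y z) (v (b ∷ z))))
    (≈-trans (∑-*ˡ (K a b) (λ z → (K ^⊗) y z * v (b ∷ z))) (*-congˡ (^⊗-∙ K (v ∘ (b ∷_)) y)))

σˣ σᶻ n nᵀ : Mat₂
σˣ 0F 0F = 0#
σˣ 0F 1F = 1#
σˣ 1F 0F = 1#
σˣ 1F 1F = 0#
σᶻ 0F 0F = 1#
σᶻ 0F 1F = 0#
σᶻ 1F 0F = 0#
σᶻ 1F 1F = - 1#
n 0F 0F = 0#
n 0F 1F = 1#
n 1F 0F = 0#
n 1F 1F = 0#
nᵀ a b = n b a

-- Describes the block of `A` between vertices with different first coordinates: the one permitted
-- difference is spent, the other coordinates must agree, and the block acts as the identity.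
∑-equal : (v : Vect D) (y : Vertex D) →
  ∑ (λ z → (if does (#differences y z ℕ.≟ 0) then 1# else 0#) * v z) ≈ v y
∑-equal v []       = *-identityˡ _
∑-equal v (0F ∷ y) = begin
  _ ≈⟨ ∑-split (λ z → (if does (#differences (0F ∷ y) z ℕ.≟ 0) then 1# else 0#) * v z) ⟩
  _ ≈⟨ +-cong (∑-equal (v ∘ (0F ∷_)) y) (≈-trans (∑-*ˡ 0# (λ z → v (1F ∷ z))) (zeroˡ _)) ⟩
  v (0F ∷ y) + 0# ≈⟨ +-identityʳ _ ⟩
  v (0F ∷ y) ∎
∑-equal v (1F ∷ y) = begin
  _ ≈⟨ ∑-split (λ z → (if does (#differences (1F ∷ y) z ℕ.≟ 0) then 1# else 0#) * v z) ⟩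
  _ ≈⟨ +-cong (≈-trans (∑-*ˡ 0# (λ z → v (0F ∷ z))) (zeroˡ _)) (∑-equal (v ∘ (1F ∷_)) y) ⟩
  0# + v (1F ∷ y) ≈⟨ +-identityˡ _ ⟩
  v (1F ∷ y) ∎

A-∙ : (v : Vect D) → A ∙ v ≈ᵥ derivation σˣ v
A-∙ v []       = zeroˡ _
A-∙ v (0F ∷ y) = begin
  (A ∙ v) (0F ∷ y)
    ≈⟨ ∑-split (λ z → A (0F ∷ y) z * v z) ⟩
  (A ∙ (v ∘ (0F ∷_))) y + ∑ (λ z → (if does (#differences y z ℕ.≟ 0) then 1# else 0#) * v (1F ∷ z))
    ≈⟨ +-cong (A-∙ (v ∘ (0F ∷_)) y) (∑-equal (v ∘ (1F ∷_)) y) ⟩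
  derivation σˣ (v ∘ (0F ∷_)) y + v (1F ∷ y)
    ≈⟨ solve 3 (λ d a b → d :+ b := (:0 :* a :+ :1 :* b) :+ d) ≈-refl _ (v (0F ∷ y)) _ ⟩
  derivation σˣ v (0F ∷ y) ∎
A-∙ v (1F ∷ y) = begin
  (A ∙ v) (1F ∷ y)
    ≈⟨ ∑-split (λ z → A (1F ∷ y) z * v z) ⟩
  ∑ (λ z → (if does (#differences y z ℕ.≟ 0) then 1# else 0#) * v (0F ∷ z)) + (A ∙ (v ∘ (1F ∷_))) y
    ≈⟨ +-cong (∑-equal (v ∘ (0F ∷_)) y) (A-∙ (v ∘ (1F ∷_)) y) ⟩
  v (0F ∷ y) + derivation σˣ (v ∘ (1F ∷_)) y
    ≈⟨ solve 3 (λ d a b → a :+ d := (:1 :* a :+ :0 :* b) :+ d) ≈-refl _ _ (v (1F ∷ y)) ⟩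
  derivation σˣ v (1F ∷ y) ∎

weight : Vertex D → ℕ
weight = ∂ 𝐱

weight≤ : (y : Vertex D) → weight y ≤ D
weight≤ []       = z≤n
weight≤ (0F ∷ y) = ℕ.m≤n⇒m≤1+n (weight≤ y)
weight≤ (1F ∷ y) = s≤s (weight≤ y)

infixr 7 _⊛_

-- The operator Σₖ f k `E* k`, that is, an arbitrary polynomial in `A*`.
_⊛_ : (ℕ → ℂ) → Vect D → Vect D
(f ⊛ v) y = f (weight y) * v y

-- Each coordinate 0 contributes 1 and each coordinate 1 contributes -1. This identifies the
-- derivation with `A*`.
derivation-σᶻ : (v : Vect D) → derivation σᶻ v ≈ᵥ (λ k → fromℕ D - 2ᶜ * fromℕ k) ⊛ v
derivation-σᶻ v []       = solve 1 (λ x → :0 := (:0 :- (:1 :+ :1) :* :0) :* x) ≈-refl (v [])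
derivation-σᶻ {suc D} v (0F ∷ y) = begin
  (1# * v (0F ∷ y) + 0# * v (1F ∷ y)) + derivation σᶻ (v ∘ (0F ∷_)) y
    ≈⟨ +-congˡ (derivation-σᶻ (v ∘ (0F ∷_)) y) ⟩
  (1# * v (0F ∷ y) + 0# * v (1F ∷ y)) + (fromℕ D - 2ᶜ * fromℕ (weight y)) * v (0F ∷ y)
    ≈⟨ solve 4 (λ a b d k → (:1 :* a :+ :0 :* b) :+ (d :- (:1 :+ :1) :* k) :* a
                 := ((:1 :+ d) :- (:1 :+ :1) :* k) :* a) ≈-refl _ (v (1F ∷ y)) _ _ ⟩
  ((1# + fromℕ D) - 2ᶜ * fromℕ (weight y)) * v (0F ∷ y)
    ≈⟨ *-congʳ (+-congʳ (fromℕ-suc D)) ⟨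
  (fromℕ (suc D) - 2ᶜ * fromℕ (weight y)) * v (0F ∷ y) ∎
derivation-σᶻ {suc D} v (1F ∷ y) = begin
  (0# * v (0F ∷ y) + (- 1#) * v (1F ∷ y)) + derivation σᶻ (v ∘ (1F ∷_)) y
    ≈⟨ +-congˡ (derivation-σᶻ (v ∘ (1F ∷_)) y) ⟩
  (0# * v (0F ∷ y) + (- 1#) * v (1F ∷ y)) + (fromℕ D - 2ᶜ * fromℕ (weight y)) * v (1F ∷ y)
    ≈⟨ solve 4 (λ a b d k → (:0 :* b :+ (:- :1) :* a) :+ (d :- (:1 :+ :1) :* k) :* a
                 := ((:1 :+ d) :- (:1 :+ :1) :* (:1 :+ k)) :* a) ≈-refl _ (v (0F ∷ y)) _ _ ⟩
  ((1# + fromℕ D) - 2ᶜ * (1# + fromℕ (weight y))) * v (1F ∷ y)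
    ≈⟨ *-congʳ (+-cong (fromℕ-suc D) (-‿cong (*-congˡ (fromℕ-suc (weight y))))) ⟨
  (fromℕ (suc D) - 2ᶜ * fromℕ (suc (weight y))) * v (1F ∷ y) ∎

-- Calculus of tensor powers and derivations

infixl 7 _·₂_
infix 4 _≈₂_

_·₂_ : Mat₂ → Mat₂ → Mat₂
(M ·₂ N) a c = M a 0F * N 0F c + M a 1F * N 1F c

_≈₂_ : Mat₂ → Mat₂ → Set
M ≈₂ N = ∀ a b → M a b ≈ N a b

tensor-cong : ∀ K {v w : Vect D} → v ≈ᵥ w → tensor K v ≈ᵥ tensor K w
tensor-cong K p []      = p []
tensor-cong K p (a ∷ y) = +-cong (*-congˡ (tensor-cong K (λ z → p (0F ∷ z)) y))
                                 (*-congˡ (tensor-cong K (λ z → p (1F ∷ z)) y))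

tensor-congˡ : ∀ {K L} → K ≈₂ L → (v : Vect D) → tensor K v ≈ᵥ tensor L v
tensor-congˡ p v []      = ≈-refl
tensor-congˡ p v (a ∷ y) = +-cong (*-cong (p a 0F) (tensor-congˡ p _ y))
                                  (*-cong (p a 1F) (tensor-congˡ p _ y))

tensor-linear : ∀ K c d (v w : Vect D) →
  tensor K (c *ᵥ v +ᵥ d *ᵥ w) ≈ᵥ c *ᵥ tensor K v +ᵥ d *ᵥ tensor K w
tensor-linear K c d v w []      = ≈-refl
tensor-linear K c d v w (a ∷ y) = begin
  _ ≈⟨ +-cong (*-congˡ (tensor-linear K c d (v ∘ (0F ∷_)) (w ∘ (0F ∷_)) y))
              (*-congˡ (tensor-linear K c d (v ∘ (1F ∷_)) (w ∘ (1F ∷_)) y)) ⟩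
  _ ≈⟨ solve 8 (λ k l c d v₀ v₁ w₀ w₁ →
         k :* (c :* v₀ :+ d :* w₀) :+ l :* (c :* v₁ :+ d :* w₁)
         := c :* (k :* v₀ :+ l :* v₁) :+ d :* (k :* w₀ :+ l :* w₁)) ≈-refl
         (K a 0F) (K a 1F) c d _ _ _ _ ⟩
  _ ∎

tensor-*ᵥ : ∀ K c (v : Vect D) → tensor K (c *ᵥ v) ≈ᵥ c *ᵥ tensor K v
tensor-*ᵥ K c v []      = ≈-refl
tensor-*ᵥ K c v (a ∷ y) = begin
  _ ≈⟨ +-cong (*-congˡ (tensor-*ᵥ K c (v ∘ (0F ∷_)) y)) (*-congˡ (tensor-*ᵥ K c (v ∘ (1F ∷_)) y)) ⟩
  _ ≈⟨ solve 5 (λ k l c v₀ v₁ → k :* (c :* v₀) :+ l :* (c :* v₁) := c :* (k :* v₀ :+ l :* v₁)) ≈-refl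
         (K a 0F) (K a 1F) c _ _ ⟩
  _ ∎

tensor-tensor : ∀ K L (v : Vect D) → tensor K (tensor L v) ≈ᵥ tensor (K ·₂ L) v
tensor-tensor K L v []      = ≈-refl
tensor-tensor K L v (a ∷ y) = begin
  _ ≈⟨ +-cong (*-congˡ (part 0F)) (*-congˡ (part 1F)) ⟩
  _ ≈⟨ solve 8 (λ k l p q r s x y → k :* (p :* x :+ q :* y) :+ l :* (r :* x :+ s :* y)
               := (k :* p :+ l :* r) :* x :+ (k :* q :+ l :* s) :* y) ≈-refl
         (K a 0F) (K a 1F) (L 0F 0F) (L 0F 1F) (L 1F 0F) (L 1F 1F) _ _ ⟩
  _ ∎
  where
  part : ∀ b → tensor K (λ z → tensor L v (b ∷ z)) y ≈
    L b 0F * tensor (K ·₂ L) (v ∘ (0F ∷_)) y + L b 1F * tensor (K ·₂ L) (v ∘ (1F ∷_)) y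
  part b = ≈-trans (tensor-linear K (L b 0F) (L b 1F) _ _ y)
    (+-cong (*-congˡ (tensor-tensor K L _ y)) (*-congˡ (tensor-tensor K L _ y)))

derivation-cong : ∀ M {v w : Vect D} → v ≈ᵥ w → derivation M v ≈ᵥ derivation M w
derivation-cong M p []      = ≈-refl
derivation-cong M p (a ∷ y) = +-cong (+-cong (*-congˡ (p _)) (*-congˡ (p _)))
                                     (derivation-cong M (λ z → p (a ∷ z)) y)

derivation-linear : ∀ M c d (v w : Vect D) →
  derivation M (c *ᵥ v +ᵥ d *ᵥ w) ≈ᵥ c *ᵥ derivation M v +ᵥ d *ᵥ derivation M w
derivation-linear M c d v w []      = solve 2 (λ c d → :0 := c :* :0 :+ d :* :0) ≈-refl c d
derivation-linear M c d v w (a ∷ y) = begin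
  _ ≈⟨ +-congˡ (derivation-linear M c d (v ∘ (a ∷_)) (w ∘ (a ∷_)) y) ⟩
  _ ≈⟨ solve 10 (λ k l c d v₀ v₁ w₀ w₁ s t →
         (k :* (c :* v₀ :+ d :* w₀) :+ l :* (c :* v₁ :+ d :* w₁)) :+ (c :* s :+ d :* t)
         := c :* ((k :* v₀ :+ l :* v₁) :+ s) :+ d :* ((k :* w₀ :+ l :* w₁) :+ t)) ≈-refl
         (M a 0F) (M a 1F) c d (v (0F ∷ y)) (v (1F ∷ y)) (w (0F ∷ y)) (w (1F ∷ y)) _ _ ⟩
  _ ∎

derivation-linearˡ : ∀ {K M N} c d → (∀ a b → K a b ≈ c * M a b + d * N a b) →
  (v : Vect D) → derivation K v ≈ᵥ c *ᵥ derivation M v +ᵥ d *ᵥ derivation N v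
derivation-linearˡ c d p v []      = solve 2 (λ c d → :0 := c :* :0 :+ d :* :0) ≈-refl c d
derivation-linearˡ {K = K} {M} {N} c d p v (a ∷ y) = begin
  _ ≈⟨ +-cong (+-cong (*-congʳ (p a 0F)) (*-congʳ (p a 1F))) (derivation-linearˡ c d p (v ∘ (a ∷_)) y) ⟩
  _ ≈⟨ solve 10 (λ k l m n c d v₀ v₁ s t →
         ((c :* k :+ d :* m) :* v₀ :+ (c :* l :+ d :* n) :* v₁) :+ (c :* s :+ d :* t)
         := c :* ((k :* v₀ :+ l :* v₁) :+ s) :+ d :* ((m :* v₀ :+ n :* v₁) :+ t)) ≈-refl
         (M a 0F) (M a 1F) (N a 0F) (N a 1F) c d (v (0F ∷ y)) (v (1F ∷ y)) _ _ ⟩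
  _ ∎

-- Each summand of a derivation acts on a single factor, where `K` intertwines `M` with `N`; on the
-- other factors only `K` acts. All conjugations by `P` go through this lift of a 2 × 2 identity.
tensor-derivation : ∀ {K M N} → K ·₂ M ≈₂ N ·₂ K → (v : Vect D) →
  tensor K (derivation M v) ≈ᵥ derivation N (tensor K v)
tensor-derivation p v []      = ≈-refl
tensor-derivation {K = K} {M} {N} p v (a ∷ y) = begin
  K a 0F * tensor K (λ z → derivation M v (0F ∷ z)) y + K a 1F * tensor K (λ z → derivation M v (1F ∷ z)) y
    ≈⟨ +-cong (*-congˡ (part 0F)) (*-congˡ (part 1F)) ⟩
  K a 0F * ((M 0F 0F * V 0F + M 0F 1F * V 1F) + W 0F) + K a 1F * ((M 1F 0F * V 0F + M 1F 1F * V 1F) + W 1F)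
    ≈⟨ solve 10 (λ k l p q r s x y u v → k :* ((p :* x :+ q :* y) :+ u) :+ l :* ((r :* x :+ s :* y) :+ v)
         := ((k :* p :+ l :* r) :* x :+ (k :* q :+ l :* s) :* y) :+ (k :* u :+ l :* v)) ≈-refl
         (K a 0F) (K a 1F) (M 0F 0F) (M 0F 1F) (M 1F 0F) (M 1F 1F) (V 0F) (V 1F) (W 0F) (W 1F) ⟩
  ((K ·₂ M) a 0F * V 0F + (K ·₂ M) a 1F * V 1F) + (K a 0F * W 0F + K a 1F * W 1F)
    ≈⟨ +-congʳ (+-cong (*-congʳ (p a 0F)) (*-congʳ (p a 1F))) ⟩
  ((N ·₂ K) a 0F * V 0F + (N ·₂ K) a 1F * V 1F) + (K a 0F * W 0F + K a 1F * W 1F)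
    ≈⟨ solve 9 (λ k l p q r s x y w → ((k :* p :+ l :* r) :* x :+ (k :* q :+ l :* s) :* y) :+ w
         := (k :* (p :* x :+ q :* y) :+ l :* (r :* x :+ s :* y)) :+ w) ≈-refl
         (N a 0F) (N a 1F) (K 0F 0F) (K 0F 1F) (K 1F 0F) (K 1F 1F) (V 0F) (V 1F) _ ⟩
  (N a 0F * tensor K v (0F ∷ y) + N a 1F * tensor K v (1F ∷ y)) + (K a 0F * W 0F + K a 1F * W 1F)
    ≈⟨ +-congˡ (derivation-linear N (K a 0F) (K a 1F) _ _ y) ⟨
  derivation N (tensor K v) (a ∷ y) ∎
  where
  V W : Fin 2 → ℂ
  V b = tensor K (v ∘ (b ∷_)) y
  W b = derivation N (tensor K (v ∘ (b ∷_))) y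
  part : ∀ b → tensor K (λ z → derivation M v (b ∷ z)) y ≈ (M b 0F * V 0F + M b 1F * V 1F) + W b
  part b = begin
    tensor K ((M b 0F *ᵥ (v ∘ (0F ∷_)) +ᵥ M b 1F *ᵥ (v ∘ (1F ∷_))) +ᵥ derivation M (v ∘ (b ∷_))) y
      ≈⟨ tensor-cong K (λ z → solve 2 (λ a b → a :+ b := :1 :* a :+ :1 :* b) ≈-refl _ _) y ⟩
    tensor K (1# *ᵥ (M b 0F *ᵥ (v ∘ (0F ∷_)) +ᵥ M b 1F *ᵥ (v ∘ (1F ∷_))) +ᵥ 1# *ᵥ derivation M (v ∘ (b ∷_))) y
      ≈⟨ tensor-linear K 1# 1# _ _ y ⟩
    1# * tensor K (M b 0F *ᵥ (v ∘ (0F ∷_)) +ᵥ M b 1F *ᵥ (v ∘ (1F ∷_))) y + 1# * tensor K (derivation M (v ∘ (b ∷_))) y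
      ≈⟨ solve 2 (λ a b → :1 :* a :+ :1 :* b := a :+ b) ≈-refl _ _ ⟩
    tensor K (M b 0F *ᵥ (v ∘ (0F ∷_)) +ᵥ M b 1F *ᵥ (v ∘ (1F ∷_))) y + tensor K (derivation M (v ∘ (b ∷_))) y
      ≈⟨ +-cong (tensor-linear K (M b 0F) (M b 1F) _ _ y) (tensor-derivation p (v ∘ (b ∷_)) y) ⟩
    (M b 0F * V 0F + M b 1F * V 1F) + W b ∎

diag₂ : ℂ → Mat₂
diag₂ c 0F 0F = 1#
diag₂ c 0F 1F = 0#
diag₂ c 1F 0F = 0#
diag₂ c 1F 1F = c

tensor-diag₂ : ∀ c (v : Vect D) → tensor (diag₂ c) v ≈ᵥ (c ^_) ⊛ v
tensor-diag₂ c v []       = ≈-sym (*-identityˡ _)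
tensor-diag₂ c v (0F ∷ y) = begin
  _ ≈⟨ +-cong (*-identityˡ _) (zeroˡ _) ⟩
  _ ≈⟨ +-identityʳ _ ⟩
  _ ≈⟨ tensor-diag₂ c (v ∘ (0F ∷_)) y ⟩
  _ ∎
tensor-diag₂ c v (1F ∷ y) = begin
  _ ≈⟨ +-cong (zeroˡ _) (*-congˡ (tensor-diag₂ c (v ∘ (1F ∷_)) y)) ⟩
  _ ≈⟨ +-identityˡ _ ⟩
  _ ≈⟨ *-assoc c _ _ ⟨
  _ ∎

tensor-scaled : ∀ {K L} c → (∀ a b → K a b ≈ c * L a b) → (v : Vect D) →
  tensor K v ≈ᵥ (c ^ D) *ᵥ tensor L v
tensor-scaled c p v []      = ≈-sym (*-identityˡ _)
tensor-scaled {suc D} {K} {L} c p v (a ∷ y) = begin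
  _ ≈⟨ +-cong (*-cong (p a 0F) (tensor-scaled c p (v ∘ (0F ∷_)) y))
              (*-cong (p a 1F) (tensor-scaled c p (v ∘ (1F ∷_)) y)) ⟩
  _ ≈⟨ solve 6 (λ c e l m x y → c :* l :* (e :* x) :+ c :* m :* (e :* y)
          := c :* e :* (l :* x :+ m :* y)) ≈-refl c (c ^ D) (L a 0F) (L a 1F) _ _ ⟩
  _ ∎

-- At `y`, `derivation n v` reads `v` at vertices with one more coordinate equal to 1, hence the
-- shift of `f`.
derivation-n-⊛ : (f : ℕ → ℂ) (v : Vect D) → derivation n (f ⊛ v) ≈ᵥ (f ∘ suc) ⊛ derivation n v
derivation-n-⊛ f v []       = ≈-sym (zeroʳ (f 1))
derivation-n-⊛ f v (0F ∷ y) = begin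
  _ ≈⟨ +-congˡ (derivation-n-⊛ f (v ∘ (0F ∷_)) y) ⟩
  _ ≈⟨ solve 5 (λ f g a b d → (:0 :* (g :* a) :+ :1 :* (f :* b)) :+ f :* d
          := f :* ((:0 :* a :+ :1 :* b) :+ d))
              ≈-refl (f (suc (weight y))) (f (weight y)) (v (0F ∷ y)) (v (1F ∷ y)) _ ⟩
  _ ∎
derivation-n-⊛ f v (1F ∷ y) = begin
  _ ≈⟨ +-congˡ (derivation-n-⊛ (f ∘ suc) (v ∘ (1F ∷_)) y) ⟩
  _ ≈⟨ solve 6 (λ f g h a b d → (:0 :* (f :* a) :+ :0 :* (g :* b)) :+ h :* d
          := h :* ((:0 :* a :+ :0 :* b) :+ d)) ≈-refl
          (f (weight y)) (f (suc (weight y))) (f (suc (suc (weight y)))) (v (0F ∷ y)) (v (1F ∷ y)) _ ⟩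
  _ ∎

-- Here `v` is read at weight one less. Shifting the inner function instead of the outer one avoids
-- a predecessor at weight 0.
derivation-nᵀ-⊛ : (f : ℕ → ℂ) (v : Vect D) → f ⊛ derivation nᵀ v ≈ᵥ derivation nᵀ ((f ∘ suc) ⊛ v)
derivation-nᵀ-⊛ f v []       = zeroʳ (f 0)
derivation-nᵀ-⊛ f v (0F ∷ y) = begin
  _ ≈⟨ solve 6 (λ f g h a b d → f :* ((:0 :* a :+ :0 :* b) :+ d) := (:0 :* (g :* a) :+ :0 :* (h :* b)) :+ f :* d) ≈-refl
         (f (weight y)) (f (suc (weight y))) (f (suc (suc (weight y)))) (v (0F ∷ y)) (v (1F ∷ y)) _ ⟩
  _ ≈⟨ +-congˡ (derivation-nᵀ-⊛ f (v ∘ (0F ∷_)) y) ⟩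
  _ ∎
derivation-nᵀ-⊛ f v (1F ∷ y) = begin
  _ ≈⟨ solve 5 (λ g h a b d → g :* ((:1 :* a :+ :0 :* b) :+ d) := (:1 :* (g :* a) :+ :0 :* (h :* b)) :+ g :* d) ≈-refl
         (f (suc (weight y))) (f (suc (suc (weight y)))) (v (0F ∷ y)) (v (1F ∷ y)) _ ⟩
  _ ≈⟨ +-congˡ (derivation-nᵀ-⊛ (f ∘ suc) (v ∘ (1F ∷_)) y) ⟩
  _ ∎

-- The tensor power of σˣ is the antipodal map, which exchanges weights k and D - k.
tensor-σˣ-⊛ : (f : ℕ → ℂ) (v : Vect D) → tensor σˣ (f ⊛ v) ≈ᵥ (λ k → f (D ℕ.∸ k)) ⊛ tensor σˣ v
tensor-σˣ-⊛ f v []       = ≈-refl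
tensor-σˣ-⊛ {suc D} f v (0F ∷ y) = begin
  0# * _ + 1# * tensor σˣ ((f ∘ suc) ⊛ (v ∘ (1F ∷_))) y
    ≈⟨ +-congˡ (*-congˡ (tensor-σˣ-⊛ (f ∘ suc) (v ∘ (1F ∷_)) y)) ⟩
  0# * _ + 1# * (f (suc (D ℕ.∸ weight y)) * tensor σˣ (v ∘ (1F ∷_)) y)
    ≈⟨ solve 4 (λ f t u w → :0 :* u :+ :1 :* (f :* t) := f :* (:0 :* w :+ :1 :* t))
        ≈-refl _ _ _ (tensor σˣ (v ∘ (0F ∷_)) y) ⟩
  f (suc (D ℕ.∸ weight y)) * tensor σˣ v (0F ∷ y)
    -- Truncated subtraction commutes with `suc` here because `weight y` is at most D.
    ≡⟨ ≡.cong (λ k → f k * tensor σˣ v (0F ∷ y)) (≡.sym (ℕ.+-∸-assoc 1 (weight≤ y))) ⟩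
  f (suc D ℕ.∸ weight y) * tensor σˣ v (0F ∷ y) ∎
tensor-σˣ-⊛ {suc D} f v (1F ∷ y) = begin
  1# * tensor σˣ (f ⊛ (v ∘ (0F ∷_))) y + 0# * _
    ≈⟨ +-congʳ (*-congˡ (tensor-σˣ-⊛ f (v ∘ (0F ∷_)) y)) ⟩
  1# * (f (D ℕ.∸ weight y) * tensor σˣ (v ∘ (0F ∷_)) y) + 0# * _
    ≈⟨ solve 4 (λ f t u w → :1 :* (f :* t) :+ :0 :* u := f :* (:1 :* t :+ :0 :* w))
        ≈-refl _ _ _ (tensor σˣ (v ∘ (1F ∷_)) y) ⟩
  f (D ℕ.∸ weight y) * tensor σˣ v (1F ∷ y) ∎

-- Highest weight vectors

δ-refl : ∀ i → δ i i ≈ 1#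
δ-refl i = ≈-reflexive (≡.cong (if_then 1# else 0#) (dec-true (i ℕ.≟ i) ≡.refl))

δ-≢ : ∀ {i j} → i ≢ j → δ i j ≈ 0#
δ-≢ {i} {j} i≢j = ≈-reflexive (≡.cong (if_then 1# else 0#) (dec-false (i ℕ.≟ j) i≢j))

δ-subst : ∀ (f : ℕ → ℂ) k r → f k * δ k r ≈ f r * δ k r
δ-subst f k r with k ℕ.≟ r
... | yes ≡.refl = ≈-refl
... | no  k≢r    = ≈-trans (vanish (f k)) (≈-sym (vanish (f r)))
  where
  vanish : ∀ z → z * δ k r ≈ 0#
  vanish z = ≈-trans (*-congˡ (δ-≢ k≢r)) (zeroʳ z)

_at_ : Vect D → ℕ → Vect D
v at k = (λ j → δ j k) ⊛ v

E*-∙ : ∀ k (v : Vect D) → E* k ∙ v ≈ᵥ v at k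
E*-∙ k v = diag-∙ (λ y → δ (weight y) k) v

⊛-at : ∀ (f : ℕ → ℂ) (v : Vect D) k → f ⊛ (v at k) ≈ᵥ f k *ᵥ (v at k)
⊛-at f v k y = begin
  f (weight y) * (δ (weight y) k * v y) ≈⟨ *-assoc _ _ _ ⟨
  f (weight y) * δ (weight y) k * v y   ≈⟨ *-congʳ (δ-subst f (weight y) k) ⟩
  f k * δ (weight y) k * v y            ≈⟨ *-assoc _ _ _ ⟩
  f k * (δ (weight y) k * v y)          ∎

record HighestWeight (r : ℕ) (v : Vect D) : Set where
  constructor highestWeight
  field
    homogeneous : v at r ≈ᵥ v
    annihilated : derivation n v ≈ᵥ 0ᵥ

open HighestWeight

derivation-*ᵥ : ∀ M c (v : Vect D) → derivation M (c *ᵥ v) ≈ᵥ c *ᵥ derivation M v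
derivation-*ᵥ M c v y = begin
  derivation M (c *ᵥ v) y
    ≈⟨ derivation-cong M (λ z → solve 2 (λ c x → c :* x := c :* x :+ :0 :* x) ≈-refl c (v z)) y ⟩
  derivation M (c *ᵥ v +ᵥ 0# *ᵥ v) y
    ≈⟨ derivation-linear M c 0# v v y ⟩
  c * derivation M v y + 0# * derivation M v y
    ≈⟨ solve 2 (λ c x → c :* x :+ :0 :* x := c :* x) ≈-refl c _ ⟩
  c * derivation M v y ∎

HighestWeight-resp : ∀ {r} {v w : Vect D} → v ≈ᵥ w → HighestWeight r v → HighestWeight r w
homogeneous (HighestWeight-resp p h) y = ≈-trans (*-congˡ (≈-sym (p y))) (≈-trans (homogeneous h y) (p y))
annihilated (HighestWeight-resp p h) y = ≈-trans (derivation-cong n (λ z → ≈-sym (p z)) y) (annihilated h y)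

HighestWeight-*ᵥ : ∀ {r} c {v : Vect D} → HighestWeight r v → HighestWeight r (c *ᵥ v)
homogeneous (HighestWeight-*ᵥ c {v} h) y = ≈-trans
  (solve 3 (λ d c x → d :* (c :* x) := c :* (d :* x)) ≈-refl _ c (v y)) (*-congˡ (homogeneous h y))
annihilated (HighestWeight-*ᵥ c {v} h) y =
  ≈-trans (derivation-*ᵥ n c v y) (≈-trans (*-congˡ (annihilated h y)) (zeroʳ c))

I-∙ : (v : Vect D) → I ∙ v ≈ᵥ v
I-∙ v y = ≈-trans (diag-∙ (λ _ → 1#) v y) (*-identityˡ _)

tensor-P₁-injective : {v w : Vect D} → tensor P₁ v ≈ᵥ tensor P₁ w → v ≈ᵥ w
tensor-P₁-injective {v = v} {w} p y = begin
  v y                    ≈⟨ recover v y ⟨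
  (P⁻¹ ∙ tensor P₁ v) y  ≈⟨ ∙-cong P⁻¹ p y ⟩
  (P⁻¹ ∙ tensor P₁ w) y  ≈⟨ recover w y ⟩
  w y                    ∎
  where
  recover : ∀ v → P⁻¹ ∙ tensor P₁ v ≈ᵥ v
  recover v y = begin
    (P⁻¹ ∙ tensor P₁ v) y ≈⟨ ∙-cong P⁻¹ (^⊗-∙ P₁ v) y ⟨
    (P⁻¹ ∙ P ∙ v) y       ≈⟨ ·-∙ P⁻¹ P v y ⟨
    ((P⁻¹ · P) ∙ v) y     ≈⟨ ∙-congˡ P⁻¹·P≈I v y ⟩
    (I ∙ v) y             ≈⟨ I-∙ v y ⟩
    v y                   ∎

-- Transports (β′ σᶻ + γ n) p = β′ (D - 2 r) p, valid for a highest weight vector p,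
-- along an intertwiner L with p = L v.
derivation-transport : ∀ {L K} α β β′ γ (M : Mat₂) →
  (∀ {v w : Vect D} → tensor L v ≈ᵥ tensor L w → v ≈ᵥ w) →
  (∀ a b → K a b ≈ α * M a b + β * σᶻ a b) →
  L ·₂ K ≈₂ (λ a b → β′ * σᶻ a b + γ * n a b) ·₂ L →
  ∀ {r} {v : Vect D} → HighestWeight r (tensor L v) → ∀ y →
  α * derivation M v y + β * ((fromℕ D - 2ᶜ * fromℕ (weight y)) * v y)
  ≈ β′ * (fromℕ D - 2ᶜ * fromℕ r) * v y
derivation-transport {D} {L} {K} α β β′ γ M inj K≈ LK≈ {r} {v} h y = begin
  α * derivation M v y + β * ((fromℕ D - 2ᶜ * fromℕ (weight y)) * v y)
    ≈⟨ +-congˡ (*-congˡ (derivation-σᶻ v y)) ⟨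
  α * derivation M v y + β * derivation σᶻ v y
    ≈⟨ derivation-linearˡ α β K≈ v y ⟨
  derivation K v y
    ≈⟨ inj eigen y ⟩
  β′ * (fromℕ D - 2ᶜ * fromℕ r) * v y ∎
  where
  p = tensor L v
  K′ : Mat₂
  K′ a b = β′ * σᶻ a b + γ * n a b
  weighted : derivation σᶻ p ≈ᵥ (fromℕ D - 2ᶜ * fromℕ r) *ᵥ p
  weighted z = begin
    derivation σᶻ p z
      ≈⟨ derivation-cong σᶻ (homogeneous h) z ⟨
    derivation σᶻ (p at r) z
      ≈⟨ derivation-σᶻ (p at r) z ⟩
    (fromℕ D - 2ᶜ * fromℕ (weight z)) * (p at r) z
      ≈⟨ ⊛-at (λ k → fromℕ D - 2ᶜ * fromℕ k) p r z ⟩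
    (fromℕ D - 2ᶜ * fromℕ r) * (p at r) z
      ≈⟨ *-congˡ (homogeneous h z) ⟩
    (fromℕ D - 2ᶜ * fromℕ r) * p z ∎
  eigen : tensor L (derivation K v) ≈ᵥ tensor L ((β′ * (fromℕ D - 2ᶜ * fromℕ r)) *ᵥ v)
  eigen z = begin
    tensor L (derivation K v) z
      ≈⟨ tensor-derivation LK≈ v z ⟩
    derivation K′ p z
      ≈⟨ derivation-linearˡ β′ γ (λ _ _ → ≈-refl) p z ⟩
    β′ * derivation σᶻ p z + γ * derivation n p z
      ≈⟨ +-cong (*-congˡ (weighted z)) (*-congˡ (annihilated h z)) ⟩
    β′ * ((fromℕ D - 2ᶜ * fromℕ r) * p z) + γ * 0#
      ≈⟨ solve 4 (λ b t x g → b :* (t :* x) :+ g :* :0 := b :* t :* x) ≈-refl β′ _ (p z) γ ⟩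
    β′ * (fromℕ D - 2ᶜ * fromℕ r) * p z
      ≈⟨ tensor-*ᵥ L (β′ * (fromℕ D - 2ᶜ * fromℕ r)) v z ⟨
    tensor L ((β′ * (fromℕ D - 2ᶜ * fromℕ r)) *ᵥ v) z ∎

-- For closed matrices all hypotheses hold by refl.
≈₂-computed : ∀ {M N : Mat₂} →
  seq (re (M 0F 0F)) ≡ seq (re (N 0F 0F)) → seq (im (M 0F 0F)) ≡ seq (im (N 0F 0F)) →
  seq (re (M 0F 1F)) ≡ seq (re (N 0F 1F)) → seq (im (M 0F 1F)) ≡ seq (im (N 0F 1F)) →
  seq (re (M 1F 0F)) ≡ seq (re (N 1F 0F)) → seq (im (M 1F 0F)) ≡ seq (im (N 1F 0F)) →
  seq (re (M 1F 1F)) ≡ seq (re (N 1F 1F)) → seq (im (M 1F 1F)) ≡ seq (im (N 1F 1F)) →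
  M ≈₂ N
≈₂-computed p q _ _ _ _ _ _ 0F 0F = ≈-pointwise (≡.cong-app p) (≡.cong-app q)
≈₂-computed _ _ p q _ _ _ _ 0F 1F = ≈-pointwise (≡.cong-app p) (≡.cong-app q)
≈₂-computed _ _ _ _ p q _ _ 1F 0F = ≈-pointwise (≡.cong-app p) (≡.cong-app q)
≈₂-computed _ _ _ _ _ _ p q 1F 1F = ≈-pointwise (≡.cong-app p) (≡.cong-app q)

-- Since `n` kills P v, any σᶻ + γ n acts on P v as D - 2r. Conjugated back by `P₁` this matrix is
-- σˣ + γ P₁⁻¹ n P₁, and γ = -2𝕚 cancels its `nᵀ` entry and leaves 2n - σᶻ. On weight k, σᶻ is D -
-- 2k, which can be solved for `n`.
lowering : ∀ {r} {v : Vect D} → HighestWeight r (tensor P₁ v) →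
  derivation n v ≈ᵥ (λ k → fromℕ D - fromℕ r - fromℕ k) ⊛ v
lowering {D} {r} {v} h y = begin
  derivation n v y
    ≈⟨ solve 3 (λ t s x → x := :½ :* (((:1 :+ :1) :* x :+ (:- :1) :* (t :* s)) :+ t :* s)) ≈-refl
         (fromℕ D - 2ᶜ * fromℕ (weight y)) (v y) _ ⟩
  fromℚ ½ * ((2ᶜ * derivation n v y + (- 1#) * ((fromℕ D - 2ᶜ * fromℕ (weight y)) * v y))
    + (fromℕ D - 2ᶜ * fromℕ (weight y)) * v y)
    ≈⟨ *-congˡ (+-congʳ (derivation-transport 2ᶜ (- 1#) 1# (- (2ᶜ * 𝕚)) n tensor-P₁-injective
         (λ _ _ → ≈-refl) P₁K≈K′P₁ h y)) ⟩
  fromℚ ½ * (1# * (fromℕ D - 2ᶜ * fromℕ r) * v y + (fromℕ D - 2ᶜ * fromℕ (weight y)) * v y)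
    ≈⟨ solve 4 (λ D r k x → :½ :* (:1 :* (D :- (:1 :+ :1) :* r) :* x :+ (D :- (:1 :+ :1) :* k) :* x)
         := (D :- r :- k) :* x) ≈-refl (fromℕ D) (fromℕ r) (fromℕ (weight y)) (v y) ⟩
  (fromℕ D - fromℕ r - fromℕ (weight y)) * v y ∎
  where
  P₁K≈K′P₁ : P₁ ·₂ (λ a b → 2ᶜ * n a b + (- 1#) * σᶻ a b)
    ≈₂ (λ a b → 1# * σᶻ a b + (- (2ᶜ * 𝕚)) * n a b) ·₂ P₁
  P₁K≈K′P₁ = ≈₂-computed ≡.refl ≡.refl ≡.refl ≡.refl ≡.refl ≡.refl ≡.refl ≡.refl

-- The opposite choice γ = 2𝕚 cancels the `n` entry instead and leaves 2nᵀ + σᶻ. Together with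
-- `lowering` it links every two neighbouring weight components of `v`.
raising : ∀ {r} {v : Vect D} → HighestWeight r (tensor P₁ v) →
  derivation nᵀ v ≈ᵥ (λ k → fromℕ k - fromℕ r) ⊛ v
raising {D} {r} {v} h y = begin
  derivation nᵀ v y
    ≈⟨ solve 3 (λ t s x → x := :½ :* (((:1 :+ :1) :* x :+ :1 :* (t :* s)) :- t :* s)) ≈-refl
         (fromℕ D - 2ᶜ * fromℕ (weight y)) (v y) _ ⟩
  fromℚ ½ * ((2ᶜ * derivation nᵀ v y + 1# * ((fromℕ D - 2ᶜ * fromℕ (weight y)) * v y))
    - (fromℕ D - 2ᶜ * fromℕ (weight y)) * v y)
    ≈⟨ *-congˡ (+-congʳ (derivation-transport 2ᶜ 1# 1# (2ᶜ * 𝕚) nᵀ tensor-P₁-injective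
         (λ _ _ → ≈-refl) P₁K≈K′P₁ h y)) ⟩
  fromℚ ½ * (1# * (fromℕ D - 2ᶜ * fromℕ r) * v y - (fromℕ D - 2ᶜ * fromℕ (weight y)) * v y)
    ≈⟨ solve 4 (λ D r k x → :½ :* (:1 :* (D :- (:1 :+ :1) :* r) :* x :- (D :- (:1 :+ :1) :* k) :* x)
         := (k :- r) :* x) ≈-refl (fromℕ D) (fromℕ r) (fromℕ (weight y)) (v y) ⟩
  (fromℕ (weight y) - fromℕ r) * v y ∎
  where
  P₁K≈K′P₁ : P₁ ·₂ (λ a b → 2ᶜ * nᵀ a b + 1# * σᶻ a b)
    ≈₂ (λ a b → 1# * σᶻ a b + (2ᶜ * 𝕚) * n a b) ·₂ P₁
  P₁K≈K′P₁ = ≈₂-computed ≡.refl ≡.refl ≡.refl ≡.refl ≡.refl ≡.refl ≡.refl ≡.refl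

P₁² : Mat₂
P₁² = P₁ ·₂ P₁

tensor-P₁² : (v : Vect D) → tensor P₁ (tensor P₁ v) ≈ᵥ tensor P₁² v
tensor-P₁² = tensor-tensor P₁ P₁

tensor-P₁²-injective : {v w : Vect D} → tensor P₁² v ≈ᵥ tensor P₁² w → v ≈ᵥ w
tensor-P₁²-injective {v = v} {w} p = tensor-P₁-injective (tensor-P₁-injective
  (λ y → ≈-trans (tensor-P₁² v y) (≈-trans (p y) (≈-sym (tensor-P₁² w y)))))

-- Through `P₁²` the matrix σᶻ comes back with off-diagonal entries 𝕚 and -𝕚. A suitable multiple of
-- `n` again removes the upper one; the factor β′ = 𝕚 then normalises the coefficient of `nᵀ` to 2,
-- giving 2nᵀ + 𝕚 σᶻ.
raising² : ∀ {r} {v : Vect D} → HighestWeight r (tensor P₁² v) →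
  derivation nᵀ v ≈ᵥ (λ k → 𝕚 * (fromℕ k - fromℕ r)) ⊛ v
raising² {D} {r} {v} h y = begin
  derivation nᵀ v y
    ≈⟨ solve 3 (λ t s x → x := :½ :* (((:1 :+ :1) :* x :+ :𝕚 :* (t :* s)) :- :𝕚 :* (t :* s))) ≈-refl
         (fromℕ D - 2ᶜ * fromℕ (weight y)) (v y) _ ⟩
  fromℚ ½ * ((2ᶜ * derivation nᵀ v y + 𝕚 * ((fromℕ D - 2ᶜ * fromℕ (weight y)) * v y))
    - 𝕚 * ((fromℕ D - 2ᶜ * fromℕ (weight y)) * v y))
    ≈⟨ *-congˡ (+-congʳ (derivation-transport 2ᶜ 𝕚 𝕚 (2ᶜ * 𝕚) nᵀ tensor-P₁²-injective
         (λ _ _ → ≈-refl) P₁²K≈K′P₁² h y)) ⟩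
  fromℚ ½ * (𝕚 * (fromℕ D - 2ᶜ * fromℕ r) * v y - 𝕚 * ((fromℕ D - 2ᶜ * fromℕ (weight y)) * v y))
    ≈⟨ solve 4 (λ D r k x → :½ :* (:𝕚 :* (D :- (:1 :+ :1) :* r) :* x :- :𝕚 :* ((D :- (:1 :+ :1) :* k) :* x))
         := (:𝕚 :* (k :- r)) :* x) ≈-refl (fromℕ D) (fromℕ r) (fromℕ (weight y)) (v y) ⟩
  (𝕚 * (fromℕ (weight y) - fromℕ r)) * v y ∎
  where
  P₁²K≈K′P₁² : P₁² ·₂ (λ a b → 2ᶜ * nᵀ a b + 𝕚 * σᶻ a b)
    ≈₂ (λ a b → 𝕚 * σᶻ a b + (2ᶜ * 𝕚) * n a b) ·₂ P₁²
  P₁²K≈K′P₁² = ≈₂-computed ≡.refl ≡.refl ≡.refl ≡.refl ≡.refl ≡.refl ≡.refl ≡.refl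

-- The pairing

conj-cong : ∀ {z w} → z ≈ w → conj z ≈ conj w
conj-cong p = mk≈ᶜ (re-≈ p) (-ᵣ-cong (im-≈ p))

conj-+ : ∀ z w → conj (z + w) ≈ conj z + conj w
conj-+ z w = ≈-pointwise (λ _ → ≡.refl)
  (λ k → solveℚ 2 (λ b d → :-ℚ (b :+ℚ d) :=ℚ (:-ℚ b) :+ℚ (:-ℚ d)) ≡.refl (seq (im z) k) (seq (im w) k))

conj-* : ∀ z w → conj (z * w) ≈ conj z * conj w
conj-* z w = ≈-pointwise
  (λ k → solveℚ 4 (λ a b c d → a :*ℚ c :-ℚ b :*ℚ d :=ℚ a :*ℚ c :-ℚ (:-ℚ b) :*ℚ (:-ℚ d)) ≡.refl
    (seq (re z) k) (seq (im z) k) (seq (re w) k) (seq (im w) k))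
  (λ k → solveℚ 4 (λ a b c d → :-ℚ (a :*ℚ d :+ℚ b :*ℚ c) :=ℚ a :*ℚ (:-ℚ d) :+ℚ (:-ℚ b) :*ℚ c) ≡.refl
    (seq (re z) k) (seq (im z) k) (seq (re w) k) (seq (im w) k))

Real : ℂ → Set
Real z = conj z ≈ z

fromℚ-real : ∀ q → Real (fromℚ q)
fromℚ-real q = ≈-pointwise (λ _ → ≡.refl) (λ _ → ≡.refl)

-‿real : ∀ {z} → Real z → Real (- z)
-‿real {z} p = ≈-trans (≈-pointwise (λ _ → ≡.refl) (λ _ → ≡.refl)) (-‿cong p)

+-real : ∀ {z w} → Real z → Real w → Real (z + w)
+-real {z} {w} p q = ≈-trans (conj-+ z w) (+-cong p q)

n-real : ∀ a b → Real (n a b)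
n-real 0F 0F = fromℚ-real 0ℚ
n-real 0F 1F = fromℚ-real 1ℚ
n-real 1F 0F = fromℚ-real 0ℚ
n-real 1F 1F = fromℚ-real 0ℚ

δ-real : ∀ i j → Real (δ i j)
δ-real i j with i ℕ.≟ j
... | yes ≡.refl = ≈-trans (conj-cong (δ-refl i)) (≈-trans (fromℚ-real 1ℚ) (≈-sym (δ-refl i)))
... | no  i≢j    = ≈-trans (conj-cong (δ-≢ i≢j)) (≈-trans (fromℚ-real 0ℚ) (≈-sym (δ-≢ i≢j)))

derivation-conj : ∀ {M} → (∀ a b → Real (M a b)) → (v : Vect D) →
  derivation M (conj ∘ v) ≈ᵥ conj ∘ derivation M v
derivation-conj real v []      = ≈-sym (fromℚ-real 0ℚ)
derivation-conj {M = M} real v (a ∷ y) = begin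
  (M a 0F * conj (v (0F ∷ y)) + M a 1F * conj (v (1F ∷ y))) + derivation M (conj ∘ v ∘ (a ∷_)) y
    ≈⟨ +-cong (+-cong (*-congʳ (real a 0F)) (*-congʳ (real a 1F))) (≈-sym (derivation-conj real (v ∘ (a ∷_)) y)) ⟨
  (conj (M a 0F) * conj (v (0F ∷ y)) + conj (M a 1F) * conj (v (1F ∷ y))) + conj (derivation M (v ∘ (a ∷_)) y)
    ≈⟨ +-congʳ (+-cong (conj-* (M a 0F) (v (0F ∷ y))) (conj-* (M a 1F) (v (1F ∷ y)))) ⟨
  (conj (M a 0F * v (0F ∷ y)) + conj (M a 1F * v (1F ∷ y))) + conj (derivation M (v ∘ (a ∷_)) y)
    ≈⟨ +-congʳ (conj-+ (M a 0F * v (0F ∷ y)) (M a 1F * v (1F ∷ y))) ⟨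
  conj (M a 0F * v (0F ∷ y) + M a 1F * v (1F ∷ y)) + conj (derivation M (v ∘ (a ∷_)) y)
    ≈⟨ conj-+ (M a 0F * v (0F ∷ y) + M a 1F * v (1F ∷ y)) (derivation M (v ∘ (a ∷_)) y) ⟨
  conj (derivation M v (a ∷ y)) ∎

derivation-adjoint : ∀ M (v w : Vect D) →
  ∑ (λ y → derivation M v y * w y) ≈ ∑ (λ y → v y * derivation (λ a b → M b a) w y)
derivation-adjoint {zero}  M v w = solve 2 (λ a b → :0 :* b := a :* :0) ≈-refl (v []) (w [])
derivation-adjoint {suc D} M v w = begin
  ∑ (λ y → derivation M v y * w y)
    ≈⟨ ∑-split (λ y → derivation M v y * w y) ⟩
  ∑ (λ y → derivation M v (0F ∷ y) * w (0F ∷ y)) + ∑ (λ y → derivation M v (1F ∷ y) * w (1F ∷ y))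
    ≈⟨ +-cong (left 0F) (left 1F) ⟩
  (M 0F 0F * S 0F 0F + M 0F 1F * S 1F 0F + U 0F) + (M 1F 0F * S 0F 1F + M 1F 1F * S 1F 1F + U 1F)
    ≈⟨ solve 10 (λ a b c d s t u v x y → (a :* s :+ b :* t :+ x) :+ (c :* u :+ d :* v :+ y)
         := (a :* s :+ c :* u :+ x) :+ (b :* t :+ d :* v :+ y)) ≈-refl
         (M 0F 0F) (M 0F 1F) (M 1F 0F) (M 1F 1F) (S 0F 0F) (S 1F 0F) (S 0F 1F) (S 1F 1F) (U 0F) (U 1F) ⟩
  (M 0F 0F * S 0F 0F + M 1F 0F * S 0F 1F + U 0F) + (M 0F 1F * S 1F 0F + M 1F 1F * S 1F 1F + U 1F)
    ≈⟨ +-cong (right 0F) (right 1F) ⟨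
  ∑ (λ y → v (0F ∷ y) * derivation Mᵀ w (0F ∷ y)) + ∑ (λ y → v (1F ∷ y) * derivation Mᵀ w (1F ∷ y))
    ≈⟨ ∑-split (λ y → v y * derivation Mᵀ w y) ⟨
  ∑ (λ y → v y * derivation Mᵀ w y) ∎
  where
  Mᵀ : Mat₂
  Mᵀ a b = M b a
  S : Fin 2 → Fin 2 → ℂ
  S a b = ∑ (λ y → v (a ∷ y) * w (b ∷ y))
  U : Fin 2 → ℂ
  U a = ∑ (λ y → derivation M (v ∘ (a ∷_)) y * w (a ∷ y))
  linear : ∀ p q (f g h : Vertex D → ℂ) → ∑ (λ y → p * f y + q * g y + h y) ≈ p * ∑ f + q * ∑ g + ∑ h
  linear p q f g h = begin
    ∑ (λ y → p * f y + q * g y + h y)                ≈⟨ ∑-+ (λ y → p * f y + q * g y) h ⟩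
    ∑ (λ y → p * f y + q * g y) + ∑ h                ≈⟨ +-congʳ (∑-+ (λ y → p * f y) (λ y → q * g y)) ⟩
    ∑ (λ y → p * f y) + ∑ (λ y → q * g y) + ∑ h      ≈⟨ +-congʳ (+-cong (∑-*ˡ p f) (∑-*ˡ q g)) ⟩
    p * ∑ f + q * ∑ g + ∑ h                          ∎
  left : ∀ a → ∑ (λ y → derivation M v (a ∷ y) * w (a ∷ y)) ≈ M a 0F * S 0F a + M a 1F * S 1F a + U a
  left a = begin
    ∑ (λ y → derivation M v (a ∷ y) * w (a ∷ y))
      ≈⟨ ∑-cong (λ y → solve 6 (λ p q s t d w → ((p :* s :+ q :* t) :+ d) :* w
           := p :* (s :* w) :+ q :* (t :* w) :+ d :* w)
               ≈-refl (M a 0F) (M a 1F) (v (0F ∷ y)) (v (1F ∷ y)) _ (w (a ∷ y))) ⟩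
    ∑ (λ y → M a 0F * (v (0F ∷ y) * w (a ∷ y)) + M a 1F * (v (1F ∷ y) * w (a ∷ y))
      + derivation M (v ∘ (a ∷_)) y * w (a ∷ y))
      ≈⟨ linear _ _ _ _ _ ⟩
    M a 0F * S 0F a + M a 1F * S 1F a + U a ∎
  right : ∀ a → ∑ (λ y → v (a ∷ y) * derivation Mᵀ w (a ∷ y)) ≈ M 0F a * S a 0F + M 1F a * S a 1F + U a
  right a = begin
    ∑ (λ y → v (a ∷ y) * derivation Mᵀ w (a ∷ y))
      ≈⟨ ∑-cong (λ y → solve 6 (λ p q s t d w → w :* ((p :* s :+ q :* t) :+ d)
           := p :* (w :* s) :+ q :* (w :* t) :+ w :* d)
               ≈-refl (M 0F a) (M 1F a) (w (0F ∷ y)) (w (1F ∷ y)) _ (v (a ∷ y))) ⟩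
    ∑ (λ y → M 0F a * (v (a ∷ y) * w (0F ∷ y)) + M 1F a * (v (a ∷ y) * w (1F ∷ y))
      + v (a ∷ y) * derivation Mᵀ (w ∘ (a ∷_)) y)
      ≈⟨ linear _ _ _ _ _ ⟩
    M 0F a * S a 0F + M 1F a * S a 1F + ∑ (λ y → v (a ∷ y) * derivation Mᵀ (w ∘ (a ∷_)) y)
      ≈⟨ +-congˡ (derivation-adjoint M (v ∘ (a ∷_)) (w ∘ (a ∷_))) ⟨
    M 0F a * S a 0F + M 1F a * S a 1F + U a ∎

⟨⟩-congˡ : {v v′ : Vect D} (w : Vect D) → v ≈ᵥ v′ → ⟨ v , w ⟩ ≈ ⟨ v′ , w ⟩
⟨⟩-congˡ w p = ∑-cong (λ y → *-congʳ (p y))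

⟨⟩-congʳ : (v : Vect D) {w w′ : Vect D} → w ≈ᵥ w′ → ⟨ v , w ⟩ ≈ ⟨ v , w′ ⟩
⟨⟩-congʳ v p = ∑-cong (λ y → *-congˡ (conj-cong (p y)))

⟨⟩-*ˡ : ∀ c (v w : Vect D) → ⟨ c *ᵥ v , w ⟩ ≈ c * ⟨ v , w ⟩
⟨⟩-*ˡ c v w = ≈-trans (∑-cong (λ y → *-assoc c (v y) (conj (w y)))) (∑-*ˡ c (λ y → v y * conj (w y)))

⟨⟩-zeroˡ : {v : Vect D} (w : Vect D) → v ≈ᵥ 0ᵥ → ⟨ v , w ⟩ ≈ 0#
⟨⟩-zeroˡ {v = v} w p = begin
  ⟨ v , w ⟩          ≈⟨ ⟨⟩-congˡ w (λ y → ≈-trans (p y) (≈-sym (zeroˡ (v y)))) ⟩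
  ⟨ 0# *ᵥ v , w ⟩    ≈⟨ ⟨⟩-*ˡ 0# v w ⟩
  0# * ⟨ v , w ⟩     ≈⟨ zeroˡ _ ⟩
  0#                 ∎

derivation-n-at : ∀ k (v : Vect D) → derivation n (v at suc k) ≈ᵥ derivation n v at k
derivation-n-at k v = derivation-n-⊛ (λ j → δ j (suc k)) v

pairing-recurrence : ∀ {r} {a b : Vect D} →
  HighestWeight r (tensor P₁ a) → HighestWeight r (tensor P₁² b) → ∀ k →
  (fromℕ D - fromℕ r - fromℕ k) * ⟨ a at k , b ⟩
  ≈ (- 𝕚) * (fromℕ (suc k) - fromℕ r) * ⟨ a at suc k , b ⟩
pairing-recurrence {D} {r} {a} {b} ha hb k = begin
  l k * ⟨ a at k , b ⟩
    ≈⟨ ⟨⟩-*ˡ (l k) (a at k) b ⟨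
  ⟨ l k *ᵥ (a at k) , b ⟩
    ≈⟨ ⟨⟩-congˡ b lowered ⟨
  ∑ (λ y → derivation n (a at suc k) y * conj (b y))
    ≈⟨ derivation-adjoint n (a at suc k) (conj ∘ b) ⟩
  ∑ (λ y → (a at suc k) y * derivation nᵀ (conj ∘ b) y)
    ≈⟨ ∑-cong raised ⟩
  ⟨ m (suc k) *ᵥ (a at suc k) , b ⟩
    ≈⟨ ⟨⟩-*ˡ (m (suc k)) (a at suc k) b ⟩
  m (suc k) * ⟨ a at suc k , b ⟩ ∎
  where
  l m : ℕ → ℂ
  l j = fromℕ D - fromℕ r - fromℕ j
  m j = (- 𝕚) * (fromℕ j - fromℕ r)
  lowered : derivation n (a at suc k) ≈ᵥ l k *ᵥ (a at k)
  lowered y = begin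
    derivation n (a at suc k) y            ≈⟨ derivation-n-at k a y ⟩
    δ (weight y) k * derivation n a y      ≈⟨ *-congˡ (lowering ha y) ⟩
    δ (weight y) k * (l (weight y) * a y)  ≈⟨ solve 3 (λ d l a → d :* (l :* a) := l :* (d :* a))
        ≈-refl _ _ _ ⟩
    l (weight y) * (δ (weight y) k * a y)  ≈⟨ ⊛-at l a k y ⟩
    l k * (a at k) y                       ∎
  raised : ∀ y → (a at suc k) y * derivation nᵀ (conj ∘ b) y ≈ m (suc k) * (a at suc k) y * conj (b y)
  raised y = begin
    (a at suc k) y * derivation nᵀ (conj ∘ b) y
      -- The adjointness is bilinear, so the conjugation of the second argument has to be moved past
      -- `nᵀ`, whose entries are real.
      ≈⟨ *-congˡ (derivation-conj (λ i j → n-real j i) b y) ⟩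
    (a at suc k) y * conj (derivation nᵀ b y)
      ≈⟨ *-congˡ (conj-cong (raising² hb y)) ⟩
    (a at suc k) y * conj (𝕚 * (fromℕ (weight y) - fromℕ r) * b y)
      -- The weights are real, so conjugation only turns the factor 𝕚 into -𝕚.
      ≈⟨ *-congˡ (≈-trans (conj-* (𝕚 * (fromℕ (weight y) - fromℕ r)) (b y))
           (*-congʳ (≈-trans (conj-* 𝕚 (fromℕ (weight y) - fromℕ r))
           (*-cong (≈-pointwise (λ _ → ≡.refl) (λ _ → ≡.refl))
                   (+-real {fromℕ (weight y)} (fromℚ-real _) (-‿real {fromℕ r} (fromℚ-real _))))))) ⟩
    (a at suc k) y * (m (weight y) * conj (b y))
      ≈⟨ solve 3 (λ a m b → a :* (m :* b) := m :* a :* b) ≈-refl _ _ _ ⟩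
    m (weight y) * (a at suc k) y * conj (b y)
      ≈⟨ *-congʳ (⊛-at m a (suc k) y) ⟩
    m (suc k) * (a at suc k) y * conj (b y) ∎

-- Multiplying by 𝕚 removes -𝕚 and gives (i+1) x (i+1) = 𝕚 (d-i) x i. By absorption the claimed
-- closed form obeys the same rule, and i+1 can be cancelled.
binomial-recurrence : ∀ {d} (x : ℕ → ℂ) →
  (∀ i → (fromℕ d - fromℕ i) * x i ≈ (- 𝕚) * fromℕ (suc i) * x (suc i)) →
  ∀ i → x i ≈ 𝕚 ^ i * fromℕ (d C i) * x 0
binomial-recurrence {d} x rec zero = begin
  x 0                          ≈⟨ solve 1 (λ x → x := :1 :* :1 :* x) ≈-refl (x 0) ⟩
  1# * fromℕ 1 * x 0           ≡⟨ ≡.cong (λ c → 1# * fromℕ c * x 0) (nC0≡1 d) ⟨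
  1# * fromℕ (d C 0) * x 0     ∎
binomial-recurrence {d} x rec (suc i) = invertible-cancelˡ (fromℕ-suc-inverse i) (begin
  fromℕ (suc i) * x (suc i)
    ≈⟨ solve 2 (λ s x → s :* x := :𝕚 :* ((:- :𝕚) :* s :* x)) ≈-refl _ _ ⟩
  𝕚 * ((- 𝕚) * fromℕ (suc i) * x (suc i))
    ≈⟨ *-congˡ (rec i) ⟨
  𝕚 * ((fromℕ d - fromℕ i) * x i)
    ≈⟨ *-congˡ (*-congˡ (binomial-recurrence x rec i)) ⟩
  𝕚 * ((fromℕ d - fromℕ i) * (𝕚 ^ i * fromℕ (d C i) * x 0))
    ≈⟨ solve 5 (λ d i p c x → :𝕚 :* ((d :- i) :* (p :* c :* x)) := (d :* c :- i :* c) :* (:𝕚 :* p :* x))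
        ≈-refl _ _ _ _ _ ⟩
  (fromℕ d * fromℕ (d C i) - fromℕ i * fromℕ (d C i)) * (𝕚 * 𝕚 ^ i * x 0)
    ≈⟨ *-congʳ (+-congʳ absorption) ⟨
  (fromℕ (suc i) * fromℕ (d C suc i) + fromℕ i * fromℕ (d C i) - fromℕ i * fromℕ (d C i)) * (𝕚 * 𝕚 ^ i * x 0)
    ≈⟨ solve 5 (λ s c e p x → (s :* c :+ e :- e) :* (p :* x) := s :* (p :* c :* x)) ≈-refl _ _ _ _ _ ⟩
  fromℕ (suc i) * (𝕚 * 𝕚 ^ i * fromℕ (d C suc i) * x 0) ∎)
  where
  absorption : fromℕ (suc i) * fromℕ (d C suc i) + fromℕ i * fromℕ (d C i) ≈ fromℕ d * fromℕ (d C i)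
  absorption = begin
    _ ≈⟨ +-cong (fromℕ-homo-* (suc i) (d C suc i)) (fromℕ-homo-* i (d C i)) ⟨
    _ ≈⟨ fromℕ-homo-+ (suc i ℕ.* (d C suc i)) (i ℕ.* (d C i)) ⟨
    _ ≡⟨ ≡.cong fromℕ (C-absorption d i) ⟩
    _ ≈⟨ fromℕ-homo-* d (d C i) ⟩
    _ ∎

-- Summation over all weights

private
  module Mult = Algebra.Properties.Semiring.Mult semiring

×-fromℕ : ∀ m z → m Mult.× z ≈ fromℕ m * z
×-fromℕ zero    z = ≈-sym (zeroˡ z)
×-fromℕ (suc m) z = begin
  z + m Mult.× z        ≈⟨ +-congˡ (×-fromℕ m z) ⟩
  z + fromℕ m * z       ≈⟨ solve 2 (λ z m → z :+ m :* z := (:1 :+ m) :* z) ≈-refl z _ ⟩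
  (1# + fromℕ m) * z    ≈⟨ *-congʳ (fromℕ-suc m) ⟨
  fromℕ (suc m) * z     ∎

one-^ : ∀ m → 1# ^ m ≈ 1#
one-^ zero    = ≈-refl
one-^ (suc m) = ≈-trans (*-identityˡ _) (one-^ m)

binomial-theorem : ∀ d → sum {suc d} (λ k → 𝕚 ^ toℕ k * fromℕ (d C toℕ k)) ≈ (1# + 𝕚) ^ d
binomial-theorem d = begin
  sum {suc d} (λ k → 𝕚 ^ toℕ k * fromℕ (d C toℕ k))
    ≈⟨ sum-cong-≋ {suc d} (λ k → begin
         𝕚 ^ toℕ k * fromℕ (d C toℕ k)
           ≈⟨ solve 2 (λ p c → p :* c := c :* (p :* :1)) ≈-refl _ _ ⟩
         fromℕ (d C toℕ k) * (𝕚 ^ toℕ k * 1#)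
           ≈⟨ *-congˡ (*-congˡ (one-^ (d ℕ.∸ toℕ k))) ⟨
         fromℕ (d C toℕ k) * (𝕚 ^ toℕ k * 1# ^ (d ℕ.∸ toℕ k))
           ≈⟨ ×-fromℕ (d C toℕ k) _ ⟨
         (d C toℕ k) Mult.× (𝕚 ^ toℕ k * 1# ^ (d ℕ.∸ toℕ k)) ∎) ⟩
  _ ≈⟨ theorem d 𝕚 1# ⟨
  (𝕚 + 1#) ^ d ≈⟨ ^-congˡ d (+-comm 𝕚 1#) ⟩
  (1# + 𝕚) ^ d ∎
  where
  open Algebra.Properties.CommutativeSemiring.Binomial commutativeSemiring
  open Algebra.Properties.Semiring.Exp semiring using (^-congˡ)

inverse-^ : ∀ {c c⁻¹} → c * c⁻¹ ≈ 1# → ∀ d → c⁻¹ ^ d * c ^ d ≈ 1#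
inverse-^ inv zero    = *-identityˡ _
inverse-^ {c} {c⁻¹} inv (suc d) = begin
  c⁻¹ * c⁻¹ ^ d * (c * c ^ d)    ≈⟨ solve 4 (λ a b c d → a :* b :* (c :* d) := c :* a :* (b :* d))
       ≈-refl _ _ _ _ ⟩
  c * c⁻¹ * (c⁻¹ ^ d * c ^ d)    ≈⟨ *-cong inv (inverse-^ inv d) ⟩
  1# * 1#                        ≈⟨ *-identityˡ _ ⟩
  1#                             ∎

sum-zero : ∀ {m} {f : Fin m → ℂ} → (∀ i → f i ≈ 0#) → sum f ≈ 0#
sum-zero {zero}  p = ≈-refl
sum-zero {suc m} p = ≈-trans (+-cong (p zero) (sum-zero (p ∘ suc))) (+-identityˡ _)

sum-shift : ∀ r {m} (x : ℕ → ℂ) → (∀ k → k < r → x k ≈ 0#) →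
  sum {r ℕ.+ m} (x ∘ toℕ) ≈ sum {m} (λ i → x (r ℕ.+ toℕ i))
sum-shift zero    x p = ≈-refl
sum-shift (suc r) x p = ≈-trans (+-cong (p 0 (s≤s z≤n)) (sum-shift r (x ∘ suc) (λ k q → p (suc k) (s≤s q))))
  (+-identityˡ _)

sum-truncate : ∀ m {k} (x : ℕ → ℂ) → (∀ j → m ≤ j → x j ≈ 0#) →
  sum {m ℕ.+ k} (x ∘ toℕ) ≈ sum {m} (x ∘ toℕ)
sum-truncate zero {k} x p = sum-zero {k} (λ i → p (toℕ i) z≤n)
sum-truncate (suc m) x p = +-congˡ (sum-truncate m (x ∘ suc) (λ j q → p (suc j) (s≤s q)))

sum-δ : ∀ {m j} → j < m → sum {m} (λ k → δ j (toℕ k)) ≈ 1#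
sum-δ {suc m} {zero}  _       = ≈-trans (+-congˡ (sum-zero {m} (λ _ → ≈-refl))) (+-identityʳ _)
sum-δ {suc m} {suc j} (s≤s p) = ≈-trans (+-identityˡ _) (sum-δ p)

sum-∑ : ∀ {m} (f : Fin m → Vertex D → ℂ) → sum (λ k → ∑ (f k)) ≈ ∑ (λ y → sum (λ k → f k y))
sum-∑ {D} {zero}  f = ≈-sym (≈-trans (∑-cong {D} (λ _ → ≈-sym (zeroˡ 0#)))
  (≈-trans (∑-*ˡ {D} 0# (λ _ → 0#)) (zeroˡ _)))
sum-∑ {D} {suc m} f = ≈-trans (+-congˡ (sum-∑ (f ∘ suc))) (≈-sym (∑-+ (f zero) (λ y → sum (λ k → f (suc k) y))))

-- The projections `E* 0` to `E* D` sum to the identity, because `weight y` occurs exactly once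
-- among 0, ..., D.
pairing-decomposition : (a b : Vect D) → sum {suc D} (λ k → ⟨ a at toℕ k , b ⟩) ≈ ⟨ a , b ⟩
pairing-decomposition {D} a b = begin
  sum {suc D} (λ k → ⟨ a at toℕ k , b ⟩)
    ≈⟨ sum-∑ {m = suc D} (λ k y → (a at toℕ k) y * conj (b y)) ⟩
  ∑ (λ y → sum {suc D} (λ k → δ (weight y) (toℕ k) * a y * conj (b y)))
    ≈⟨ ∑-cong (λ y → sum-cong-≋ {suc D} (λ k → *-assoc (δ (weight y) (toℕ k)) (a y) (conj (b y)))) ⟩
  ∑ (λ y → sum {suc D} (λ k → δ (weight y) (toℕ k) * (a y * conj (b y))))
    ≈⟨ ∑-cong (λ y → *-distribʳ-sum {suc D} (a y * conj (b y)) (λ k → δ (weight y) (toℕ k))) ⟨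
  ∑ (λ y → sum {suc D} (λ k → δ (weight y) (toℕ k)) * (a y * conj (b y)))
    ≈⟨ ∑-cong (λ y → ≈-trans (*-congʳ (sum-δ (s≤s (weight≤ y)))) (*-identityˡ (a y * conj (b y)))) ⟩
  ⟨ a , b ⟩ ∎

pairing-formula : ∀ {r d} → D ≡ d ℕ.+ (r ℕ.+ r) → {a b : Vect D} →
  HighestWeight r (tensor P₁ a) → HighestWeight r (tensor P₁² b) →
  (∀ k → k < r → a at k ≈ᵥ 0ᵥ) → (∀ k → r ℕ.+ d < k → a at k ≈ᵥ 0ᵥ) →
  ∀ i → ⟨ a at (r ℕ.+ i) , b ⟩ ≈ 𝕚 ^ i * fromℕ (d C i) * [1+𝕚]⁻¹ ^ d * ⟨ a , b ⟩
pairing-formula {D} {r} {d} D≡ {a} {b} ha hb below above i = begin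
  x i
    ≈⟨ closed i ⟩
  𝕚 ^ i * fromℕ (d C i) * x 0
    ≈⟨ *-congˡ leading ⟩
  𝕚 ^ i * fromℕ (d C i) * ([1+𝕚]⁻¹ ^ d * ⟨ a , b ⟩)
    ≈⟨ *-assoc _ _ _ ⟨
  𝕚 ^ i * fromℕ (d C i) * [1+𝕚]⁻¹ ^ d * ⟨ a , b ⟩ ∎
  where
  x : ℕ → ℂ
  x i = ⟨ a at (r ℕ.+ i) , b ⟩

  fromℕ-D : fromℕ D ≈ fromℕ d + (fromℕ r + fromℕ r)
  fromℕ-D = ≈-trans (≈-reflexive (≡.cong fromℕ D≡))
    (≈-trans (fromℕ-homo-+ d (r ℕ.+ r)) (+-congˡ (fromℕ-homo-+ r r)))

  recurrence : ∀ i → (fromℕ d - fromℕ i) * x i ≈ (- 𝕚) * fromℕ (suc i) * x (suc i)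
  recurrence i = begin
    (fromℕ d - fromℕ i) * x i
      -- With D = d + 2r the coefficient D - r - k at k = r + i is d - i.
      ≈⟨ *-congʳ (solve 3 (λ d r i → d :- i := (d :+ (r :+ r)) :- r :- (r :+ i))
          ≈-refl (fromℕ d) (fromℕ r) (fromℕ i)) ⟩
    (fromℕ d + (fromℕ r + fromℕ r) - fromℕ r - (fromℕ r + fromℕ i)) * x i
      ≈⟨ *-congʳ (+-cong (+-congʳ fromℕ-D) (-‿cong (fromℕ-homo-+ r i))) ⟨
    (fromℕ D - fromℕ r - fromℕ (r ℕ.+ i)) * x i
      ≈⟨ pairing-recurrence ha hb (r ℕ.+ i) ⟩
    (- 𝕚) * (fromℕ (suc (r ℕ.+ i)) - fromℕ r) * ⟨ a at suc (r ℕ.+ i) , b ⟩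
      ≡⟨ ≡.cong (λ k → (- 𝕚) * (fromℕ k - fromℕ r) * ⟨ a at k , b ⟩) (ℕ.+-suc r i) ⟨
    (- 𝕚) * (fromℕ (r ℕ.+ suc i) - fromℕ r) * x (suc i)
      ≈⟨ *-congʳ (*-congˡ (+-congʳ (fromℕ-homo-+ r (suc i)))) ⟩
    (- 𝕚) * (fromℕ r + fromℕ (suc i) - fromℕ r) * x (suc i)
      ≈⟨ solve 3 (λ r i x → (:- :𝕚) :* (r :+ i :- r) :* x := (:- :𝕚) :* i :* x) ≈-refl _ _ _ ⟩
    (- 𝕚) * fromℕ (suc i) * x (suc i) ∎

  closed : ∀ i → x i ≈ 𝕚 ^ i * fromℕ (d C i) * x 0
  closed = binomial-recurrence {d} x recurrence

  total : ⟨ a , b ⟩ ≈ (1# + 𝕚) ^ d * x 0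
  total = begin
    ⟨ a , b ⟩
      ≈⟨ pairing-decomposition a b ⟨
    sum {suc D} (λ k → ⟨ a at toℕ k , b ⟩)
      -- The D + 1 weights split into r below the endpoint, d + 1 that carry the sum, and r above.
      ≡⟨ ≡.cong (λ m → sum {m} (λ k → ⟨ a at toℕ k , b ⟩)) size ⟩
    sum {r ℕ.+ (suc d ℕ.+ r)} (λ k → ⟨ a at toℕ k , b ⟩)
      ≈⟨ sum-shift r (λ k → ⟨ a at k , b ⟩) (λ k k<r → ⟨⟩-zeroˡ b (below k k<r)) ⟩
    sum {suc d ℕ.+ r} (x ∘ toℕ)
      ≈⟨ sum-truncate (suc d) x (λ j d<j → ⟨⟩-zeroˡ b (above (r ℕ.+ j) (ℕ.+-monoʳ-< r d<j))) ⟩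
    sum {suc d} (x ∘ toℕ)
      ≈⟨ sum-cong-≋ {suc d} (λ k → closed (toℕ k)) ⟩
    sum {suc d} (λ k → 𝕚 ^ toℕ k * fromℕ (d C toℕ k) * x 0)
      ≈⟨ *-distribʳ-sum {suc d} (x 0) (λ k → 𝕚 ^ toℕ k * fromℕ (d C toℕ k)) ⟨
    sum {suc d} (λ k → 𝕚 ^ toℕ k * fromℕ (d C toℕ k)) * x 0
      ≈⟨ *-congʳ (binomial-theorem d) ⟩
    (1# + 𝕚) ^ d * x 0 ∎
    where
    size : suc D ≡ r ℕ.+ (suc d ℕ.+ r)
    size = ≡.trans (≡.cong suc D≡)
      (solveℕ 2 (λ d r → conℕ 1 :+ℕ (d :+ℕ (r :+ℕ r)) :=ℕ r :+ℕ (conℕ 1 :+ℕ d :+ℕ r)) ≡.refl d r)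

  leading : x 0 ≈ [1+𝕚]⁻¹ ^ d * ⟨ a , b ⟩
  leading = begin
    x 0                                    ≈⟨ *-identityˡ _ ⟨
    1# * x 0                               ≈⟨ *-congʳ (inverse-^ [1+𝕚]⁻¹-inverse d) ⟨
    [1+𝕚]⁻¹ ^ d * (1# + 𝕚) ^ d * x 0       ≈⟨ *-assoc _ _ _ ⟩
    [1+𝕚]⁻¹ ^ d * ((1# + 𝕚) ^ d * x 0)     ≈⟨ *-congˡ total ⟨
    [1+𝕚]⁻¹ ^ d * ⟨ a , b ⟩                ∎

-- Components of different weights have disjoint supports, so projecting the second argument as well
-- only contributes the factor `δ i j`.
pairing-at : ∀ r i j (a b : Vect D) →
  ⟨ a at (r ℕ.+ i) , b at (r ℕ.+ j) ⟩ ≈ δ i j * ⟨ a at (r ℕ.+ i) , b ⟩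
pairing-at r i j a b = ≈-trans (∑-cong (λ y → begin
  (a at (r ℕ.+ i)) y * conj ((b at (r ℕ.+ j)) y)
    ≈⟨ *-congˡ (≈-trans (conj-* (δ (weight y) (r ℕ.+ j)) (b y)) (*-congʳ (δ-real (weight y) (r ℕ.+ j)))) ⟩
  δ (weight y) (r ℕ.+ i) * a y * (δ (weight y) (r ℕ.+ j) * conj (b y))
    ≈⟨ solve 4 (λ d a e b → d :* a :* (e :* b) := (e :* d) :* (a :* b)) ≈-refl _ _ _ _ ⟩
  (δ (weight y) (r ℕ.+ j) * δ (weight y) (r ℕ.+ i)) * (a y * conj (b y))
    ≈⟨ *-congʳ (δ-subst (λ k → δ k (r ℕ.+ j)) (weight y) (r ℕ.+ i)) ⟩
  (δ (r ℕ.+ i) (r ℕ.+ j) * δ (weight y) (r ℕ.+ i)) * (a y * conj (b y))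
    ≡⟨ ≡.cong (λ c → (c * δ (weight y) (r ℕ.+ i)) * (a y * conj (b y))) (δ-shift r) ⟩
  (δ i j * δ (weight y) (r ℕ.+ i)) * (a y * conj (b y))
    ≈⟨ solve 4 (λ d e a b → (d :* e) :* (a :* b) := d :* (e :* a :* b)) ≈-refl _ _ _ _ ⟩
  δ i j * ((a at (r ℕ.+ i)) y * conj (b y)) ∎)) (∑-*ˡ (δ i j) (λ y → (a at (r ℕ.+ i)) y * conj (b y)))
  where
  δ-shift : ∀ r → δ (r ℕ.+ i) (r ℕ.+ j) ≡ δ i j
  δ-shift zero    = ≡.refl
  δ-shift (suc r) = δ-shift r

-- Conjugation by P

P₁-isometry : (v w : Vect D) → ⟨ tensor P₁ v , tensor P₁ w ⟩ ≈ 2ᶜ ^ D * ⟨ v , w ⟩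
P₁-isometry {zero}  v w = ≈-sym (*-identityˡ _)
P₁-isometry {suc D} v w = begin
  ⟨ tensor P₁ v , tensor P₁ w ⟩
    ≈⟨ ∑-split (λ y → tensor P₁ v y * conj (tensor P₁ w y)) ⟩
  ∑ (λ y → tensor P₁ v (0F ∷ y) * conj (tensor P₁ w (0F ∷ y))) +
  ∑ (λ y → tensor P₁ v (1F ∷ y) * conj (tensor P₁ w (1F ∷ y)))
    ≈⟨ ∑-+ (λ y → tensor P₁ v (0F ∷ y) * conj (tensor P₁ w (0F ∷ y)))
           (λ y → tensor P₁ v (1F ∷ y) * conj (tensor P₁ w (1F ∷ y))) ⟨
  ∑ (λ y → tensor P₁ v (0F ∷ y) * conj (tensor P₁ w (0F ∷ y)) +
           tensor P₁ v (1F ∷ y) * conj (tensor P₁ w (1F ∷ y)))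
    ≈⟨ ∑-cong (λ y → parallelogram (V 0F y) (V 1F y) (W 0F y) (W 1F y)) ⟩
  ∑ (λ y → 2ᶜ * (V 0F y * conj (W 0F y) + V 1F y * conj (W 1F y)))
    ≈⟨ ∑-*ˡ 2ᶜ (λ y → V 0F y * conj (W 0F y) + V 1F y * conj (W 1F y)) ⟩
  2ᶜ * ∑ (λ y → V 0F y * conj (W 0F y) + V 1F y * conj (W 1F y))
    ≈⟨ *-congˡ (∑-+ (λ y → V 0F y * conj (W 0F y)) (λ y → V 1F y * conj (W 1F y))) ⟩
  2ᶜ * (⟨ V 0F , W 0F ⟩ + ⟨ V 1F , W 1F ⟩)
    ≈⟨ *-congˡ (+-cong (P₁-isometry (v ∘ (0F ∷_)) (w ∘ (0F ∷_))) (P₁-isometry (v ∘ (1F ∷_)) (w ∘ (1F ∷_)))) ⟩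
  2ᶜ * (2ᶜ ^ D * ⟨ v ∘ (0F ∷_) , w ∘ (0F ∷_) ⟩ + 2ᶜ ^ D * ⟨ v ∘ (1F ∷_) , w ∘ (1F ∷_) ⟩)
    ≈⟨ solve 4 (λ t e x y → t :* (e :* x :+ e :* y) := t :* e :* (x :+ y)) ≈-refl 2ᶜ (2ᶜ ^ D) _ _ ⟩
  2ᶜ * 2ᶜ ^ D * (⟨ v ∘ (0F ∷_) , w ∘ (0F ∷_) ⟩ + ⟨ v ∘ (1F ∷_) , w ∘ (1F ∷_) ⟩)
    ≈⟨ *-congˡ (∑-split (λ y → v y * conj (w y))) ⟨
  2ᶜ * 2ᶜ ^ D * ⟨ v , w ⟩ ∎
  where
  V W : Fin 2 → Vect D
  V b = tensor P₁ (v ∘ (b ∷_))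
  W b = tensor P₁ (w ∘ (b ∷_))
  conj-linear : ∀ {c d c′ d′} → conj c ≈ c′ → conj d ≈ d′ → ∀ z w → conj (c * z + d * w) ≈ c′ * conj z + d′ * conj w
  conj-linear {c} {d} p q z w = ≈-trans (conj-+ (c * z) (d * w))
    (+-cong (≈-trans (conj-* c z) (*-congʳ p)) (≈-trans (conj-* d w) (*-congʳ q)))
  conj-𝕚 : conj 𝕚 ≈ - 𝕚
  conj-𝕚 = ≈-pointwise (λ _ → ≡.refl) (λ _ → ≡.refl)
  conj-[-𝕚] : conj (- 𝕚) ≈ 𝕚
  conj-[-𝕚] = ≈-pointwise (λ _ → ≡.refl) (λ _ → ≡.refl)
  parallelogram : ∀ a b c d →
    (1# * a + 1# * b) * conj (1# * c + 1# * d) + ((- 𝕚) * a + 𝕚 * b) * conj ((- 𝕚) * c + 𝕚 * d)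
    ≈ 2ᶜ * (a * conj c + b * conj d)
  parallelogram a b c d = begin
    _ ≈⟨ +-cong (*-congˡ (conj-linear {1#} {1#} (fromℚ-real 1ℚ) (fromℚ-real 1ℚ) c d))
                (*-congˡ (conj-linear { - 𝕚} {𝕚} conj-[-𝕚] conj-𝕚 c d)) ⟩
    _ ≈⟨ solve 4 (λ a b c d → (:1 :* a :+ :1 :* b) :* (:1 :* c :+ :1 :* d)
           :+ ((:- :𝕚) :* a :+ :𝕚 :* b) :* (:𝕚 :* c :+ (:- :𝕚) :* d)
           := (:1 :+ :1) :* (a :* c :+ b :* d)) ≈-refl a b (conj c) (conj d) ⟩
    _ ∎

-- Both inner products are scaled by the same 2^D, which cancels. Identities between inner products
-- may therefore be proved after applying `P`.
P₁-transfer : ∀ {c} (v w v′ w′ : Vect D) →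
  ⟨ tensor P₁ v , tensor P₁ w ⟩ ≈ c * ⟨ tensor P₁ v′ , tensor P₁ w′ ⟩ → ⟨ v , w ⟩ ≈ c * ⟨ v′ , w′ ⟩
P₁-transfer {D} {c} v w v′ w′ p = invertible-cancelˡ (inverse-^ 2*½≈1 D) (begin
  2ᶜ ^ D * ⟨ v , w ⟩                        ≈⟨ P₁-isometry v w ⟨
  ⟨ tensor P₁ v , tensor P₁ w ⟩             ≈⟨ p ⟩
  c * ⟨ tensor P₁ v′ , tensor P₁ w′ ⟩       ≈⟨ *-congˡ (P₁-isometry v′ w′) ⟩
  c * (2ᶜ ^ D * ⟨ v′ , w′ ⟩)                ≈⟨ solve 3 (λ c t x → c :* (t :* x) := t :* (c :* x))
       ≈-refl c _ _ ⟩
  2ᶜ ^ D * (c * ⟨ v′ , w′ ⟩)                ∎)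
  where
  2*½≈1 : 2ᶜ * fromℚ ½ ≈ 1#
  2*½≈1 = ≈-pointwise (λ _ → ≡.refl) (λ _ → ≡.refl)

-- Idempotents as Lagrange polynomials

factor-coefficients : ℕ → ℕ → ℕ → ℂ × ℂ
factor-coefficients D i j with i ℕ.≟ j
... | yes _   = 0# , 1#
... | no  i≢j = fromℚ (1/[θᵢ-θⱼ] D i≢j) , - (fromℚ (1/[θᵢ-θⱼ] D i≢j) * fromℤ (θ D j))

-- With every factor in the affine form α A + β, the skipped index j = i included as 0 A + 1, the
-- same coefficients can be evaluated at `A`, at `A*` and at an eigenvalue.
E-factor-∙ : ∀ i j (v : Vect D) → E-factor i j ∙ v
  ≈ᵥ proj₁ (factor-coefficients D i j) *ᵥ (A ∙ v) +ᵥ proj₂ (factor-coefficients D i j) *ᵥ v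
E-factor-∙ {D} i j v y with i ℕ.≟ j
... | yes _   = ≈-trans (I-∙ v y) (solve 2 (λ x z → x := :0 :* z :+ :1 :* x) ≈-refl (v y) _)
... | no  i≢j = begin
  ((q *ₘ (A -ₘ t *ₘ I)) ∙ v) y           ≈⟨ *ₘ-∙ q (A -ₘ t *ₘ I) v y ⟩
  q * ((A -ₘ t *ₘ I) ∙ v) y              ≈⟨ *-congˡ (-ₘ-∙ A (t *ₘ I) v y) ⟩
  q * ((A ∙ v) y - ((t *ₘ I) ∙ v) y)     ≈⟨ *-congˡ (+-congˡ (-‿cong (≈-trans (*ₘ-∙ t I v y) (*-congˡ (I-∙ v y))))) ⟩
  q * ((A ∙ v) y - t * v y)              ≈⟨ solve 4 (λ q a t x → q :* (a :- t :* x) := q :* a :+ (:- (q :* t)) :* x)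
       ≈-refl q _ t (v y) ⟩
  q * (A ∙ v) y + (- (q * t)) * v y      ∎
  where
  q = fromℚ (1/[θᵢ-θⱼ] D i≢j)
  t = fromℤ (θ D j)

factor : ℕ → ℕ → ℕ → ℕ → ℂ
factor D i j k = proj₁ (factor-coefficients D i j) * fromℤ (θ D k) + proj₂ (factor-coefficients D i j)

-- The product of Lagrange factors for the node θ i over the nodes listed, evaluated at θ k. Over
-- the full list 0, ..., D it is the Lagrange basis polynomial.
factors : ℕ → ℕ → List ℕ → ℕ → ℂ
factors D i []       k = 1#
factors D i (j ∷ js) k = factor D i j k * factors D i js k

factor-diagonal : ∀ i j → factor D i j i ≈ 1#
factor-diagonal {D} i j with i ℕ.≟ j
... | yes _   = solve 1 (λ t → :0 :* t :+ :1 := :1) ≈-refl (fromℤ (θ D i))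
... | no  i≢j = begin
  q * fromℤ (θ D i) + - (q * fromℤ (θ D j))
    ≈⟨ solve 3 (λ q s t → q :* s :+ (:- (q :* t)) := q :* (s :+ (:- t)))
        ≈-refl q (fromℤ (θ D i)) (fromℤ (θ D j)) ⟩
  q * (fromℤ (θ D i) + - fromℤ (θ D j))
    ≈⟨ *-congˡ (+-congˡ (fromℤ-homo-neg (θ D j))) ⟨
  q * (fromℤ (θ D i) + fromℤ (ℤ.- θ D j))
    ≈⟨ *-congˡ (fromℤ-homo-+ (θ D i) (ℤ.- θ D j)) ⟨
  q * fromℤ (θ D i ℤ.- θ D j)
    ≈⟨ fromℚ-homo-* (1/[θᵢ-θⱼ] D i≢j) _ ⟨
  fromℚ (1/[θᵢ-θⱼ] D i≢j ℚ.* ℚ.fromℤ (θ D i ℤ.- θ D j))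
    ≡⟨ ≡.cong fromℚ (ℚ.*-inverseˡ (ℚ.fromℤ (θ D i ℤ.- θ D j))
         {{ℤ.≢-nonZero (λ eq → i≢j (θ-injective D (ℤ.i-j≡0⇒i≡j (θ D i) (θ D j) eq)))}}) ⟩
  1# ∎
  where
  q = fromℚ (1/[θᵢ-θⱼ] D i≢j)

factor-root : ∀ {i j} → i ≢ j → factor D i j j ≈ 0#
factor-root {D} {i} {j} i≢j with i ℕ.≟ j
... | yes i≡j = contradiction i≡j i≢j
... | no  i≢j = solve 2 (λ q t → q :* t :+ (:- (q :* t)) := :0) ≈-refl _ _

factors-diagonal : ∀ i js → factors D i js i ≈ 1#
factors-diagonal i []       = ≈-refl
factors-diagonal i (j ∷ js) = ≈-trans (*-cong (factor-diagonal i j) (factors-diagonal i js)) (*-identityˡ 1#)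

factors-root : ∀ {i k js} → i ≢ k → k List.∈ js → factors D i js k ≈ 0#
factors-root i≢k (Any.here ≡.refl) = ≈-trans (*-congʳ (factor-root i≢k)) (zeroˡ _)
factors-root i≢k (Any.there p)     = ≈-trans (*-congˡ (factors-root i≢k p)) (zeroʳ _)

factors-δ : ∀ i {k} → k ≤ D → factors D i (List.upTo (suc D)) k ≈ δ k i
factors-δ {D} i {k} k≤D with k ℕ.≟ i
... | yes ≡.refl = ≈-trans (factors-diagonal i (List.upTo (suc D))) (≈-sym (δ-refl i))
... | no  k≢i    = ≈-trans (factors-root (k≢i ∘ ≡.sym) (∈-upTo⁺ (s≤s k≤D))) (≈-sym (δ-≢ k≢i))

P₁σˣ≈σᶻP₁ : P₁ ·₂ σˣ ≈₂ σᶻ ·₂ P₁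
P₁σˣ≈σᶻP₁ = ≈₂-computed ≡.refl ≡.refl ≡.refl ≡.refl ≡.refl ≡.refl ≡.refl ≡.refl

P₁-A : (v : Vect D) → tensor P₁ (A ∙ v) ≈ᵥ (λ k → fromℤ (θ D k)) ⊛ tensor P₁ v
P₁-A {D} v y = begin
  tensor P₁ (A ∙ v) y                                      ≈⟨ tensor-cong P₁ (A-∙ v) y ⟩
  tensor P₁ (derivation σˣ v) y                            ≈⟨ tensor-derivation P₁σˣ≈σᶻP₁ v y ⟩
  derivation σᶻ (tensor P₁ v) y                            ≈⟨ derivation-σᶻ (tensor P₁ v) y ⟩
  (fromℕ D - 2ᶜ * fromℕ (weight y)) * tensor P₁ v y        ≈⟨ *-congʳ (θ-≈ D (weight y)) ⟨
  fromℤ (θ D (weight y)) * tensor P₁ v y                   ∎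

-- Since P A = A* P, `P` turns a polynomial in `A` into the same polynomial in `A*`, and the latter
-- acts on weight k by its value at θ k.
P₁-E-factors : ∀ i js (v : Vect D) →
  tensor P₁ (List.foldr _·_ I (List.map (E-factor i) js) ∙ v) ≈ᵥ factors D i js ⊛ tensor P₁ v
P₁-E-factors i []       v y = ≈-trans (tensor-cong P₁ (I-∙ v) y) (≈-sym (*-identityˡ _))
P₁-E-factors {D} i (j ∷ js) v y = begin
  tensor P₁ ((E-factor i j · M) ∙ v) y
    ≈⟨ tensor-cong P₁ (·-∙ (E-factor i j) M v) y ⟩
  tensor P₁ (E-factor i j ∙ M ∙ v) y
    ≈⟨ tensor-cong P₁ (E-factor-∙ i j (M ∙ v)) y ⟩
  tensor P₁ (α *ᵥ (A ∙ M ∙ v) +ᵥ β *ᵥ (M ∙ v)) y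
    ≈⟨ tensor-linear P₁ α β (A ∙ M ∙ v) (M ∙ v) y ⟩
  α * tensor P₁ (A ∙ M ∙ v) y + β * tensor P₁ (M ∙ v) y
    ≈⟨ +-congʳ (*-congˡ (P₁-A (M ∙ v) y)) ⟩
  α * (fromℤ (θ D (weight y)) * tensor P₁ (M ∙ v) y) + β * tensor P₁ (M ∙ v) y
    ≈⟨ solve 4 (λ a b t x → a :* (t :* x) :+ b :* x := (a :* t :+ b) :* x) ≈-refl α β _ _ ⟩
  factor D i j (weight y) * tensor P₁ (M ∙ v) y
    ≈⟨ *-congˡ (P₁-E-factors i js v y) ⟩
  factor D i j (weight y) * (factors D i js (weight y) * tensor P₁ v y)
    ≈⟨ *-assoc _ _ _ ⟨
  factors D i (j ∷ js) (weight y) * tensor P₁ v y ∎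
  where
  M = List.foldr _·_ I (List.map (E-factor i) js)
  α = proj₁ (factor-coefficients D i j)
  β = proj₂ (factor-coefficients D i j)

P₁-E : ∀ i (v : Vect D) → tensor P₁ (E i ∙ v) ≈ᵥ tensor P₁ v at i
P₁-E {D} i v y = ≈-trans (P₁-E-factors i (List.upTo (suc D)) v y) (*-congʳ (factors-δ i (weight≤ y)))

P₁-Eε : ∀ i (v : Vect D) → tensor P₁ (Eε i ∙ v) ≈ᵥ E i ∙ tensor P₁ v
P₁-Eε i v y = begin
  tensor P₁ (Eε i ∙ v) y              ≈⟨ ^⊗-∙ P₁ (Eε i ∙ v) y ⟨
  (P ∙ Eε i ∙ v) y                    ≈⟨ ∙-cong P (·-∙ (P⁻¹ · E i) P v) y ⟩
  (P ∙ (P⁻¹ · E i) ∙ P ∙ v) y         ≈⟨ ∙-cong P (·-∙ P⁻¹ (E i) (P ∙ v)) y ⟩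
  (P ∙ P⁻¹ ∙ E i ∙ P ∙ v) y           ≈⟨ ·-∙ P P⁻¹ (E i ∙ P ∙ v) y ⟨
  ((P · P⁻¹) ∙ E i ∙ P ∙ v) y         ≈⟨ ∙-congˡ P·P⁻¹≈I (E i ∙ P ∙ v) y ⟩
  (I ∙ E i ∙ P ∙ v) y                 ≈⟨ I-∙ (E i ∙ P ∙ v) y ⟩
  (E i ∙ P ∙ v) y                     ≈⟨ ∙-cong (E i) (^⊗-∙ P₁ v) y ⟩
  (E i ∙ tensor P₁ v) y               ∎

-- Each `P` advances one step along the cycle of idempotents: P P Eε = P E P = E* P P.
P₁²-Eε : ∀ i (v : Vect D) → tensor P₁ (tensor P₁ (Eε i ∙ v)) ≈ᵥ tensor P₁ (tensor P₁ v) at i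
P₁²-Eε i v y = ≈-trans (tensor-cong P₁ (P₁-Eε i v) y) (P₁-E i (tensor P₁ v) y)

tensor-·₂ : ∀ {K L K′ L′} → K ·₂ L ≈₂ K′ ·₂ L′ → (v : Vect D) → tensor K (tensor L v) ≈ᵥ tensor K′ (tensor L′ v)
tensor-·₂ {K = K} {L} {K′} {L′} p v y =
  ≈-trans (tensor-tensor K L v y) (≈-trans (tensor-congˡ p v y) (≈-sym (tensor-tensor K′ L′ v y)))

tensor-scalar : ∀ {K} c → K ≈₂ (λ a b → c * diag₂ 1# a b) → (v : Vect D) → tensor K v ≈ᵥ (c ^ D) *ᵥ v
tensor-scalar c p v y = ≈-trans (tensor-scaled c p v y)
  (*-congˡ (≈-trans (tensor-diag₂ 1# v y) (≈-trans (*-congʳ (one-^ (weight y))) (*-identityˡ _))))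

-- Closes the cycle: three applications of `P` give a nonzero multiple of the identity, so
-- conditions on `P³ v` are conditions on `v` itself.
P₁³-scalar : (v : Vect D) → tensor P₁ (tensor P₁ (tensor P₁ v)) ≈ᵥ ((2ᶜ - 2ᶜ * 𝕚) ^ D) *ᵥ v
P₁³-scalar v y = ≈-trans (tensor-cong P₁ (tensor-P₁² v) y)
  (≈-trans (tensor-tensor P₁ P₁² v y) (tensor-scalar (2ᶜ - 2ᶜ * 𝕚)
    (≈₂-computed ≡.refl ≡.refl ≡.refl ≡.refl ≡.refl ≡.refl ≡.refl ≡.refl) v y))

tensor-sum : ∀ K m (f : ℕ → Vect D) →
  tensor K (λ y → sum {m} (λ k → f (toℕ k) y)) ≈ᵥ λ y → sum {m} (λ k → tensor K (f (toℕ k)) y)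
tensor-sum K zero    f y = ≈-trans (tensor-cong K (λ _ → ≈-sym (zeroˡ 0#)) y)
  (≈-trans (tensor-*ᵥ K 0# (λ _ → 0#) y) (zeroˡ _))
tensor-sum K (suc m) f y = begin
  tensor K (λ z → f 0 z + sum {m} (λ k → f (suc (toℕ k)) z)) y
    ≈⟨ tensor-cong K (λ z → ≈-sym (+-cong (*-identityˡ (f 0 z)) (*-identityˡ _))) y ⟩
  tensor K (1# *ᵥ f 0 +ᵥ 1# *ᵥ (λ z → sum {m} (λ k → f (suc (toℕ k)) z))) y
    ≈⟨ tensor-linear K 1# 1# (f 0) (λ z → sum {m} (λ k → f (suc (toℕ k)) z)) y ⟩
  1# * tensor K (f 0) y + 1# * tensor K (λ z → sum {m} (λ k → f (suc (toℕ k)) z)) y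
    ≈⟨ +-cong (*-identityˡ _) (≈-trans (*-identityˡ _) (tensor-sum K m (f ∘ suc) y)) ⟩
  tensor K (f 0) y + sum {m} (λ k → tensor K (f (suc (toℕ k))) y) ∎

sum-at : ∀ (f : ℕ → ℂ) (v : Vect D) y → sum {suc D} (λ k → f (toℕ k) * (v at toℕ k) y) ≈ (f ⊛ v) y
sum-at {D} f v y = begin
  sum {suc D} (λ k → f (toℕ k) * (δ (weight y) (toℕ k) * v y))
    ≈⟨ sum-cong-≋ {suc D} (λ k → ⊛-at f v (toℕ k) y) ⟨
  sum {suc D} (λ k → f (weight y) * (δ (weight y) (toℕ k) * v y))
    ≈⟨ sum-cong-≋ {suc D} (λ k → solve 3 (λ f d x → f :* (d :* x) := d :* (f :* x))
        ≈-refl (f (weight y)) (δ (weight y) (toℕ k)) (v y)) ⟩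
  sum {suc D} (λ k → δ (weight y) (toℕ k) * (f (weight y) * v y))
    ≈⟨ *-distribʳ-sum {suc D} (f (weight y) * v y) (λ k → δ (weight y) (toℕ k)) ⟨
  sum {suc D} (λ k → δ (weight y) (toℕ k)) * (f (weight y) * v y)
    ≈⟨ *-congʳ (sum-δ (s≤s (weight≤ y))) ⟩
  1# * (f (weight y) * v y)
    ≈⟨ *-identityˡ _ ⟩
  f (weight y) * v y ∎

-- T-modules

tensor-zero : ∀ K {v : Vect D} → v ≈ᵥ 0ᵥ → tensor K v ≈ᵥ 0ᵥ
tensor-zero K {v} p y = begin
  tensor K v y         ≈⟨ tensor-cong K (λ z → ≈-trans (p z) (≈-sym (zeroˡ (v z)))) y ⟩
  tensor K (0# *ᵥ v) y ≈⟨ tensor-*ᵥ K 0# v y ⟩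
  0# * tensor K v y    ≈⟨ zeroˡ _ ⟩
  0#                   ∎

derivation-zero : ∀ M {v : Vect D} → v ≈ᵥ 0ᵥ → derivation M v ≈ᵥ 0ᵥ
derivation-zero M {v} p y = begin
  derivation M v y         ≈⟨ derivation-cong M (λ z → ≈-trans (p z) (≈-sym (zeroˡ (v z)))) y ⟩
  derivation M (0# *ᵥ v) y ≈⟨ derivation-*ᵥ M 0# v y ⟩
  0# * derivation M v y    ≈⟨ zeroˡ _ ⟩
  0#                       ∎

tensor-P₁-reflects-zero : {v : Vect D} → tensor P₁ v ≈ᵥ 0ᵥ → v ≈ᵥ 0ᵥ
tensor-P₁-reflects-zero p = tensor-P₁-injective
  (λ y → ≈-trans (p y) (≈-sym (tensor-zero P₁ {0ᵥ} (λ _ → ≈-refl) y)))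

-- Propagation of a vanishing weight component

at-weight : (v : Vect D) (y : Vertex D) → (v at weight y) y ≈ v y
at-weight v y = ≈-trans (*-congʳ (δ-refl (weight y))) (*-identityˡ _)

fromℕ-suc-cancel : ∀ m {z} → fromℕ (suc m) * z ≈ 0# → z ≈ 0#
fromℕ-suc-cancel m p = invertible-cancelˡ (fromℕ-suc-inverse m) (≈-trans p (≈-sym (zeroʳ _)))

-- By `lowering`, `n` maps the component of weight k+1 to D - r - k times the component of weight k.
-- The hypothesis on D makes this scalar m+1, which is invertible.
at-predecessor-zero : ∀ {r k m} → D ≡ r ℕ.+ (suc m ℕ.+ k) → {v : Vect D} → HighestWeight r (tensor P₁ v) →
  v at suc k ≈ᵥ 0ᵥ → v at k ≈ᵥ 0ᵥ
at-predecessor-zero {D} {r} {k} {m} D≡ {v} h p y = fromℕ-suc-cancel m (begin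
  fromℕ (suc m) * (v at k) y
    ≈⟨ *-congʳ (solve 3 (λ r m k → m := (r :+ (m :+ k)) :- r :- k) ≈-refl (fromℕ r) _ (fromℕ k)) ⟩
  (fromℕ r + (fromℕ (suc m) + fromℕ k) - fromℕ r - fromℕ k) * (v at k) y
    ≈⟨ *-congʳ (+-congʳ (+-congʳ fromℕ-D)) ⟨
  (fromℕ D - fromℕ r - fromℕ k) * (v at k) y
    ≈⟨ ⊛-at (λ j → fromℕ D - fromℕ r - fromℕ j) v k y ⟨
  (fromℕ D - fromℕ r - fromℕ (weight y)) * (δ (weight y) k * v y)
    ≈⟨ solve 3 (λ l d x → l :* (d :* x) := d :* (l :* x)) ≈-refl _ _ _ ⟩
  δ (weight y) k * ((fromℕ D - fromℕ r - fromℕ (weight y)) * v y)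
    ≈⟨ *-congˡ (lowering h y) ⟨
  (derivation n v at k) y
    ≈⟨ derivation-n-at k v y ⟨
  derivation n (v at suc k) y
    ≈⟨ derivation-zero n p y ⟩
  0# ∎)
  where
  fromℕ-D : fromℕ D ≈ fromℕ r + (fromℕ (suc m) + fromℕ k)
  fromℕ-D = ≈-trans (≈-reflexive (≡.cong fromℕ D≡))
    (≈-trans (fromℕ-homo-+ r (suc m ℕ.+ k)) (+-congˡ (fromℕ-homo-+ (suc m) k)))

derivation-nᵀ-at : ∀ k (v : Vect D) → derivation nᵀ v at suc k ≈ᵥ derivation nᵀ (v at k)
derivation-nᵀ-at k v = derivation-nᵀ-⊛ (λ j → δ j (suc k)) v

-- By `raising`, `nᵀ` maps the component of weight m + r to m+1 times the next one.
at-successor-zero : ∀ {r m} {v : Vect D} → HighestWeight r (tensor P₁ v) →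
  v at (m ℕ.+ r) ≈ᵥ 0ᵥ → v at suc (m ℕ.+ r) ≈ᵥ 0ᵥ
at-successor-zero {D} {r} {m} {v} h p y = fromℕ-suc-cancel m (begin
  fromℕ (suc m) * (v at k) y
    ≈⟨ *-congʳ (solve 2 (λ m r → m := (m :+ r) :- r) ≈-refl _ (fromℕ r)) ⟩
  (fromℕ (suc m) + fromℕ r - fromℕ r) * (v at k) y
    ≈⟨ *-congʳ (+-congʳ (fromℕ-homo-+ (suc m) r)) ⟨
  (fromℕ k - fromℕ r) * (v at k) y
    ≈⟨ ⊛-at (λ j → fromℕ j - fromℕ r) v k y ⟨
  (fromℕ (weight y) - fromℕ r) * (δ (weight y) k * v y)
    ≈⟨ solve 3 (λ l d x → l :* (d :* x) := d :* (l :* x)) ≈-refl _ _ _ ⟩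
  δ (weight y) k * ((fromℕ (weight y) - fromℕ r) * v y)
    ≈⟨ *-congˡ (raising h y) ⟨
  (derivation nᵀ v at k) y
    ≈⟨ derivation-nᵀ-at (m ℕ.+ r) v y ⟩
  derivation nᵀ (v at (m ℕ.+ r)) y
    ≈⟨ derivation-zero nᵀ p y ⟩
  0# ∎)
  where
  k = suc (m ℕ.+ r)

-- Downward propagation from k meets the scalars D - r - j with j < k, which are nonzero as k ≤ D -
-- r; upward propagation meets j + 1 - r with j ≥ k, nonzero as k ≥ r. So one vanishing component
-- inside the range forces all of them to vanish.
component-zero⇒zero : ∀ {r k} → r ≤ k → k ℕ.+ r ≤ D → {v : Vect D} → HighestWeight r (tensor P₁ v) →
  v at k ≈ᵥ 0ᵥ → v ≈ᵥ 0ᵥ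
component-zero⇒zero {D} {r} {k} r≤k k+r≤D {v} h p y = ≈-trans (≈-sym (at-weight v y)) (everywhere (weight y) y)
  where
  down : ∀ e {j} → e ℕ.+ j ≡ k → v at j ≈ᵥ 0ᵥ
  down zero    ≡.refl = p
  -- Here D - r - j equals e + s + 1, where s is the slack D - (k + r).
  down (suc e) {j} eq = at-predecessor-zero {m = e ℕ.+ s} D≡ h (down e (≡.trans (ℕ.+-suc e j) eq))
    where
    s = D ℕ.∸ (k ℕ.+ r)
    D≡ : D ≡ r ℕ.+ (suc (e ℕ.+ s) ℕ.+ j)
    D≡ = ≡.trans (≡.sym (ℕ.m∸n+n≡m k+r≤D)) (≡.trans (≡.cong (λ k → s ℕ.+ (k ℕ.+ r)) (≡.sym eq))
      (solveℕ 4 (λ s e j r → s :+ℕ (conℕ 1 :+ℕ e :+ℕ j :+ℕ r) :=ℕ r :+ℕ (conℕ 1 :+ℕ (e :+ℕ s) :+ℕ j))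
          ≡.refl s e j r))
  up : ∀ e → v at (e ℕ.+ k) ≈ᵥ 0ᵥ
  up zero    = p
  up (suc e) = ≡.subst (λ j → v at suc j ≈ᵥ 0ᵥ) (eq e)
    (at-successor-zero {m = e ℕ.+ (k ℕ.∸ r)} h (≡.subst (λ j → v at j ≈ᵥ 0ᵥ) (≡.sym (eq e)) (up e)))
    where
    eq : ∀ e → e ℕ.+ (k ℕ.∸ r) ℕ.+ r ≡ e ℕ.+ k
    eq e = ≡.trans (ℕ.+-assoc e (k ℕ.∸ r) r) (≡.cong (e ℕ.+_) (ℕ.m∸n+n≡m r≤k))
  everywhere : ∀ j → v at j ≈ᵥ 0ᵥ
  everywhere j with ℕ.≤-total j k
  ... | inj₁ j≤k = down (k ℕ.∸ j) (ℕ.m∸n+n≡m j≤k)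
  ... | inj₂ k≤j = ≡.subst (λ i → v at i ≈ᵥ 0ᵥ) (ℕ.m∸n+n≡m k≤j) (up (j ℕ.∸ k))

interval-size : ∀ {n} a m (S : Subset n) → a ℕ.+ m ≤ n →
  (∀ i → i Subset.∈ S → a ≤ toℕ i × toℕ i < a ℕ.+ m) →
  (∀ i → a ≤ toℕ i → toℕ i < a ℕ.+ m → i Subset.∈ S) → Subset.∣ S ∣ ≡ m
interval-size zero zero [] _ _ _ = ≡.refl
interval-size (suc a) m (inside ∷ S) _ sound _ = contradiction (proj₁ (sound zero here)) λ ()
interval-size (suc a) m (outside ∷ S) (s≤s p) sound complete = interval-size a m S p
  (λ i i∈S → let q , r = sound (suc i) (there i∈S) in ℕ.s≤s⁻¹ q , ℕ.s≤s⁻¹ r)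
  (λ i q r → drop-there (complete (suc i) (s≤s q) (s≤s r)))
interval-size zero zero (inside ∷ S) _ sound _ = contradiction (proj₂ (sound zero here)) λ ()
interval-size zero zero (outside ∷ S) _ sound complete = interval-size zero zero S z≤n
  (λ i i∈S → contradiction (proj₂ (sound (suc i) (there i∈S))) λ ())
  (λ i _ ())
interval-size zero (suc m) (inside ∷ S) (s≤s p) sound complete = ≡.cong suc (interval-size zero m S p
  (λ i i∈S → z≤n , ℕ.s≤s⁻¹ (proj₂ (sound (suc i) (there i∈S))))
  (λ i _ r → drop-there (complete (suc i) z≤n (s≤s r))))
interval-size zero (suc m) (outside ∷ S) _ _ complete with complete zero z≤n (s≤s z≤n)
... | ()

P₁³-highest : ∀ {r} {v : Vect D} → HighestWeight r v → HighestWeight r (tensor P₁ (tensor P₁ (tensor P₁ v)))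
P₁³-highest {D} {v = v} h =
  HighestWeight-resp (λ y → ≈-sym (P₁³-scalar v y)) (HighestWeight-*ᵥ ((2ᶜ - 2ᶜ * 𝕚) ^ D) h)

-- Operators that preserve a T-module

module TModule {D} (W : Subspace D) (isTModule : IsTModule W) where

  affine-closed : ∀ {M} → T M → ∀ α β {w} → w ∈ member W → α *ᵥ (M ∙ w) +ᵥ β *ᵥ w ∈ member W
  affine-closed M∈T α β w∈W = +∈ W (*∈ W α (isTModule M∈T w∈W)) (*∈ W β w∈W)

  E-closed : ∀ i {w} → w ∈ member W → E i ∙ w ∈ member W
  E-closed i {w} w∈W = go (List.upTo (suc D))
    where
    go : ∀ js → List.foldr _·_ I (List.map (E-factor i) js) ∙ w ∈ member W
    go []       = isTModule I∈T w∈W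
    go (j ∷ js) = resp W (λ y → ≈-sym (≈-trans (·-∙ (E-factor i j) M w y) (E-factor-∙ i j (M ∙ w) y)))
      (affine-closed A∈T _ _ (go js))
      where M = List.foldr _·_ I (List.map (E-factor i) js)

  -- `A*` has eigenvalue θ k on weight k, so the Lagrange factors that build `E i` from `A` build
  -- the projection to weight i from the generator `A*`.
  at-closed : ∀ i {w} → w ∈ member W → w at i ∈ member W
  at-closed i {w} w∈W = resp W (λ y → *-congʳ (factors-δ i (weight≤ y))) (go (List.upTo (suc D)))
    where
    go : ∀ js → factors D i js ⊛ w ∈ member W
    go []       = resp W (λ y → ≈-sym (*-identityˡ (w y))) w∈W
    go (j ∷ js) = resp W (λ y → ≈-trans (+-congʳ (*-congˡ (diag-∙ (λ z → fromℤ (θ D (weight z))) v y)))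
        (solve 5 (λ a b t f x → a :* (t :* (f :* x)) :+ b :* (f :* x) := (a :* t :+ b) :* f :* x) ≈-refl
          α β (fromℤ (θ D (weight y))) (factors D i js (weight y)) (w y)))
      (affine-closed A*∈T α β (go js))
      where
      v = factors D i js ⊛ w
      α = proj₁ (factor-coefficients D i j)
      β = proj₂ (factor-coefficients D i j)

  sum-closed : ∀ m (f : ℕ → Vect D) → (∀ k → f k ∈ member W) → (λ y → sum {m} (λ k → f (toℕ k) y)) ∈ member W
  sum-closed zero    f p = 0∈ W
  sum-closed (suc m) f p = +∈ W (p 0) (sum-closed m (f ∘ suc) (p ∘ suc))

  ⊛-closed : ∀ f {w} → w ∈ member W → f ⊛ w ∈ member W
  ⊛-closed f {w} w∈W = resp W (sum-at f w)
    (sum-closed (suc D) (λ k → f k *ᵥ (w at k)) (λ k → *∈ W (f k) (at-closed k w∈W)))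

  -- The conjugate of f ⊛ by P is Σₖ f k E k.
  conjugate-closed : ∀ f {w} → w ∈ member W → ∃ λ s → s ∈ member W × tensor P₁ s ≈ᵥ f ⊛ tensor P₁ w
  conjugate-closed f {w} w∈W = (λ y → sum {suc D} (λ k → g (toℕ k) y)) ,
    sum-closed (suc D) g (λ k → *∈ W (f k) (E-closed k w∈W)) , λ y → begin
      tensor P₁ (λ z → sum {suc D} (λ k → g (toℕ k) z)) y
        ≈⟨ tensor-sum P₁ (suc D) g y ⟩
      sum {suc D} (λ k → tensor P₁ (g (toℕ k)) y)
        ≈⟨ sum-cong-≋ {suc D} (λ k → ≈-trans (tensor-*ᵥ P₁ (f (toℕ k)) (E (toℕ k) ∙ w) y)
             (*-congˡ (P₁-E (toℕ k) w y))) ⟩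
      sum {suc D} (λ k → f (toℕ k) * (tensor P₁ w at toℕ k) y)
        ≈⟨ sum-at f (tensor P₁ w) y ⟩
      (f ⊛ tensor P₁ w) y ∎
    where
    g : ℕ → Vect D
    g k = f k *ᵥ (E k ∙ w)

  -- P₁ P₁ = (1 - 𝕚) Z P₁ Z with Z = diag (1 , 𝕚), so P is a multiple of (P⁻¹ Z^⊗ P) Z^⊗.
  P₁-closed : ∀ {w} → w ∈ member W → tensor P₁ w ∈ member W
  P₁-closed {w} w∈W =
    -- The vector `s` is known only through `tensor P₁ s`, so c s and P w are compared after one
    -- further application of `P`.
    resp W (tensor-P₁-injective (λ y → begin
      tensor P₁ (c *ᵥ proj₁ s) y
        ≈⟨ tensor-*ᵥ P₁ c (proj₁ s) y ⟩
      c * tensor P₁ (proj₁ s) y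
        ≈⟨ *-congˡ (proj₂ (proj₂ s) y) ⟩
      c * ((𝕚 ^_) ⊛ tensor P₁ ((𝕚 ^_) ⊛ w)) y
        ≈⟨ *-congˡ (tensor-diag₂ 𝕚 _ y) ⟨
      c * tensor Z (tensor P₁ ((𝕚 ^_) ⊛ w)) y
        ≈⟨ *-congˡ (tensor-cong Z (tensor-cong P₁ (tensor-diag₂ 𝕚 w)) y) ⟨
      c * tensor Z (tensor P₁ (tensor Z w)) y
        ≈⟨ *-congˡ (tensor-cong Z (tensor-tensor P₁ Z w) y) ⟩
      c * tensor Z (tensor (P₁ ·₂ Z) w) y
        ≈⟨ *-congˡ (tensor-tensor Z (P₁ ·₂ Z) w y) ⟩
      c * tensor (Z ·₂ (P₁ ·₂ Z)) w y
        ≈⟨ tensor-scaled (1# - 𝕚) P₁²≈ w y ⟨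
      tensor P₁² w y
        ≈⟨ tensor-P₁² w y ⟨
      tensor P₁ (tensor P₁ w) y ∎))
    (*∈ W c (proj₁ (proj₂ s)))
    where
    s = conjugate-closed (𝕚 ^_) (⊛-closed (𝕚 ^_) w∈W)
    c = (1# - 𝕚) ^ D
    Z = diag₂ 𝕚
    P₁²≈ : P₁² ≈₂ (λ a b → (1# - 𝕚) * (Z ·₂ (P₁ ·₂ Z)) a b)
    P₁²≈ = ≈₂-computed ≡.refl ≡.refl ≡.refl ≡.refl ≡.refl ≡.refl ≡.refl ≡.refl

  -- `P₁` diagonalises σˣ to diag (1 , -1), so the antipodal map is Σₖ (-1)^k `E k`.
  σˣ-closed : ∀ {w} → w ∈ member W → tensor σˣ w ∈ member W
  σˣ-closed {w} w∈W =
    resp W (tensor-P₁-injective (λ y → ≈-trans (proj₂ (proj₂ s) y)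
      (≈-trans (≈-sym (tensor-diag₂ (- 1#) (tensor P₁ w) y)) (tensor-·₂ ZP₁≈P₁σˣ w y)))) (proj₁ (proj₂ s))
    where
    s = conjugate-closed ((- 1#) ^_) w∈W
    ZP₁≈P₁σˣ : diag₂ (- 1#) ·₂ P₁ ≈₂ P₁ ·₂ σˣ
    ZP₁≈P₁σˣ = ≈₂-computed ≡.refl ≡.refl ≡.refl ≡.refl ≡.refl ≡.refl ≡.refl ≡.refl

  -- Endpoint, support and diameter

  module Endpoint {r} (isEndpoint : IsEndpoint W r) where
    open IsEndpoint isEndpoint

    -- If `w y` were nonzero, so would be `E* (weight y)` W, and minimality of r would give r ≤
    -- `weight y`. This only refutes that `w y` is nonzero, hence the appeal to stability.
    zero-below : ∀ {w} → w ∈ member W → ∀ y → weight y < r → w y ≈ 0#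
    zero-below {w} w∈W y y<r = ≈-stable λ w≉0 → ℕ.<⇒≱ y<r (least (weight y) (weight≤ y) λ isZero →
      w≉0 (≈-trans (≈-sym (at-weight w y)) (isZero (w , w∈W , λ z → ≈-sym (E*-∙ (weight y) w z)) y)))

    -- The antipodal map preserves W and sends a weight above D - r to one below r. Applying it
    -- twice recovers the component.
    zero-above : ∀ {w} → w ∈ member W → ∀ y → D ℕ.∸ r < weight y → w y ≈ 0#
    zero-above {w} w∈W y D∸r<y = begin
      w y
        ≈⟨ at-weight w y ⟨
      (w at weight y) y
        ≈⟨ involutive (w at weight y) y ⟨
      tensor σˣ (tensor σˣ (w at weight y)) y
        ≈⟨ tensor-zero σˣ (λ z → ≈-trans (tensor-σˣ-⊛ (λ k → δ k (weight y)) w z) (flipped z)) y ⟩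
      0# ∎
      where
      involutive : ∀ v → tensor σˣ (tensor σˣ v) ≈ᵥ v
      involutive v z = ≈-trans (tensor-tensor σˣ σˣ v z)
        (≈-trans (tensor-scalar 1#
          (≈₂-computed ≡.refl ≡.refl ≡.refl ≡.refl ≡.refl ≡.refl ≡.refl ≡.refl) v z)
        (≈-trans (*-congʳ (one-^ D)) (*-identityˡ (v z))))
      flipped : ∀ z → δ (D ℕ.∸ weight z) (weight y) * tensor σˣ w z ≈ 0#
      flipped z with D ℕ.∸ weight z ℕ.≟ weight y
      ... | yes eq = ≈-trans (*-congˡ (zero-below (σˣ-closed w∈W) z
              (ℕ.≰⇒> λ r≤z → ℕ.<⇒≱ D∸r<y (≡.subst (_≤ D ℕ.∸ r) eq (ℕ.∸-monoʳ-≤ D r≤z))))) (zeroʳ _)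
      ... | no ne  = ≈-trans (*-congʳ (δ-≢ ne)) (zeroˡ _)

    -- Otherwise every weight would be below r or above D - r, and every vector of W would vanish.
    r≤D∸r : r ≤ D ℕ.∸ r
    r≤D∸r = ℕ.≮⇒≥ λ D∸r<r → nonzero λ { (w , w∈W , v≈) y → ≈-trans (v≈ y) (≈-trans (E*-∙ r w y)
      (≈-trans (*-congˡ (vanish D∸r<r w∈W y)) (zeroʳ _))) }
      where
      vanish : D ℕ.∸ r < r → ∀ {w} → w ∈ member W → w ≈ᵥ 0ᵥ
      vanish D∸r<r w∈W y with ℕ.≤-total r (weight y)
      ... | inj₁ r≤y = zero-above w∈W y (ℕ.<-≤-trans D∸r<r r≤y)
      ... | inj₂ y≤r with weight y ℕ.<? r
      ...   | yes y<r = zero-below w∈W y y<r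
      ...   | no  y≮r = zero-above w∈W y (ℕ.<-≤-trans D∸r<r (ℕ.≮⇒≥ y≮r))

    -- Let p be the weight r component of w. Then A p = N p + Nᵀ p lies in W, so it vanishes at
    -- weight r - 1, while Nᵀ p lives at weight r + 1. Hence N p vanishes at weight r - 1, the only
    -- weight where it could be nonzero.
    highest-weight : ∀ {w} → w ∈ member W → HighestWeight r (w at r)
    HighestWeight.homogeneous (highest-weight {w} w∈W) y =
      ≈-trans (⊛-at (λ k → δ k r) w r y) (≈-trans (*-congʳ (δ-refl r)) (*-identityˡ _))
    HighestWeight.annihilated (highest-weight {w} w∈W) y with suc (weight y) ℕ.≟ r
    ... | no  ne     = ≈-trans (derivation-n-⊛ (λ k → δ k r) w y) (≈-trans (*-congʳ (δ-≢ ne)) (zeroˡ _))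
    ... | yes ≡.refl = begin
      derivation n p y
        ≈⟨ solve 2 (λ a b → a := :1 :* a :+ :1 :* b :- b) ≈-refl _ (derivation nᵀ p y) ⟩
      1# * derivation n p y + 1# * derivation nᵀ p y - derivation nᵀ p y
        ≈⟨ +-cong (≈-sym (derivation-linearˡ 1# 1# σˣ≈n+nᵀ p y)) (-‿cong raised) ⟩
      derivation σˣ p y - 0#
        ≈⟨ +-congʳ (≈-trans (≈-sym (A-∙ p y)) (zero-below (isTModule A∈T (at-closed r w∈W)) y ℕ.≤-refl)) ⟩
      0# - 0#
        ≈⟨ solve 0 (:0 :- :0 := :0) ≈-refl ⟩
      0# ∎
      where
      p = w at r
      σˣ≈n+nᵀ : ∀ a b → σˣ a b ≈ 1# * n a b + 1# * nᵀ a b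
      σˣ≈n+nᵀ = ≈₂-computed ≡.refl ≡.refl ≡.refl ≡.refl ≡.refl ≡.refl ≡.refl ≡.refl
      raised : derivation nᵀ p y ≈ 0#
      raised = ≈-trans (≈-sym (derivation-nᵀ-at r w y))
        (≈-trans (*-congʳ (δ-≢ {weight y} {suc r} (λ eq → ℕ.<⇒≢ (ℕ.m≤n⇒m≤1+n ℕ.≤-refl) eq))) (zeroˡ _))

    -- If all weight k components of W vanish, then so does that of P² (w at r), a vector which `P`
    -- carries to a highest weight vector. It is therefore zero, and so is the weight r component of
    -- every w, against the choice of r.
    interior-nonzero : ∀ {k} → r ≤ k → k ≤ D ℕ.∸ r → ¬ IsZero (E* k [ W ])
    interior-nonzero {k} r≤k k≤D∸r isZero = nonzero λ { (w , w∈W , v≈) y →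
      ≈-trans (v≈ y) (≈-trans (E*-∙ r w y) (vanish w∈W y)) }
      where
      k+r≤D : k ℕ.+ r ≤ D
      k+r≤D = ℕ.≤-trans (ℕ.+-monoˡ-≤ r k≤D∸r) (ℕ.≤-reflexive (ℕ.m∸n+n≡m r≤D))
      vanish : ∀ {w} → w ∈ member W → w at r ≈ᵥ 0ᵥ
      -- Two applications of `P` are right because a third one returns to a multiple of `w at r`.
      vanish {w} w∈W = tensor-P₁-reflects-zero (tensor-P₁-reflects-zero (component-zero⇒zero r≤k k+r≤D
          (P₁³-highest (highest-weight w∈W))
          (isZero (u , P₁-closed (P₁-closed (at-closed r w∈W)) , λ y → ≈-sym (E*-∙ k u y)))))
        where
        u = tensor P₁ (tensor P₁ (w at r))

    diameter : ∀ {d} → IsDiameter W d → D ≡ d ℕ.+ (r ℕ.+ r)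
    diameter {d} isDiameter = ≡.sym (≡.trans (≡.cong (ℕ._+ (r ℕ.+ r)) d≡) (ℕ.m∸n+n≡m r+r≤D))
      where
      open IsDiameter isDiameter
      r+r≤D : r ℕ.+ r ≤ D
      r+r≤D = ℕ.≤-trans (ℕ.+-monoˡ-≤ r r≤D∸r) (ℕ.≤-reflexive (ℕ.m∸n+n≡m r≤D))
      -- The expected diameter: the support will be the half-open interval from r to r + e + 1.
      e = D ℕ.∸ (r ℕ.+ r)
      r+e≡ : r ℕ.+ e ≡ D ℕ.∸ r
      r+e≡ = ≡.trans (≡.cong (r ℕ.+_) (≡.sym (ℕ.∸-+-assoc D r r))) (ℕ.m+[n∸m]≡n r≤D∸r)
      sound : ∀ i → i Subset.∈ support → r ≤ toℕ i × toℕ i < r ℕ.+ suc e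
      sound i i∈S =
        ℕ.≮⇒≥ (λ i<r → E*ᵢW≠0 λ { (w , w∈W , v≈) y →
            zero-on w v≈ y λ eq → zero-below w∈W y (≡.subst (_< r) (≡.sym eq) i<r) }) ,
        ≡.subst (toℕ i <_) (≡.trans (≡.cong suc (≡.sym r+e≡)) (≡.sym (ℕ.+-suc r e)))
          (s≤s (ℕ.≮⇒≥ (λ D∸r<i → E*ᵢW≠0 λ { (w , w∈W , v≈) y →
            zero-on w v≈ y λ eq → zero-above w∈W y (≡.subst (D ℕ.∸ r <_) (≡.sym eq) D∸r<i) })))
        where
        E*ᵢW≠0 = Equivalence.to (∈-support i) i∈S
        zero-on : ∀ w {v} → v ≈ᵥ E* (toℕ i) ∙ w → ∀ y → (weight y ≡ toℕ i → w y ≈ 0#) → v y ≈ 0#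
        zero-on w v≈ y p with weight y ℕ.≟ toℕ i
        ... | yes eq = ≈-trans (v≈ y) (≈-trans (E*-∙ (toℕ i) w y) (≈-trans (*-congˡ (p eq)) (zeroʳ _)))
        ... | no  ne = ≈-trans (v≈ y) (≈-trans (E*-∙ (toℕ i) w y) (≈-trans (*-congʳ (δ-≢ ne)) (zeroˡ _)))
      complete : ∀ i → r ≤ toℕ i → toℕ i < r ℕ.+ suc e → i Subset.∈ support
      complete i r≤i i<r+1+e = Equivalence.from (∈-support i) (interior-nonzero r≤i
        (≡.subst (toℕ i ≤_) r+e≡ (ℕ.s≤s⁻¹ (≡.subst (toℕ i <_) (ℕ.+-suc r e) i<r+1+e))))
      d≡ : d ≡ e
      d≡ = ℕ.suc-injective (≡.trans (≡.sym size) (interval-size r (suc e) support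
        (≡.subst (_≤ suc D) (≡.sym (≡.trans (ℕ.+-suc r e) (≡.cong suc r+e≡))) (s≤s (ℕ.m∸n≤m D r))) sound complete))

    -- The three identities

    module Diameter {d} (isDiameter : IsDiameter W d) where

      -- The common statement behind all three parts. Membership of `a` in W confines its weights to
      -- r, ..., r + d, so that the sum over all weights is a full binomial sum.
      formula : ∀ i j (a b : Vect D) → a ∈ member W →
        HighestWeight r (tensor P₁ a) → HighestWeight r (tensor P₁ (tensor P₁ b)) →
        ⟨ a at (r ℕ.+ i) , b at (r ℕ.+ j) ⟩
        ≈ δ i j * 𝕚 ^ i * fromℕ (d C i) * [1+𝕚]⁻¹ ^ d * ⟨ a , b ⟩
      formula i j a b a∈W ha hb = begin
        ⟨ a at (r ℕ.+ i) , b at (r ℕ.+ j) ⟩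
          ≈⟨ pairing-at r i j a b ⟩
        δ i j * ⟨ a at (r ℕ.+ i) , b ⟩
          ≈⟨ *-congˡ (pairing-formula (diameter isDiameter) ha
               (HighestWeight-resp (tensor-P₁² b) hb) below above i) ⟩
        δ i j * (𝕚 ^ i * fromℕ (d C i) * [1+𝕚]⁻¹ ^ d * ⟨ a , b ⟩)
          ≈⟨ solve 5 (λ d i c e x → d :* (i :* c :* e :* x) := d :* i :* c :* e :* x) ≈-refl _ _ _ _ _ ⟩
        δ i j * 𝕚 ^ i * fromℕ (d C i) * [1+𝕚]⁻¹ ^ d * ⟨ a , b ⟩ ∎
        where
        D∸r≡ : D ℕ.∸ r ≡ r ℕ.+ d
        D∸r≡ = ≡.trans (≡.cong (ℕ._∸ r) (≡.trans (diameter isDiameter) (≡.sym (ℕ.+-assoc d r r))))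
          (≡.trans (ℕ.m+n∸n≡m (d ℕ.+ r) r) (ℕ.+-comm d r))
        zero-at : ∀ k → (∀ y → weight y ≡ k → a y ≈ 0#) → a at k ≈ᵥ 0ᵥ
        zero-at k p y with weight y ℕ.≟ k
        ... | yes eq = ≈-trans (*-congˡ (p y eq)) (zeroʳ _)
        ... | no  ne = ≈-trans (*-congʳ (δ-≢ ne)) (zeroˡ _)
        below : ∀ k → k < r → a at k ≈ᵥ 0ᵥ
        below k k<r = zero-at k λ { y ≡.refl → zero-below a∈W y k<r }
        above : ∀ k → r ℕ.+ d < k → a at k ≈ᵥ 0ᵥ
        above k r+d<k = zero-at k λ { y ≡.refl → zero-above a∈W y (≡.subst (_< k) (≡.sym D∸r≡) r+d<k) }

      module _ (i j : ℕ) {u u* uε w w* wε : Vect D}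
        (w∈W : w ∈ member W)   (u≈ : u ≈ᵥ E r ∙ w)
        (w*∈W : w* ∈ member W) (u*≈ : u* ≈ᵥ E* r ∙ w*)
        (wε∈W : wε ∈ member W) (uε≈ : uε ≈ᵥ Eε r ∙ wε) where
        private
          coefficient = δ i j * 𝕚 ^ i * fromℕ (d C i) * [1+𝕚]⁻¹ ^ d

          u∈W : u ∈ member W
          u∈W = resp W (λ y → ≈-sym (u≈ y)) (E-closed r w∈W)

          w*-at≈u* : w* at r ≈ᵥ u*
          w*-at≈u* y = ≈-sym (≈-trans (u*≈ y) (E*-∙ r w* y))

          u*∈W : u* ∈ member W
          u*∈W = resp W w*-at≈u* (at-closed r w*∈W)

          Puε∈W : tensor P₁ uε ∈ member W
          Puε∈W = resp W (λ y → ≈-sym (≈-trans (tensor-cong P₁ uε≈ y) (P₁-Eε r wε y)))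
            (E-closed r (P₁-closed wε∈W))

          u*-highest : HighestWeight r u*
          u*-highest = HighestWeight-resp w*-at≈u* (highest-weight w*∈W)

          Pu-highest : HighestWeight r (tensor P₁ u)
          Pu-highest = HighestWeight-resp (λ y → ≈-sym (≈-trans (tensor-cong P₁ u≈ y) (P₁-E r w y)))
            (highest-weight (P₁-closed w∈W))

          -- P² uε is the weight r component of P² wε, which lies in W.
          P²uε-highest : HighestWeight r (tensor P₁ (tensor P₁ uε))
          P²uε-highest = HighestWeight-resp
            (λ y → ≈-sym (≈-trans (tensor-cong P₁ (tensor-cong P₁ uε≈) y) (P₁²-Eε r wε y)))
            (highest-weight (P₁-closed (P₁-closed wε∈W)))

        -- One `P` turns `E` into `E*`, so a = P uε and b = P u*. Then P a = P² uε, while P² b = P³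
        -- u* is a multiple of u*.
        E-pairing : ⟨ E (r ℕ.+ i) ∙ uε , E (r ℕ.+ j) ∙ u* ⟩ ≈ coefficient * ⟨ uε , u* ⟩
        E-pairing = P₁-transfer _ _ uε u* (begin
          ⟨ tensor P₁ (E (r ℕ.+ i) ∙ uε) , tensor P₁ (E (r ℕ.+ j) ∙ u*) ⟩
            ≈⟨ ⟨⟩-congˡ (tensor P₁ (E (r ℕ.+ j) ∙ u*)) (P₁-E (r ℕ.+ i) uε) ⟩
          ⟨ tensor P₁ uε at (r ℕ.+ i) , tensor P₁ (E (r ℕ.+ j) ∙ u*) ⟩
            ≈⟨ ⟨⟩-congʳ (tensor P₁ uε at (r ℕ.+ i)) (P₁-E (r ℕ.+ j) u*) ⟩
          ⟨ tensor P₁ uε at (r ℕ.+ i) , tensor P₁ u* at (r ℕ.+ j) ⟩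
            ≈⟨ formula i j (tensor P₁ uε) (tensor P₁ u*) Puε∈W P²uε-highest (P₁³-highest u*-highest) ⟩
          coefficient * ⟨ tensor P₁ uε , tensor P₁ u* ⟩ ∎)

        -- The projections are already those of `A*`, so a = u and b = uε are used as they stand.
        E*-pairing : ⟨ E* (r ℕ.+ i) ∙ u , E* (r ℕ.+ j) ∙ uε ⟩ ≈ coefficient * ⟨ u , uε ⟩
        E*-pairing = begin
          ⟨ E* (r ℕ.+ i) ∙ u , E* (r ℕ.+ j) ∙ uε ⟩
            ≈⟨ ⟨⟩-congˡ (E* (r ℕ.+ j) ∙ uε) (E*-∙ (r ℕ.+ i) u) ⟩
          ⟨ u at (r ℕ.+ i) , E* (r ℕ.+ j) ∙ uε ⟩
            ≈⟨ ⟨⟩-congʳ (u at (r ℕ.+ i)) (E*-∙ (r ℕ.+ j) uε) ⟩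
          ⟨ u at (r ℕ.+ i) , uε at (r ℕ.+ j) ⟩
            ≈⟨ formula i j u uε u∈W Pu-highest P²uε-highest ⟩
          coefficient * ⟨ u , uε ⟩ ∎

        -- `Eε` needs two applications of `P`, so a = P² u* and b = P² u. Then P a = P³ u* and P² b
        -- = P³ (P u) are multiples of u* and P u.
        Eε-pairing : ⟨ Eε (r ℕ.+ i) ∙ u* , Eε (r ℕ.+ j) ∙ u ⟩ ≈ coefficient * ⟨ u* , u ⟩
        Eε-pairing = P₁-transfer _ _ u* u (P₁-transfer _ _ (tensor P₁ u*) (tensor P₁ u) (begin
          ⟨ tensor P₁ (tensor P₁ (Eε (r ℕ.+ i) ∙ u*)) , tensor P₁ (tensor P₁ (Eε (r ℕ.+ j) ∙ u)) ⟩
            ≈⟨ ⟨⟩-congˡ (tensor P₁ (tensor P₁ (Eε (r ℕ.+ j) ∙ u))) (P₁²-Eε (r ℕ.+ i) u*) ⟩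
          ⟨ tensor P₁ (tensor P₁ u*) at (r ℕ.+ i) , tensor P₁ (tensor P₁ (Eε (r ℕ.+ j) ∙ u)) ⟩
            ≈⟨ ⟨⟩-congʳ (tensor P₁ (tensor P₁ u*) at (r ℕ.+ i)) (P₁²-Eε (r ℕ.+ j) u) ⟩
          ⟨ tensor P₁ (tensor P₁ u*) at (r ℕ.+ i) , tensor P₁ (tensor P₁ u) at (r ℕ.+ j) ⟩
            ≈⟨ formula i j (tensor P₁ (tensor P₁ u*)) (tensor P₁ (tensor P₁ u))
                 (P₁-closed (P₁-closed u*∈W)) (P₁³-highest u*-highest) (P₁³-highest Pu-highest) ⟩
          coefficient * ⟨ tensor P₁ (tensor P₁ u*) , tensor P₁ (tensor P₁ u) ⟩ ∎))

theorem11p4 :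
    ∀ (D : ℕ) → 0 < D →
    (W : Subspace D) → IsIrreducible W →
    ∀ (r d : ℕ) → IsEndpoint W r → IsDiameter W d →
    ∀ (i j : ℕ) → i ≤ d → j ≤ d →
    ∀ (u u* uε : Vect D) →
    u ∈ E r [ W ] → ¬ (u ≈ᵥ 0ᵥ) →
    u* ∈ E* r [ W ] → ¬ (u* ≈ᵥ 0ᵥ) →
    uε ∈ Eε r [ W ] → ¬ (uε ≈ᵥ 0ᵥ) →
    (⟨ E (r ℕ.+ i) ∙ uε , E (r ℕ.+ j) ∙ u* ⟩
      ≈ δ i j * 𝕚 ^ i * fromℕ (d C i) * [1+𝕚]⁻¹ ^ d * ⟨ uε , u* ⟩) ×
    (⟨ E* (r ℕ.+ i) ∙ u , E* (r ℕ.+ j) ∙ uε ⟩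
      ≈ δ i j * 𝕚 ^ i * fromℕ (d C i) * [1+𝕚]⁻¹ ^ d * ⟨ u , uε ⟩) ×
    (⟨ Eε (r ℕ.+ i) ∙ u* , Eε (r ℕ.+ j) ∙ u ⟩
      ≈ δ i j * 𝕚 ^ i * fromℕ (d C i) * [1+𝕚]⁻¹ ^ d * ⟨ u* , u ⟩)
theorem11p4 D _ W irreducible r d endpoint isDiameter i j _ _ u u* uε
  (w , w∈W , u≈) _ (w* , w*∈W , u*≈) _ (wε , wε∈W , uε≈) _ =
  E-pairing i j w∈W u≈ w*∈W u*≈ wε∈W uε≈ ,
  E*-pairing i j w∈W u≈ w*∈W u*≈ wε∈W uε≈ ,
  Eε-pairing i j w∈W u≈ w*∈W u*≈ wε∈W uε≈
  where
  open TModule W (IsIrreducible.isTModule irreducible)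
  open Endpoint endpoint
  open Diameter isDiameter
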